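{- Let $X_0\subset\mathbb{P}^6$ be the singular del Pezzo surface of degree $6$ described in the context. Then the saturation number satisfies $r(X_0(\mathbb{Z}),x_0\cdots x_6)\leq 45$; that is, the set of primitive vectors $\mathbf{x}=(x_0,\ldots,x_6)\in\mathbb{Z}^7$ with $[\mathbf{x}]\in X_0$ and such that $x_0\cdots x_6$ is a product of at most $45$ primes is Zariski dense in $X_0$.
   Context: $X_0\subset\mathbb{P}^6$ denotes a (split) singular del Pezzo surface of degree $6$ defined over $\mathbb{Q}$, anticanonically embedded as an intersection of $9$ quadrics, with a single singularity of type $\mathbf{A}_2$ and with both of its two lines defined over $\mathbb{Q}$. Concretely, $X_0$ is the image of the affine hypersurface $\eta_2\alpha_1^2+\eta_3\alpha_2+\eta_4\alpha_3=0$ in $\mathbb{A}^7$ (coordinates $\eta_1,\ldots,\eta_4,\alpha_1,\alpha_2,\alpha_3$) under the morphism $(\boldsymbol\eta,\boldsymbol\alpha)\mapsto(\alpha_2\alpha_3,\ \eta^{(1,1,1,0)}\alpha_1\alpha_2,\ \eta^{(1,1,0,1)}\alpha_1\alpha_3,\ \eta^{(2,1,2,1)}\alpha_2,\ \eta^{(2,1,1,2)}\alpha_3,\ \eta^{(4,2,3,3)},\ \eta^{(3,2,2,2)}\alpha_1)$, where $\eta^{(a,b,c,d)}=\eta_1^a\eta_2^b\eta_3^c\eta_4^d$ (more precisely, the Zariski closure of the image of the open subset where this is defined). Rational points of $X_0$ are identified with primitive integer vectors $\mathbf{x}\in\mathbb{Z}^7$ (up to sign), giving $X_0(\mathbb{Z})$.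 The saturation number $r(X_0(\mathbb{Z}),x_0\cdots x_6)$ is the least $r$ such that the set of $\mathbf{x}\in\mathbb{Z}^7$ with $[\mathbf{x}]\in X_0(\mathbb{Z})$ and $x_0\cdots x_6$ a product of at most $r$ primes (counted with multiplicity, up to sign) is Zariski dense in $X_0$. -}

module Defs where

open import Data.Nat as ℕ using (ℕ; _≤_)
open import Data.Nat.Divisibility using (_∣_)
open import Data.Nat.Primality using (Prime)
open import Data.Integer using (ℤ; _+_; _*_; _^_; ∣_∣; 0ℤ; 1ℤ)
open import Data.Fin using (Fin)
open import Data.Vec using (Vec; []; _∷_; lookup; foldr; zipWith)
open import Data.List as L using (List; length)
open import Data.Nat.ListAction using (product)
open import Data.List.Relation.Unary.All using (All)
open import Data.Product using (_×_; ∃; proj₁; proj₂; _,_)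
open import Relation.Binary.PropositionalEquality using (_≡_)

Monomial : Set
Monomial = ℤ × Vec ℕ 7

Poly : Set
Poly = List Monomial

Homogeneous : ℕ → Poly → Set
Homogeneous d F = All (λ m → foldr _ ℕ._+_ 0 (proj₂ m) ≡ d) F

evalMono : Vec ℤ 7 → Monomial → ℤ
evalMono x (c , e) = c * foldr _ _*_ 1ℤ (zipWith _^_ x e)

eval : Poly → Vec ℤ 7 → ℤ
eval L.[] x = 0ℤ
eval (m L.∷ F) x = evalMono x m + eval F x

η^ : ℤ → ℤ → ℤ → ℤ → ℕ → ℕ → ℕ → ℕ → ℤ
η^ η₁ η₂ η₃ η₄ a b c d = η₁ ^ a * η₂ ^ b * η₃ ^ c * η₄ ^ d

OnTorsor : ℤ → ℤ → ℤ → ℤ → ℤ → ℤ → ℤ → Set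
OnTorsor η₁ η₂ η₃ η₄ α₁ α₂ α₃ = η₂ * α₁ ^ 2 + η₃ * α₂ + η₄ * α₃ ≡ 0ℤ

-- The parametrising morphism into 𝔸⁷ (affine cone over ℙ⁶).
φ : ℤ → ℤ → ℤ → ℤ → ℤ → ℤ → ℤ → Vec ℤ 7
φ η₁ η₂ η₃ η₄ α₁ α₂ α₃ =
  α₂ * α₃ ∷
  η^ η₁ η₂ η₃ η₄ 1 1 1 0 * α₁ * α₂ ∷
  η^ η₁ η₂ η₃ η₄ 1 1 0 1 * α₁ * α₃ ∷
  η^ η₁ η₂ η₃ η₄ 2 1 2 1 * α₂ ∷
  η^ η₁ η₂ η₃ η₄ 2 1 1 2 * α₃ ∷
  η^ η₁ η₂ η₃ η₄ 4 2 3 3 ∷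
  η^ η₁ η₂ η₃ η₄ 3 2 2 2 * α₁ ∷ []

-- A homogeneous polynomial vanishes on X₀ iff it vanishes on the image
-- of φ (the image is Zariski dense in X₀ by definition of X₀ as its
-- closure; integer points of the torsor hypersurface are Zariski dense
-- in it, since it is the graph of α₃ over the locus η₄ = 1, etc.).
VanishesOnX₀ : Poly → Set
VanishesOnX₀ F =
  ∀ η₁ η₂ η₃ η₄ α₁ α₂ α₃ → OnTorsor η₁ η₂ η₃ η₄ α₁ α₂ α₃ →
    eval F (φ η₁ η₂ η₃ η₄ α₁ α₂ α₃) ≡ 0ℤ

-- x lies on (the affine cone over) X₀ = Zariski closure of the image:
-- every homogeneous polynomial vanishing on X₀ vanishes at x.
InX₀ : Vec ℤ 7 → Set
InX₀ x = ∀ d F → Homogeneous d F → VanishesOnX₀ F → eval F x ≡ 0ℤ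

Primitive : Vec ℤ 7 → Set
Primitive x = ∀ (k : ℕ) → (∀ (i : Fin 7) → k ∣ ∣ lookup x i ∣) → k ≡ 1

coordProduct : Vec ℤ 7 → ℤ
coordProduct x = foldr _ _*_ 1ℤ x

AtMostPrimes : ℕ → ℤ → Set
AtMostPrimes r n = ∃ λ (ps : List ℕ) →
  All Prime ps × length ps ≤ r × product ps ≡ ∣ n ∣

S : ℕ → Vec ℤ 7 → Set
S r x = Primitive x × InX₀ x × AtMostPrimes r (coordProduct x)

ZariskiDenseInX₀ : (Vec ℤ 7 → Set) → Set
ZariskiDenseInX₀ T =
  ∀ d F → Homogeneous d F → (∀ x → T x → eval F x ≡ 0ℤ) → VanishesOnX₀ F

{-# OPTIONS --safe #-}
-- On the chart η = (1,1,1,1) the surface is parametrised by x = (bc, ab, ac, b, c, 1, a) with a² + b + c = 0, and the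
-- product of the coordinates is (abc)³. Take a = 2p with p prime, b = n and c = −(n + 4p²). It suffices that, for every p,
-- infinitely many n make n(n + 4p²) a product of at most 13 primes: then abc has at most 15, and its cube at most 45.
-- Such n come from a two-dimensional Brun–Hooley lower bound sieve with Kuhn's weights. Restrict n to a residue class
-- W k + β in which n(n + h) has no small prime factor, and let k < 2^90x. Sifting by the primes up to 2^3x, split into
-- ranges (2^3q, 2^6q], and weighting by 8 − #{primes in (2^3x, 2^24x] dividing n(n + h)} leaves a positive total. The
-- resulting n(n + h) is free of primes up to 2^3x and has at most 7 prime factors up to 2^24x (squares of such primes are
-- removed separately), so that 14 prime factors would force n(n + h) ≥ 2^(7·3x + 7·24x) = 2^189x, which is too large.
-- The density of sieving primes, Σ 1/p over (2^x, 2^(x+m)], is controlled by Chebyshev's argument with multinomials.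
-- Density then follows since a polynomial with infinitely many integer zeros vanishes, applied first in b, then in a,
-- and finally along curves in the torsor to reach the points where some ηᵢ = 0.
module Submission where

open import Defs

-- The prime factors of `a` count towards the bound, and `h = a²` must be even, since otherwise n (n
-- + h) is always even; `a = 2p` has just two prime factors and still takes infinitely many values.
-- Throughout, `x = 2^d q` with `q` fixed and `d` growing: `W`, `β` and `h` are then constants, and
-- losing a constant factor per block, 64^d in all, costs a power of `x`, negligible beside 2^x.
-- Hence no sharp density is needed, only the ratio between the lower and the upper sieve sum, which
-- crude explicit bounds keep away from 0. The exponents form a budget: the truncated blocks cost
-- 65x, the window 24x more, and 89x lies below the range 90x; both forms then stay below 2^91x,
-- hence their product below 2^189x. A sieve expression is a syntax tree because it is read in three
-- ways: at the actual indicators, at their densities, and as a bound for the rounding error.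
-- Squares need separate treatment because Kuhn's weight counts each prime only once.

module AlmostPrimeValues where
  open import Data.Nat
  open import Data.Nat.Properties
  open import Data.Nat.Divisibility hiding (quotient)
  open import Data.Nat.DivMod using (m≡m%n+[m/n]*n; m/n*n≤m; m%n<n)
  open import Data.Nat.Primality
  open import Data.Nat.Primality.Factorisation using (factorise; PrimeFactorisation)
  open import Data.Nat.Coprimality as Co using (Coprime)
  open import Data.Nat.GCD using (module Bézout)
  open import Data.Nat.ListAction using (product)
  open import Data.Nat.ListAction.Properties using (∈⇒∣product)
  open import Data.Rational as ℚ using (ℚ; 0ℚ; 1ℚ)
  import Data.Rational.Properties as ℚₚ
  open import Data.List using (List; []; _∷_; _++_; length)
  open import Data.List.Membership.Propositional using (_∈_)
  open import Data.List.Membership.Propositional.Properties using (∈-++⁺ˡ; ∈-++⁺ʳ)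
  open import Data.List.Relation.Unary.All as All using (All; []; _∷_)
  open import Data.List.Relation.Unary.Any using (here; there)
  open import Data.Maybe using (Maybe; just; nothing)
  open import Data.Product
  open import Data.Sum using (_⊎_; inj₁; inj₂; [_,_]′)
  open import Data.Empty using (⊥-elim)
  open import Data.Unit using (⊤; tt)
  open import Relation.Binary.PropositionalEquality
  open import Relation.Nullary
  open import Algebra.Bundles using (CommutativeRing)
  open import Algebra.Structures using (IsCommutativeRing)
  open import Level using (0ℓ)
  open import Data.Nat.Tactic.RingSolver using () renaming (solve-∀ to ℕ-solve)
  import Tactic.RingSolver as RS
  open import Tactic.RingSolver.Core.AlmostCommutativeRing using (AlmostCommutativeRing; fromCommutativeRing)

  -- The rational numbers as an ordered ring with reciprocals

  infixl 6 _⊕_ _⊖_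
  infixl 7 _⊗_
  infix 8 ⊝_
  infix 4 _≼_

  -- K is ℚ; its operations are opaque because those of ℚ reduce even on variables.
  opaque
    K : Set
    K = ℚ

    _⊕_ _⊗_ : K → K → K
    _⊕_ = ℚ._+_
    _⊗_ = ℚ._*_

    ⊝_ : K → K
    ⊝_ = ℚ.-_

    0K 1K : K
    0K = 0ℚ
    1K = 1ℚ

    _≼_ : K → K → Set
    _≼_ = ℚ._≤_

    isCommutativeRing : IsCommutativeRing _≡_ _⊕_ _⊗_ ⊝_ 0K 1K
    isCommutativeRing = CommutativeRing.isCommutativeRing ℚₚ.+-*-commutativeRing

    isZero : (x : K) → Maybe (0K ≡ x)
    isZero x with 0ℚ ℚ.≟ x
    ... | yes p = just p
    ... | no _ = nothing

    ≼-refl : ∀ {a} → a ≼ a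
    ≼-refl = ℚₚ.≤-refl

    ≼-trans : ∀ {a b c} → a ≼ b → b ≼ c → a ≼ c
    ≼-trans = ℚₚ.≤-trans

    ⊕-mono : ∀ {a b c d} → a ≼ b → c ≼ d → a ⊕ c ≼ b ⊕ d
    ⊕-mono = ℚₚ.+-mono-≤

    ⊝-anti : ∀ {a b} → a ≼ b → ⊝ b ≼ ⊝ a
    ⊝-anti = ℚₚ.neg-antimono-≤

    ⊗-monoˡ : ∀ {a b} c → 0K ≼ c → a ≼ b → c ⊗ a ≼ c ⊗ b
    ⊗-monoˡ c p q = ℚₚ.*-monoˡ-≤-nonNeg c {{ℚ.nonNegative p}} q

    0≼1 : 0K ≼ 1K
    0≼1 = ℚₚ.nonNegative⁻¹ 1ℚ

    1⋠0 : ¬ 1K ≼ 0K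
    1⋠0 p = ℚₚ.<-irrefl refl (ℚₚ.<-≤-trans (ℚₚ.positive⁻¹ 1ℚ) p)

    -- Reciprocals, with the junk value recip 0 = 0.
    recip : K → K
    recip x with x ℚ.≟ 0ℚ
    ... | yes _ = 0ℚ
    ... | no x≢0 = ℚ.1/_ x {{ℚ.≢-nonZero x≢0}}

    recip-inverse : ∀ {x} → 1K ≼ x → recip x ⊗ x ≡ 1K
    recip-inverse {x} 1≤x with x ℚ.≟ 0ℚ
    ... | yes refl = ⊥-elim (1⋠0 1≤x)
    ... | no x≢0 = ℚₚ.*-inverseˡ x {{ℚ.≢-nonZero x≢0}}

    recip≥0 : ∀ {x} → 0K ≼ x → 0K ≼ recip x
    recip≥0 {x} x≥0 with x ℚ.≟ 0ℚ
    ... | yes _ = ℚₚ.≤-refl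
    ... | no x≢0 = ℚₚ.nonNegative⁻¹ (ℚ.1/_ x {{ℚ.≢-nonZero x≢0}})
      {{ℚₚ.pos⇒nonNeg (ℚ.1/_ x {{ℚ.≢-nonZero x≢0}})
        {{ℚₚ.1/pos⇒pos x {{ℚₚ.nonNeg∧nonZero⇒pos x {{ℚ.nonNegative x≥0}} {{ℚ.≢-nonZero x≢0}}}}}}}}

  _⊖_ : K → K → K
  a ⊖ b = a ⊕ ⊝ b

  K-commutativeRing : CommutativeRing 0ℓ 0ℓ
  K-commutativeRing = record { isCommutativeRing = isCommutativeRing }

  K-ring : AlmostCommutativeRing 0ℓ 0ℓ
  K-ring = fromCommutativeRing K-commutativeRing isZero

  open CommutativeRing K-commutativeRing using () renaming
    ( +-identityˡ to ⊕-identityˡ; +-identityʳ to ⊕-identityʳ; +-comm to ⊕-comm; +-assoc to ⊕-assoc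
    ; *-identityˡ to ⊗-identityˡ; *-identityʳ to ⊗-identityʳ; *-comm to ⊗-comm; *-assoc to ⊗-assoc
    ; zeroˡ to ⊗-zeroˡ; zeroʳ to ⊗-zeroʳ; distribˡ to ⊗-distribˡ; distribʳ to ⊗-distribʳ; -‿inverseʳ to ⊖-self ) public

  ≼-reflexive : ∀ {a b} → a ≡ b → a ≼ b
  ≼-reflexive refl = ≼-refl

  ⊗-monoʳ : ∀ {a b} c → 0K ≼ c → a ≼ b → a ⊗ c ≼ b ⊗ c
  ⊗-monoʳ {a} {b} c p q = subst₂ _≼_ (⊗-comm c a) (⊗-comm c b) (⊗-monoˡ c p q)

  diff⇒≼ : ∀ {a b} → 0K ≼ b ⊖ a → a ≼ b
  diff⇒≼ {a} {b} p = subst₂ _≼_ (⊕-identityˡ a) (e b a) (⊕-mono p (≼-refl {a}))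
    where
    opaque
      unfolding K
      e : ∀ b a → (b ⊖ a) ⊕ a ≡ b
      e = RS.solve-∀ K-ring

  ≼⇒diff : ∀ {a b} → a ≼ b → 0K ≼ b ⊖ a
  ≼⇒diff {a} {b} p = subst (_≼ b ⊖ a) (⊖-self a) (⊕-mono p (≼-refl {⊝ a}))

  0≼⊕ : ∀ {a b} → 0K ≼ a → 0K ≼ b → 0K ≼ a ⊕ b
  0≼⊕ {a} {b} p q = subst (_≼ a ⊕ b) (⊕-identityˡ 0K) (⊕-mono p q)

  0≼⊗ : ∀ {a b} → 0K ≼ a → 0K ≼ b → 0K ≼ a ⊗ b
  0≼⊗ {a} {b} p q = subst (_≼ a ⊗ b) (⊗-zeroʳ a) (⊗-monoˡ a p q)

  ⊗-mono : ∀ {a b c d} → 0K ≼ b → 0K ≼ c → a ≼ b → c ≼ d → a ⊗ c ≼ b ⊗ d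
  ⊗-mono {a} {b} {c} {d} pb pc p q = ≼-trans (⊗-monoʳ c pc p) (⊗-monoˡ b pb q)

  ⊖-mono : ∀ {a b c d} → a ≼ b → c ≼ d → a ⊖ d ≼ b ⊖ c
  ⊖-mono p q = ⊕-mono p (⊝-anti q)

  opaque
    ι : ℕ → K
    ι zero = 0K
    ι (suc n) = 1K ⊕ ι n

    ι-0 : ι 0 ≡ 0K
    ι-0 = refl

    ι-suc : ∀ n → ι (suc n) ≡ 1K ⊕ ι n
    ι-suc n = refl

  ι-1 : ι 1 ≡ 1K
  ι-1 = trans (ι-suc 0) (trans (cong (1K ⊕_) ι-0) (⊕-identityʳ 1K))

  ι-+ : ∀ m n → ι (m + n) ≡ ι m ⊕ ι n
  ι-+ zero n = sym (trans (cong (_⊕ ι n) ι-0) (⊕-identityˡ (ι n)))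
  ι-+ (suc m) n = begin
    ι (suc (m + n))     ≡⟨ ι-suc (m + n) ⟩
    1K ⊕ ι (m + n)      ≡⟨ cong (1K ⊕_) (ι-+ m n) ⟩
    1K ⊕ (ι m ⊕ ι n)    ≡⟨ sym (⊕-assoc 1K (ι m) (ι n)) ⟩
    (1K ⊕ ι m) ⊕ ι n    ≡⟨ cong (_⊕ ι n) (sym (ι-suc m)) ⟩
    ι (suc m) ⊕ ι n     ∎
    where open ≡-Reasoning

  ι-* : ∀ m n → ι (m * n) ≡ ι m ⊗ ι n
  ι-* zero n = trans ι-0 (sym (trans (cong (_⊗ ι n) ι-0) (⊗-zeroˡ (ι n))))
  ι-* (suc m) n = begin
    ι (n + m * n)          ≡⟨ ι-+ n (m * n) ⟩
    ι n ⊕ ι (m * n)        ≡⟨ cong (ι n ⊕_) (ι-* m n) ⟩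
    ι n ⊕ ι m ⊗ ι n        ≡⟨ e (ι n) (ι m) ⟩
    (1K ⊕ ι m) ⊗ ι n       ≡⟨ cong (_⊗ ι n) (sym (ι-suc m)) ⟩
    ι (suc m) ⊗ ι n        ∎
    where
    open ≡-Reasoning
    opaque
      unfolding K
      e : ∀ x y → x ⊕ y ⊗ x ≡ (1K ⊕ y) ⊗ x
      e = RS.solve-∀ K-ring

  ι≥0 : ∀ n → 0K ≼ ι n
  ι≥0 zero = ≼-reflexive (sym ι-0)
  ι≥0 (suc n) = subst (0K ≼_) (sym (ι-suc n)) (0≼⊕ 0≼1 (ι≥0 n))

  ι-mono : ∀ {m n} → m ≤ n → ι m ≼ ι n
  ι-mono {m} {n} p = subst₂ _≼_ (⊕-identityʳ (ι m))
    (trans (sym (ι-+ m (n ∸ m))) (cong ι (m+[n∸m]≡n p))) (⊕-mono (≼-refl {ι m}) (ι≥0 (n ∸ m)))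

  ι-cancel-≤ : ∀ {m n} → ι m ≼ ι n → m ≤ n
  ι-cancel-≤ {m} {n} p with m ≤? n
  ... | yes q = q
  ... | no ¬q = ⊥-elim (1⋠0 (subst₂ _≼_ eq (⊖-self (ι n)) (⊖-mono (≼-trans (ι-mono (≰⇒> ¬q)) p) (≼-refl {ι n}))))
    where
    opaque
      unfolding K
      e : ∀ x → (1K ⊕ x) ⊖ x ≡ 1K
      e = RS.solve-∀ K-ring
    eq : ι (suc n) ⊖ ι n ≡ 1K
    eq = trans (cong (_⊖ ι n) (ι-suc n)) (e (ι n))

  inv : ℕ → K
  inv n = recip (ι n)

  inv-inverse : ∀ n → .{{NonZero n}} → inv n ⊗ ι n ≡ 1K
  inv-inverse (suc n) = recip-inverse (subst (_≼ ι (suc n)) ι-1 (ι-mono (s≤s z≤n)))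

  inv≥0 : ∀ n → 0K ≼ inv n
  inv≥0 n = recip≥0 (ι≥0 n)

  ⊗-cancel-≼ : ∀ n {a b} → .{{NonZero n}} → ι n ⊗ a ≼ ι n ⊗ b → a ≼ b
  ⊗-cancel-≼ n {a} {b} p = subst₂ _≼_ (e a) (e b) (⊗-monoˡ (inv n) (inv≥0 n) p)
    where
    e : ∀ x → inv n ⊗ (ι n ⊗ x) ≡ x
    e x = trans (sym (⊗-assoc (inv n) (ι n) x)) (trans (cong (_⊗ x) (inv-inverse n)) (⊗-identityˡ x))

  -- Residue classes

  opaque
    δ : ℕ → ℕ → ℕ
    δ d n with d ∣? n
    ... | yes _ = 1
    ... | no _ = 0

    δ-yes : ∀ {d n} → d ∣ n → δ d n ≡ 1
    δ-yes {d} {n} p with d ∣? n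
    ... | yes _ = refl
    ... | no ¬p = ⊥-elim (¬p p)

    δ-no : ∀ {d n} → ¬ d ∣ n → δ d n ≡ 0
    δ-no {d} {n} ¬p with d ∣? n
    ... | yes p = ⊥-elim (¬p p)
    ... | no _ = refl

  δ-cong : ∀ {d n e m} → (d ∣ n → e ∣ m) → (e ∣ m → d ∣ n) → δ d n ≡ δ e m
  δ-cong {d} {n} {e} {m} f g with d ∣? n
  ... | yes p = trans (δ-yes p) (sym (δ-yes (f p)))
  ... | no ¬p = trans (δ-no ¬p) (sym (δ-no (λ q → ¬p (g q))))

  Σℕ : ℕ → (ℕ → ℕ) → ℕ
  Σℕ zero f = 0
  Σℕ (suc N) f = f N + Σℕ N f

  -- `s` is the distance from `X` up to the next multiple of `D`. An equality, not a bound, is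
  -- carried along so that two counts can be subtracted; 0 counts as a multiple.
  multiples-below : ∀ D .{{_ : NonZero D}} X → ∃ λ s → s < D × D * Σℕ X (δ D) ≡ X + s × D ∣ X + s
  multiples-below D zero = 0 , >-nonZero⁻¹ D , *-zeroʳ D , D ∣0
  multiples-below D (suc X) = step (multiples-below D X) (D ∣? X)
    where
    count-no : ¬ D ∣ X → D * Σℕ (suc X) (δ D) ≡ D * Σℕ X (δ D)
    count-no ∤X = cong (λ t → D * (t + Σℕ X (δ D))) (δ-no ∤X)
    step : (∃ λ s → s < D × D * Σℕ X (δ D) ≡ X + s × D ∣ X + s) → Dec (D ∣ X) →
      ∃ λ s → s < D × D * Σℕ (suc X) (δ D) ≡ suc X + s × D ∣ suc X + s
    step (zero , s<D , eq , d) (no ∤X) = ⊥-elim (∤X (subst (D ∣_) (+-identityʳ X) d))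
    step (suc s , s<D , eq , d) (no ∤X) =
      s , <-trans (n<1+n s) s<D , trans (count-no ∤X) (trans eq (+-suc X s)) , subst (D ∣_) (+-suc X s) d
    step (suc s , s<D , eq , d) (yes ∣X) = ⊥-elim (>⇒∤ s<D (∣m+n∣m⇒∣n d ∣X))
    step (zero , s<D , eq , d) (yes ∣X) =
      pred D , subst (pred D <_) (suc-pred D) (n<1+n _) , eq₁ , subst (D ∣_) eq₂ (∣m∣n⇒∣m+n ∣-refl ∣X)
      where
      eq₂ : D + X ≡ suc X + pred D
      eq₂ = trans (cong (_+ X) (sym (suc-pred D))) (cong suc (+-comm (pred D) X))
      eq₁ : D * Σℕ (suc X) (δ D) ≡ suc X + pred D
      eq₁ = trans (cong (λ t → D * (t + Σℕ X (δ D))) (δ-yes ∣X))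
        (trans (*-distribˡ-+ D 1 _) (trans (cong₂ _+_ (*-identityʳ D) (trans eq (+-identityʳ X))) eq₂))

  Σℕ-shift : ∀ (f : ℕ → ℕ) c N → Σℕ (N + c) f ≡ Σℕ N (λ k → f (k + c)) + Σℕ c f
  Σℕ-shift f c zero = refl
  Σℕ-shift f c (suc N) = trans (cong (f (N + c) +_) (Σℕ-shift f c N)) (sym (+-assoc (f (N + c)) _ _))

  -- Subtracting the exact counts below `N + c` and below `c` leaves `D * C + s' ≡ N + s`, where
  -- both gaps are less than `D`.
  count-multiples : ∀ D .{{_ : NonZero D}} c N → let C = Σℕ N (λ k → δ D (k + c)) in D * C ≤ N + D × N ≤ D * C + D
  count-multiples D c N with multiples-below D (N + c) | multiples-below D c
  ... | s , s<D , eq , _ | s' , s'<D , eq' , _ =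
    ≤-trans (m≤m+n _ s') (≤-trans (≤-reflexive key) (+-monoʳ-≤ N (<⇒≤ s<D))) ,
    ≤-trans (m≤m+n N s) (≤-trans (≤-reflexive (sym key)) (+-monoʳ-≤ (D * C) (<⇒≤ s'<D)))
    where
    C = Σℕ N (λ k → δ D (k + c))
    r : ∀ a b c → a + b + c ≡ (a + c) + b
    r = ℕ-solve
    key : D * C + s' ≡ N + s
    key = +-cancelʳ-≡ c _ _ (begin
      D * C + s' + c       ≡⟨ r (D * C) s' c ⟩
      D * C + c + s'       ≡⟨ +-assoc (D * C) c s' ⟩
      D * C + (c + s')     ≡⟨ cong (D * C +_) (sym eq') ⟩
      D * C + D * Σℕ c (δ D) ≡⟨ sym (*-distribˡ-+ D C _) ⟩
      D * (C + Σℕ c (δ D))   ≡⟨ cong (D *_) (sym (Σℕ-shift (δ D) c N)) ⟩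
      D * Σℕ (N + c) (δ D)   ≡⟨ eq ⟩
      N + c + s            ≡⟨ r N c s ⟩
      N + s + c            ∎)
      where open ≡-Reasoning

  prime∤⇒coprime : ∀ {p α} → Prime p → ¬ p ∣ α → Coprime p α
  prime∤⇒coprime pp ∤α (d∣p , d∣α) with prime⇒irreducible pp d∣p
  ... | inj₁ d≡1 = d≡1
  ... | inj₂ refl = ⊥-elim (∤α d∣α)

  linear-congruence : ∀ {m α} .{{_ : NonZero m}} → Coprime m α → ∀ γ → ∃ λ i → m ∣ α * i + γ
  linear-congruence {m} {α} cop γ with Co.coprime-Bézout cop
  ... | Bézout.+- x y eq = y * γ , divides (x * γ) (trans (e₁ α y γ) (trans (cong (_* γ) eq) (e₂ x m γ)))
    where
    e₁ : ∀ α y γ → α * (y * γ) + γ ≡ (1 + y * α) * γ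
    e₁ = ℕ-solve
    e₂ : ∀ x m γ → x * m * γ ≡ x * γ * m
    e₂ = ℕ-solve
  -- Here `y * α` is 1 modulo `m`, so a factor -1 is needed; `pred m` represents it.
  ... | Bézout.-+ x y eq = y * (γ * pred m) , divides (x * (γ * pred m) + γ) (begin
      α * (y * (γ * pred m)) + γ        ≡⟨ e₁ α y (γ * pred m) γ ⟩
      y * α * (γ * pred m) + γ          ≡⟨ cong (λ t → t * (γ * pred m) + γ) (sym eq) ⟩
      (1 + x * m) * (γ * pred m) + γ    ≡⟨ e₂ x m γ (pred m) ⟩
      x * (γ * pred m) * m + γ * suc (pred m) ≡⟨ cong (λ t → x * (γ * pred m) * m + γ * t) (suc-pred m) ⟩
      x * (γ * pred m) * m + γ * m      ≡⟨ sym (*-distribʳ-+ m (x * (γ * pred m)) γ) ⟩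
      (x * (γ * pred m) + γ) * m        ∎)
    where
    open ≡-Reasoning
    e₁ : ∀ α y g γ → α * (y * g) + γ ≡ y * α * g + γ
    e₁ = ℕ-solve
    e₂ : ∀ x m γ q → (1 + x * m) * (γ * q) + γ ≡ x * (γ * q) * m + γ * suc q
    e₂ = ℕ-solve

  coprime-*∣ : ∀ {p D x} → Prime p → ¬ p ∣ D → D ∣ x → p ∣ x → D * p ∣ x
  coprime-*∣ {p} {D} pp ∤D (divides q refl) p∣x with euclidsLemma q D pp p∣x
  ... | inj₁ (divides r refl) = divides r (e r p D)
    where
    e : ∀ r p D → r * p * D ≡ r * (D * p)
    e = ℕ-solve
  ... | inj₂ p∣D = ⊥-elim (∤D p∣D)

  -- The class k ≡ −c (mod D) is written D ∣ k + c, so that no subtraction is needed.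
  refine-class : ∀ {p W D} → Prime p → ¬ p ∣ W → ¬ p ∣ D → ∀ c β →
    ∃ λ c′ → ∀ k → (D * p ∣ k + c′ → D ∣ k + c × p ∣ W * k + β) × (D ∣ k + c → p ∣ W * k + β → D * p ∣ k + c′)
  refine-class {p} {W} {D} pp ∤W ∤D c β
    -- For k ≡ -(c + D i), the condition p ∣ W k + β reads W D i + W c - β ≡ 0 modulo p;
    -- `β * pred p` stands for -β.
    with linear-congruence {p} {W * D} {{prime⇒nonZero pp}}
      (prime∤⇒coprime pp (λ d → [ ∤W , ∤D ]′ (euclidsLemma W D pp d))) (W * c + β * pred p)
  ... | i , d = c′ , λ k → (to k , from k)
    where
    instance _ = prime⇒nonZero pp
    c′ = c + D * i
    e₁ : ∀ k c D i → k + (c + D * i) ≡ D * i + (k + c)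
    e₁ = ℕ-solve
    e₂ : ∀ W k β c D i q → W * k + β + (W * D * i + (W * c + β * q)) ≡ β * suc q + W * (k + (c + D * i))
    e₂ = ℕ-solve
    key : ∀ k → W * k + β + (W * D * i + (W * c + β * pred p)) ≡ β * p + W * (k + c′)
    key k = trans (e₂ W k β c D i (pred p)) (cong (λ t → β * t + W * (k + c′)) (suc-pred p))
    to : ∀ k → D * p ∣ k + c′ → D ∣ k + c × p ∣ W * k + β
    to k h = ∣m+n∣m⇒∣n (subst (D ∣_) (e₁ k c D i) (∣-trans (m∣m*n p) h)) (m∣m*n i) ,
      ∣m+n∣m⇒∣n (subst (p ∣_) (trans (sym (key k)) (+-comm (W * k + β) _))
        (∣m∣n⇒∣m+n (n∣m*n β) (∣n⇒∣m*n W (∣-trans (n∣m*n D) h)))) d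
    from : ∀ k → D ∣ k + c → p ∣ W * k + β → D * p ∣ k + c′
    from k hD hp = coprime-*∣ pp ∤D (subst (D ∣_) (sym (e₁ k c D i)) (∣m∣n⇒∣m+n (m∣m*n i) hD))
      ([ (λ w → ⊥-elim (∤W w)) , (λ z → z) ]′ (euclidsLemma W (k + c′) pp
        (∣m+n∣m⇒∣n (subst (p ∣_) (key k) (∣m∣n⇒∣m+n hp d)) (n∣m*n β))))

  prime-square-coprime : ∀ {p W} → Prime p → ¬ p ∣ W → Coprime (p * p) W
  prime-square-coprime {p} {W} pp ∤W {d} (d∣pp , d∣W) = d⊥p (∣-refl , Co.coprime-divisor d⊥p d∣pp)
    where
    d⊥p : Coprime d p
    d⊥p (e∣d , e∣p) = prime∤⇒coprime pp ∤W (e∣p , ∣-trans e∣d d∣W)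

  -- `W` is invertible modulo `m`, so `m` divides the form on a single class of `k`. This serves the
  -- moduli `p * p`, for which an upper bound suffices.
  count-form : ∀ m {W} .{{_ : NonZero m}} → Coprime m W → ∀ β N → m * Σℕ N (λ k → δ m (W * k + β)) ≤ N + m
  count-form m {W} m⊥W β N with linear-congruence m⊥W (β * pred m)
  ... | c , d = ≤-trans (*-monoʳ-≤ m (≤-reflexive (Σℕ-cong same N))) (proj₁ (count-multiples m c N))
    where
    Σℕ-cong : ∀ {f g : ℕ → ℕ} → (∀ k → f k ≡ g k) → ∀ N → Σℕ N f ≡ Σℕ N g
    Σℕ-cong e zero = refl
    Σℕ-cong e (suc N) = cong₂ _+_ (e N) (Σℕ-cong e N)
    e : ∀ W k β c q → W * k + β + (W * c + β * q) ≡ β * suc q + W * (k + c)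
    e = ℕ-solve
    key : ∀ k → W * k + β + (W * c + β * pred m) ≡ β * m + W * (k + c)
    key k = trans (e W k β c (pred m)) (cong (λ t → β * t + W * (k + c)) (suc-pred m))
    same : ∀ k → δ m (W * k + β) ≡ δ m (k + c)
    same k = δ-cong
      (λ h → Co.coprime-divisor m⊥W (∣m+n∣m⇒∣n (subst (m ∣_) (key k) (∣m∣n⇒∣m+n h d)) (n∣m*n β)))
      (λ h → ∣m+n∣m⇒∣n (subst (m ∣_) (trans (sym (key k)) (+-comm (W * k + β) _)) (∣m∣n⇒∣m+n (n∣m*n β) (∣n⇒∣m*n W h)))
        d)

  -- Sums of divisibility indicators over residue classes

  ΣK : ℕ → (ℕ → K) → K
  ΣK zero f = 0K
  ΣK (suc N) f = f N ⊕ ΣK N f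

  ΣK-cong : ∀ {f g : ℕ → K} → (∀ k → f k ≡ g k) → ∀ N → ΣK N f ≡ ΣK N g
  ΣK-cong e zero = refl
  ΣK-cong e (suc N) = cong₂ _⊕_ (e N) (ΣK-cong e N)

  ΣK-⊕ : ∀ (f g : ℕ → K) N → ΣK N (λ k → f k ⊕ g k) ≡ ΣK N f ⊕ ΣK N g
  ΣK-⊕ f g zero = sym (⊕-identityˡ 0K)
  ΣK-⊕ f g (suc N) = trans (cong ((f N ⊕ g N) ⊕_) (ΣK-⊕ f g N)) (e (f N) (g N) (ΣK N f) (ΣK N g))
    where
    opaque
      unfolding K
      e : ∀ a b c d → (a ⊕ b) ⊕ (c ⊕ d) ≡ (a ⊕ c) ⊕ (b ⊕ d)
      e = RS.solve-∀ K-ring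

  ΣK-⊖ : ∀ (f g : ℕ → K) N → ΣK N (λ k → f k ⊖ g k) ≡ ΣK N f ⊖ ΣK N g
  ΣK-⊖ f g zero = sym (⊖-self 0K)
  ΣK-⊖ f g (suc N) = trans (cong ((f N ⊖ g N) ⊕_) (ΣK-⊖ f g N)) (e (f N) (g N) (ΣK N f) (ΣK N g))
    where
    opaque
      unfolding K
      e : ∀ a b c d → (a ⊖ b) ⊕ (c ⊖ d) ≡ (a ⊕ c) ⊖ (b ⊕ d)
      e = RS.solve-∀ K-ring

  ΣK-⊗ʳ : ∀ (f : ℕ → K) c N → ΣK N (λ k → f k ⊗ c) ≡ ΣK N f ⊗ c
  ΣK-⊗ʳ f c zero = sym (⊗-zeroˡ c)
  ΣK-⊗ʳ f c (suc N) = trans (cong (f N ⊗ c ⊕_) (ΣK-⊗ʳ f c N)) (sym (⊗-distribʳ c (f N) (ΣK N f)))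

  ΣK-ι : ∀ (f : ℕ → ℕ) N → ΣK N (λ k → ι (f k)) ≡ ι (Σℕ N f)
  ΣK-ι f zero = sym ι-0
  ΣK-ι f (suc N) = trans (cong (ι (f N) ⊕_) (ΣK-ι f N)) (sym (ι-+ (f N) (Σℕ N f)))

  -- Two-sided, because subtracting a tree turns upper estimates into lower ones.
  Within : K → K → K → Set
  Within r a b = a ≼ b ⊕ r × b ≼ a ⊕ r

  within-≡ : ∀ {r r′ a a′ b b′} → r ≡ r′ → a ≡ a′ → b ≡ b′ → Within r a b → Within r′ a′ b′
  within-≡ refl refl refl w = w

  within-⊕ : ∀ {r s a b c d} → Within r a b → Within s c d → Within (r ⊕ s) (a ⊕ c) (b ⊕ d)
  within-⊕ {r} {s} {a} {b} {c} {d} (p , q) (p′ , q′) =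
    subst (a ⊕ c ≼_) (e b r d s) (⊕-mono p p′) , subst (b ⊕ d ≼_) (e a r c s) (⊕-mono q q′)
    where
    opaque
      unfolding K
      e : ∀ b r d s → (b ⊕ r) ⊕ (d ⊕ s) ≡ (b ⊕ d) ⊕ (r ⊕ s)
      e = RS.solve-∀ K-ring

  within-⊖ : ∀ {r s a b c d} → Within r a b → Within s c d → Within (r ⊕ s) (a ⊖ c) (b ⊖ d)
  within-⊖ {r} {s} {a} {b} {c} {d} (p , q) (p′ , q′) =
    diff⇒≼ (subst (0K ≼_) (e a b c d r s) (0≼⊕ (≼⇒diff p) (≼⇒diff q′))) ,
    diff⇒≼ (subst (0K ≼_) (e b a d c r s) (0≼⊕ (≼⇒diff q) (≼⇒diff p′)))
    where
    opaque
      unfolding K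
      e : ∀ a b c d r s → ((b ⊕ r) ⊖ a) ⊕ ((c ⊕ s) ⊖ d) ≡ ((b ⊖ d) ⊕ (r ⊕ s)) ⊖ (a ⊖ c)
      e = RS.solve-∀ K-ring

  within-⊗ : ∀ {r a b} c → 0K ≼ c → Within r a b → Within (c ⊗ r) (c ⊗ a) (c ⊗ b)
  within-⊗ {r} {a} {b} c c≥0 (p , q) =
    subst (c ⊗ a ≼_) (⊗-distribˡ c b r) (⊗-monoˡ c c≥0 p) ,
    subst (c ⊗ b ≼_) (⊗-distribˡ c a r) (⊗-monoˡ c c≥0 q)

  -- Integer combinations of the indicators of "d divides the product of the two forms", d squarefree.
  data Tree : Set where
    const : ℕ → Tree
    _⊞_ _⊟_ : Tree → Tree → Tree
    hit : ℕ → Tree → Tree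

  eval-tree : (ℕ → K) → Tree → K
  eval-tree v (const c) = ι c
  eval-tree v (A ⊞ B) = eval-tree v A ⊕ eval-tree v B
  eval-tree v (A ⊟ B) = eval-tree v A ⊖ eval-tree v B
  eval-tree v (hit p A) = v p ⊗ eval-tree v A

  -- Each hit splits a residue class into two, so this bounds the accumulated rounding error.
  weight : Tree → ℕ
  weight (const c) = c
  weight (A ⊞ B) = weight A + weight B
  weight (A ⊟ B) = weight A + weight B
  weight (hit p A) = weight A + weight A

  -- Each of the two forms vanishes on exactly one class modulo a prime not dividing `W`: two hits
  -- in `p` values of `k`.
  density : ℕ → K
  density p = inv p ⊕ inv p

  module Forms (W β h : ℕ) where

    form₁ form₂ : ℕ → ℕ
    form₁ k = W * k + β
    form₂ k = W * k + (β + h)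

    hits : ℕ → ℕ → K
    hits k p = ι (δ p (form₁ k)) ⊕ ι (δ p (form₂ k))

    Good : ℕ → Set
    Good p = Prime p × ¬ p ∣ W × ¬ p ∣ h

    -- Primes strictly increase along a branch, so the modulus accumulated so far is never divisible
    -- by the next one; `NoPrimeAbove` is that invariant.
    Ascending : ℕ → Tree → Set
    Ascending x (const _) = ⊤
    Ascending x (A ⊞ B) = Ascending x A × Ascending x B
    Ascending x (A ⊟ B) = Ascending x A × Ascending x B
    Ascending x (hit p A) = x < p × Good p × Ascending p A

    NoPrimeAbove : ℕ → ℕ → Set
    NoPrimeAbove x D = ∀ {p} → Prime p → x < p → ¬ p ∣ D

    class-sum : ℕ → ℕ → ℕ → Tree → K
    class-sum N D c T = ΣK N (λ k → ι (δ D (k + c)) ⊗ eval-tree (hits k) T)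

    -- `hits` is a sum of two indicators, and each of them cuts the class modulo `D` down to one
    -- class modulo `D * p`.
    split-class : ∀ {p D} → Good p → ¬ p ∣ D → ∀ c → ∃₂ λ c₁ c₂ → ∀ N A →
      class-sum N D c (hit p A) ≡ class-sum N (D * p) c₁ A ⊕ class-sum N (D * p) c₂ A
    split-class {p} {D} (pp , ∤W , _) ∤D c = c₁ , c₂ , λ N A →
      trans (ΣK-cong (λ k → pointwise k (eval-tree (hits k) A)) N) (ΣK-⊕ _ _ N)
      where
      refinement : ∀ γ → ∃ λ c′ → ∀ k → (D * p ∣ k + c′ → D ∣ k + c × p ∣ W * k + γ) ×
        (D ∣ k + c → p ∣ W * k + γ → D * p ∣ k + c′)
      refinement = refine-class pp ∤W ∤D c
      c₁ = proj₁ (refinement β)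
      c₂ = proj₁ (refinement (β + h))
      δ-× : ∀ {a b d m n l} → (d ∣ l → a ∣ m × b ∣ n) → (a ∣ m → b ∣ n → d ∣ l) → ι (δ a m) ⊗ ι (δ b n) ≡ ι (δ d l)
      δ-× {a} {b} {d} {m} {n} {l} f g = by-cases (a ∣? m)
        where
        by-cases : Dec (a ∣ m) → ι (δ a m) ⊗ ι (δ b n) ≡ ι (δ d l)
        by-cases (yes q) = trans (cong (_⊗ ι (δ b n)) (trans (cong ι (δ-yes q)) ι-1)) (trans (⊗-identityˡ _)
          (cong ι (δ-cong (g q) (λ z → proj₂ (f z)))))
        by-cases (no ¬q) = trans (cong (_⊗ ι (δ b n)) (trans (cong ι (δ-no ¬q)) ι-0)) (trans (⊗-zeroˡ _)
          (sym (trans (cong ι (δ-no (λ z → ¬q (proj₁ (f z))))) ι-0)))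
      opaque
        unfolding K
        e : ∀ a b c d → a ⊗ ((b ⊕ c) ⊗ d) ≡ (a ⊗ b) ⊗ d ⊕ (a ⊗ c) ⊗ d
        e = RS.solve-∀ K-ring
      pointwise : ∀ k X → ι (δ D (k + c)) ⊗ (hits k p ⊗ X) ≡ ι (δ (D * p) (k + c₁)) ⊗ X ⊕ ι (δ (D * p) (k + c₂)) ⊗ X
      pointwise k X = trans (e (ι (δ D (k + c))) (ι (δ p (form₁ k))) (ι (δ p (form₂ k))) X)
        (cong₂ (λ a b → a ⊗ X ⊕ b ⊗ X)
          (δ-× (proj₁ (proj₂ (refinement β) k)) (proj₂ (proj₂ (refinement β) k)))
          (δ-× (proj₁ (proj₂ (refinement (β + h)) k)) (proj₂ (proj₂ (refinement (β + h)) k))))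

    -- Multiplication by `D` normalises the main term of a class modulo `D` to `N`. A leaf is off by
    -- at most `D` times its constant; a `hit` passes to two classes modulo `D * p`, which doubles
    -- the weight and turns the indicator into its density.
    class-sum-estimate : ∀ N T x D .{{_ : NonZero D}} c → Ascending x T → NoPrimeAbove x D →
      Within (ι D ⊗ ι (weight T)) (ι D ⊗ class-sum N D c T) (ι N ⊗ eval-tree density T)
    class-sum-estimate N (const w) x D c _ _ = within-≡ (⊗-comm (ι w) (ι D)) eq (⊗-comm (ι w) (ι N))
      (within-⊗ (ι w) (ι≥0 w)
        ( subst (ι (D * C) ≼_) (ι-+ N D) (ι-mono (proj₁ (count-multiples D c N)))
        , subst (ι N ≼_) (ι-+ (D * C) D) (ι-mono (proj₂ (count-multiples D c N)))))
      where
      C = Σℕ N (λ k → δ D (k + c))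
      opaque
        unfolding K
        e : ∀ a b c → a ⊗ (b ⊗ c) ≡ b ⊗ (c ⊗ a)
        e = RS.solve-∀ K-ring
      eq : ι w ⊗ ι (D * C) ≡ ι D ⊗ class-sum N D c (const w)
      eq = trans (cong (ι w ⊗_) (ι-* D C)) (trans (e (ι w) (ι D) (ι C))
        (cong (ι D ⊗_) (sym (trans (ΣK-⊗ʳ _ (ι w) N) (cong (_⊗ ι w) (ΣK-ι _ N))))))
    class-sum-estimate N (A ⊞ B) x D c (okA , okB) na = within-≡
      (trans (sym (⊗-distribˡ (ι D) _ _)) (cong (ι D ⊗_) (sym (ι-+ (weight A) (weight B)))))
      (trans (sym (⊗-distribˡ (ι D) _ _)) (cong (ι D ⊗_)
        (sym (trans (ΣK-cong (λ k → ⊗-distribˡ _ _ _) N) (ΣK-⊕ _ _ N)))))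
      (sym (⊗-distribˡ (ι N) _ _))
      (within-⊕ (class-sum-estimate N A x D c okA na) (class-sum-estimate N B x D c okB na))
    class-sum-estimate N (A ⊟ B) x D c (okA , okB) na = within-≡
      (trans (sym (⊗-distribˡ (ι D) _ _)) (cong (ι D ⊗_) (sym (ι-+ (weight A) (weight B)))))
      (trans (sym (e (ι D) _ _)) (cong (ι D ⊗_) (sym (trans (ΣK-cong (λ k → e _ _ _) N) (ΣK-⊖ _ _ N)))))
      (sym (e (ι N) _ _))
      (within-⊖ (class-sum-estimate N A x D c okA na) (class-sum-estimate N B x D c okB na))
      where
      opaque
        unfolding K
        e : ∀ a b c → a ⊗ (b ⊖ c) ≡ a ⊗ b ⊖ a ⊗ c
        e = RS.solve-∀ K-ring
    class-sum-estimate N (hit p A) x D c (x<p , good@(pp , _ , _) , okA) na =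
      -- Dividing by `p` turns the modulus `D * p` of the two subclasses back into `D` and produces
      -- the density 2/p in the main term.
      within-≡ eqR eqS eqM (within-⊗ (inv p) (inv≥0 p) (within-⊕ (step c₁) (step c₂)))
      where
      instance _ = prime⇒nonZero pp
      instance _ = m*n≢0 D p
      classes : ∃₂ λ c₁ c₂ → ∀ N A → class-sum N D c (hit p A) ≡ class-sum N (D * p) c₁ A ⊕ class-sum N (D * p) c₂ A
      classes = split-class good (na pp x<p) c
      c₁ = proj₁ classes
      c₂ = proj₁ (proj₂ classes)
      split = proj₂ (proj₂ classes)
      na′ : NoPrimeAbove p (D * p)
      na′ {q} pq p<q d with euclidsLemma D p pq d
      ... | inj₁ q∣D = na pq (<-trans x<p p<q) q∣D
      ... | inj₂ q∣p = <⇒≱ p<q (∣⇒≤ q∣p)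
      step : ∀ c′ → Within (ι (D * p) ⊗ ι (weight A)) (ι (D * p) ⊗ class-sum N (D * p) c′ A) (ι N ⊗ eval-tree density A)
      step c′ = class-sum-estimate N A p (D * p) c′ okA na′
      opaque
        unfolding K
        e₁ : ∀ i d p x y → i ⊗ ((d ⊗ p) ⊗ x ⊕ (d ⊗ p) ⊗ y) ≡ (i ⊗ p) ⊗ (d ⊗ (x ⊕ y))
        e₁ = RS.solve-∀ K-ring
      opaque
        unfolding K
        e₂ : ∀ i n x → i ⊗ (n ⊗ x ⊕ n ⊗ x) ≡ n ⊗ ((i ⊕ i) ⊗ x)
        e₂ = RS.solve-∀ K-ring
      cancel : ∀ x y → inv p ⊗ (ι (D * p) ⊗ x ⊕ ι (D * p) ⊗ y) ≡ ι D ⊗ (x ⊕ y)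
      cancel x y = trans (cong (λ t → inv p ⊗ (t ⊗ x ⊕ t ⊗ y)) (ι-* D p)) (trans (e₁ (inv p) (ι D) (ι p) x y)
        (trans (cong (_⊗ (ι D ⊗ (x ⊕ y))) (inv-inverse p)) (⊗-identityˡ _)))
      eqS : inv p ⊗ (ι (D * p) ⊗ class-sum N (D * p) c₁ A ⊕ ι (D * p) ⊗ class-sum N (D * p) c₂ A) ≡ ι D ⊗ class-sum N
        D c (hit p A)
      eqS = trans (cancel _ _) (cong (ι D ⊗_) (sym (split N A)))
      eqM : inv p ⊗ (ι N ⊗ eval-tree density A ⊕ ι N ⊗ eval-tree density A) ≡ ι N ⊗ (density p ⊗ eval-tree density A)
      eqM = e₂ (inv p) (ι N) _
      eqR : inv p ⊗ (ι (D * p) ⊗ ι (weight A) ⊕ ι (D * p) ⊗ ι (weight A)) ≡ ι D ⊗ ι (weight A + weight A)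
      eqR = trans (cancel _ _) (cong (ι D ⊗_) (sym (ι-+ (weight A) (weight A))))

  -- Truncated inclusion–exclusion

  -- Brun's truncation: the signed sum over sets of at most `b` primes of `P` of their products of
  -- indicators, multiplied by `A`. Taking `A` as an argument makes products over several blocks
  -- possible.
  truncated : ℕ → List ℕ → Tree → Tree
  truncated zero P A = A
  truncated (suc b) [] A = A
  truncated (suc b) (p ∷ P) A = truncated (suc b) P A ⊟ hit p (truncated b P A)

  -- The elementary symmetric polynomial of degree `k` in the indicators, times `A`; in degree b + 1
  -- it majorises the error of truncating at `b`.
  elementary : ℕ → List ℕ → Tree → Tree
  elementary zero P A = A
  elementary (suc k) [] A = const 0
  elementary (suc k) (p ∷ P) A = elementary (suc k) P A ⊞ hit p (elementary k P A)

  -- The same inequalities are needed for the actual indicators `hits k` and for their expected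
  -- values `density`.
  module Valuation (v : ℕ → K) where

    τ : ℕ → List ℕ → K
    τ zero P = 1K
    τ (suc b) [] = 1K
    τ (suc b) (p ∷ P) = τ (suc b) P ⊖ v p ⊗ τ b P

    ε : ℕ → List ℕ → K
    ε zero P = 1K
    ε (suc k) [] = 0K
    ε (suc k) (p ∷ P) = ε (suc k) P ⊕ v p ⊗ ε k P

    π : List ℕ → K
    π [] = 1K
    π (p ∷ P) = (1K ⊖ v p) ⊗ π P

    σ : List ℕ → K
    σ [] = 0K
    σ (p ∷ P) = v p ⊕ σ P

    eval-truncated : ∀ b P A → eval-tree v (truncated b P A) ≡ τ b P ⊗ eval-tree v A
    eval-truncated zero P A = sym (⊗-identityˡ _)
    eval-truncated (suc b) [] A = sym (⊗-identityˡ _)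
    eval-truncated (suc b) (p ∷ P) A = trans (cong₂ (λ s t → s ⊖ v p ⊗ t) (eval-truncated (suc b) P A)
      (eval-truncated b P A))
      (e (τ (suc b) P) (v p) (τ b P) (eval-tree v A))
      where
      opaque
        unfolding K
        e : ∀ s x t a → s ⊗ a ⊖ x ⊗ (t ⊗ a) ≡ (s ⊖ x ⊗ t) ⊗ a
        e = RS.solve-∀ K-ring

    eval-elementary : ∀ k P A → eval-tree v (elementary k P A) ≡ ε k P ⊗ eval-tree v A
    eval-elementary zero P A = sym (⊗-identityˡ _)
    eval-elementary (suc k) [] A = trans ι-0 (sym (⊗-zeroˡ _))
    eval-elementary (suc k) (p ∷ P) A = trans (cong₂ (λ s t → s ⊕ v p ⊗ t) (eval-elementary (suc k) P A)
      (eval-elementary k P A))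
      (e (ε (suc k) P) (v p) (ε k P) (eval-tree v A))
      where
      opaque
        unfolding K
        e : ∀ s x t a → s ⊗ a ⊕ x ⊗ (t ⊗ a) ≡ (s ⊕ x ⊗ t) ⊗ a
        e = RS.solve-∀ K-ring

    π-++ : ∀ P Q → π (P ++ Q) ≡ π P ⊗ π Q
    π-++ [] Q = sym (⊗-identityˡ _)
    π-++ (p ∷ P) Q = trans (cong ((1K ⊖ v p) ⊗_) (π-++ P Q)) (sym (⊗-assoc _ _ _))

    σ-++ : ∀ P Q → σ (P ++ Q) ≡ σ P ⊕ σ Q
    σ-++ [] Q = sym (⊕-identityˡ _)
    σ-++ (p ∷ P) Q = trans (cong (v p ⊕_) (σ-++ P Q)) (sym (⊕-assoc _ _ _))

    ε₁≡σ : ∀ P → ε 1 P ≡ σ P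
    ε₁≡σ [] = refl
    ε₁≡σ (p ∷ P) = trans (cong₂ _⊕_ (ε₁≡σ P) (⊗-identityʳ (v p))) (⊕-comm (σ P) (v p))

    InUnit : ℕ → Set
    InUnit p = 0K ≼ v p × v p ≼ 1K

    π≥0 : ∀ {P} → All InUnit P → 0K ≼ π P
    π≥0 [] = 0≼1
    π≥0 ((_ , v≤1) ∷ us) = 0≼⊗ (≼⇒diff v≤1) (π≥0 us)

    π≤1 : ∀ {P} → All InUnit P → π P ≼ 1K
    π≤1 [] = ≼-refl
    π≤1 {p ∷ P} ((v≥0 , v≤1) ∷ us) = ≼-trans (⊗-monoˡ (1K ⊖ v p) (≼⇒diff v≤1) (π≤1 us))
      (diff⇒≼ (subst (0K ≼_) (e (v p)) v≥0))
      where
      opaque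
        unfolding K
        e : ∀ x → x ≡ 1K ⊖ (1K ⊖ x) ⊗ 1K
        e = RS.solve-∀ K-ring

    ε≥0 : ∀ k {P} → All InUnit P → 0K ≼ ε k P
    ε≥0 zero us = 0≼1
    ε≥0 (suc k) [] = ≼-refl
    ε≥0 (suc k) ((v≥0 , _) ∷ us) = 0≼⊕ (ε≥0 (suc k) us) (0≼⊗ v≥0 (ε≥0 k us))

    -- Weierstrass's product inequality. It is of use only where the sum stays below 1, hence the
    -- division of a block into pieces.
    1-σ≤π : ∀ {P} → All InUnit P → 1K ⊖ σ P ≼ π P
    1-σ≤π [] = ≼-reflexive e
      where
      opaque
        unfolding K
        e : 1K ⊖ 0K ≡ 1K
        e = RS.solve-∀ K-ring
    1-σ≤π {p ∷ P} ((v≥0 , v≤1) ∷ us) = diff⇒≼ (subst (0K ≼_) (e (v p) (σ P) (π P))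
      (0≼⊕ (≼⇒diff (1-σ≤π us)) (0≼⊗ v≥0 (≼⇒diff (π≤1 us)))))
      where
      opaque
        unfolding K
        e : ∀ x s t → (t ⊖ (1K ⊖ s)) ⊕ x ⊗ (1K ⊖ t) ≡ (1K ⊖ x) ⊗ t ⊖ (1K ⊖ (x ⊕ s))
        e = RS.solve-∀ K-ring

    -- The truncation error, up to the sign (−1)^b.
    excess : ℕ → List ℕ → K
    excess zero P = 1K ⊖ π P
    excess (suc b) [] = 0K
    excess (suc b) (p ∷ P) = excess (suc b) P ⊕ v p ⊗ excess b P

    sign : ℕ → K
    sign zero = 1K
    sign (suc b) = ⊝ sign b

    -- Bonferroni's inequalities in exact form: `excess` obeys the recursion of the truncation
    -- without its signs, so the error has sign (-1)^b. An even level overshoots.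
    τ≡π+excess : ∀ b P → τ b P ≡ π P ⊕ sign b ⊗ excess b P
    τ≡π+excess zero P = e (π P)
      where
      opaque
        unfolding K
        e : ∀ x → 1K ≡ x ⊕ 1K ⊗ (1K ⊖ x)
        e = RS.solve-∀ K-ring
    τ≡π+excess (suc b) [] = e (⊝ sign b)
      where
      opaque
        unfolding K
        e : ∀ s → 1K ≡ 1K ⊕ s ⊗ 0K
        e = RS.solve-∀ K-ring
    τ≡π+excess (suc b) (p ∷ P) = trans (cong₂ (λ s t → s ⊖ v p ⊗ t) (τ≡π+excess (suc b) P) (τ≡π+excess b P))
      (e (π P) (sign b) (excess (suc b) P) (v p) (excess b P))
      where
      opaque
        unfolding K
        e : ∀ t s d x d′ → (t ⊕ (⊝ s) ⊗ d) ⊖ x ⊗ (t ⊕ s ⊗ d′) ≡ (1K ⊖ x) ⊗ t ⊕ (⊝ s) ⊗ (d ⊕ x ⊗ d′)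
        e = RS.solve-∀ K-ring

    excess≥0 : ∀ b {P} → All InUnit P → 0K ≼ excess b P
    excess≥0 zero us = ≼⇒diff (π≤1 us)
    excess≥0 (suc b) [] = ≼-refl
    excess≥0 (suc b) ((v≥0 , _) ∷ us) = 0≼⊕ (excess≥0 (suc b) us) (0≼⊗ v≥0 (excess≥0 b us))

    -- The truncation error is at most the first omitted term; for `b` = 0 this is Weierstrass's
    -- inequality, and both sides satisfy the same recursion.
    excess≤ε : ∀ b {P} → All InUnit P → excess b P ≼ ε (suc b) P
    excess≤ε zero {P} us = subst (1K ⊖ π P ≼_) (sym (ε₁≡σ P))
      (diff⇒≼ (subst (0K ≼_) (e (π P) (σ P)) (≼⇒diff (1-σ≤π us))))
      where
      opaque
        unfolding K
        e : ∀ t s → t ⊖ (1K ⊖ s) ≡ s ⊖ (1K ⊖ t)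
        e = RS.solve-∀ K-ring
    excess≤ε (suc b) [] = ≼-refl
    excess≤ε (suc b) {p ∷ P} ((v≥0 , _) ∷ us) = ⊕-mono (excess≤ε (suc b) us) (⊗-monoˡ (v p) v≥0 (excess≤ε b us))

    sign-even : ∀ d → sign (d + d) ≡ 1K
    sign-even zero = refl
    sign-even (suc d) = trans (cong (λ n → ⊝ sign n) (+-suc d d)) (trans (e (sign (d + d))) (sign-even d))
      where
      opaque
        unfolding K
        e : ∀ s → ⊝ ⊝ s ≡ s
        e = RS.solve-∀ K-ring

    τ-even : ∀ d P → τ (d + d) P ≡ π P ⊕ excess (d + d) P
    τ-even d P = trans (τ≡π+excess (d + d) P) (cong (π P ⊕_)
      (trans (cong (_⊗ excess (d + d) P) (sign-even d)) (⊗-identityˡ _)))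

    -- In the product of the sum with the symmetric polynomial of degree `k`, each squarefree
    -- monomial of degree k + 1 occurs k + 1 times; the remaining terms contain squares and are
    -- nonnegative.
    ε-ratio : ∀ k {P} → All InUnit P → ι (suc k) ⊗ ε (suc k) P ≼ σ P ⊗ ε k P
    ε-ratio zero {P} us = ≼-reflexive (trans (cong₂ _⊗_ ι-1 (ε₁≡σ P)) (⊗-comm 1K (σ P)))
    ε-ratio (suc k) [] = ≼-reflexive (trans (⊗-zeroʳ _) (sym (⊗-zeroʳ _)))
    ε-ratio (suc k) {p ∷ P} ((v≥0 , _) ∷ us) = subst
      (λ n → n ⊗ ε (suc (suc k)) (p ∷ P) ≼ σ (p ∷ P) ⊗ ε (suc k) (p ∷ P)) (sym (ι-suc (suc k)))
      (diff⇒≼ (subst (0K ≼_) (e (ι (suc k)) (v p) (σ P) (ε (suc (suc k)) P) (ε (suc k) P) (ε k P))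
        (0≼⊕ (≼⇒diff (subst (λ n → n ⊗ ε (suc (suc k)) P ≼ σ P ⊗ ε (suc k) P) (ι-suc (suc k)) (ε-ratio (suc k) us)))
          (0≼⊗ v≥0 (0≼⊕ (≼⇒diff (ε-ratio k us)) (0≼⊗ v≥0 (ε≥0 k us)))))))
      where
      opaque
        unfolding K
        e : ∀ n x s a b c → (s ⊗ b ⊖ (1K ⊕ n) ⊗ a) ⊕ x ⊗ ((s ⊗ c ⊖ n ⊗ b) ⊕ x ⊗ c) ≡ (x ⊕ s) ⊗ (b ⊕ x ⊗ c) ⊖ (1K ⊕ n)
          ⊗ (a ⊕ x ⊗ b)
        e = RS.solve-∀ K-ring

  -- Sums of reciprocals of primes

  -- Pascal's rule, applied to the identity with factorials so that no division occurs; it also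
  -- doubles the bound at each step.
  binomial : ∀ k l → ∃ λ c → c * (k ! * l !) ≡ (k + l) ! × c ≤ 2 ^ (k + l)
  binomial zero l = 1 , trans (*-identityˡ _) (*-identityˡ _) , m^n>0 2 l
  binomial (suc k) zero = 1 , trans (*-identityˡ _) (trans (*-identityʳ _) (cong _! (sym (+-identityʳ (suc k))))) ,
    m^n>0 2 (suc k + 0)
  binomial (suc k) (suc l) = add (binomial k (suc l)) (binomial (suc k) l)
    where
    e : ∀ c₁ c₂ k l k! l! → (c₁ + c₂) * (suc k * k! * (suc l * l!)) ≡ suc k * (c₁ * (k! * (suc l * l!))) + suc l *
      (c₂ * (suc k * k! * l!))
    e = ℕ-solve
    add : (∃ λ c → c * (k ! * suc l !) ≡ (k + suc l) ! × c ≤ 2 ^ (k + suc l)) →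
          (∃ λ c → c * (suc k ! * l !) ≡ (suc k + l) ! × c ≤ 2 ^ (suc k + l)) →
          ∃ λ c → c * (suc k ! * suc l !) ≡ (suc k + suc l) ! × c ≤ 2 ^ (suc k + suc l)
    add (c₁ , eq₁ , b₁) (c₂ , eq₂ , b₂) = c₁ + c₂ , eq , bound
      where
      n! = (k + suc l) !
      eq₂′ : c₂ * (suc k ! * l !) ≡ n!
      eq₂′ = trans eq₂ (cong _! (sym (+-suc k l)))
      eq : (c₁ + c₂) * (suc k ! * suc l !) ≡ (suc k + suc l) !
      eq = trans (e c₁ c₂ k l (k !) (l !)) (trans (cong₂ (λ a b → suc k * a + suc l * b) eq₁ eq₂′)
        (sym (*-distribʳ-+ n! (suc k) (suc l))))
      bound : c₁ + c₂ ≤ 2 ^ (suc k + suc l)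
      bound = ≤-trans (+-mono-≤ b₁ (≤-trans b₂ (≤-reflexive (cong (2 ^_) (sym (+-suc k l))))))
        (≤-reflexive (cong (2 ^ (k + suc l) +_) (sym (+-identityʳ _))))

  -- (2^s y)! / (y!)^(2^s) is an iterated product of central binomial coefficients.
  multinomial : ∀ y s → ∃ λ M → M * (y !) ^ (2 ^ s) ≡ (2 ^ s * y) ! × M ≤ 2 ^ (s * (2 ^ s * y))
  multinomial y zero = 1 , trans (*-identityˡ _) (trans (*-identityʳ _) (cong _! (sym (*-identityˡ y)))) , ≤-refl
  multinomial y (suc s) = square (multinomial y s) (binomial (2 ^ s * y) (2 ^ s * y))
    where
    n = 2 ^ s * y
    n+n : n + n ≡ 2 ^ suc s * y
    n+n = e (2 ^ s) y
      where
      e : ∀ a y → a * y + a * y ≡ 2 * a * y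
      e = ℕ-solve
    square : (∃ λ M → M * (y !) ^ (2 ^ s) ≡ n ! × M ≤ 2 ^ (s * n)) →
      (∃ λ c → c * (n ! * n !) ≡ (n + n) ! × c ≤ 2 ^ (n + n)) →
      ∃ λ M → M * (y !) ^ (2 ^ suc s) ≡ (2 ^ suc s * y) ! × M ≤ 2 ^ (suc s * (2 ^ suc s * y))
    square (M , eqM , bM) (c , eqc , bc) = c * (M * M) , eq , bound
      where
      e : ∀ c M Y → c * (M * M) * (Y * Y) ≡ c * (M * Y * (M * Y))
      e = ℕ-solve
      eq : c * (M * M) * (y !) ^ (2 ^ suc s) ≡ (2 ^ suc s * y) !
      eq = trans (cong (λ t → c * (M * M) * t) (trans (cong ((y !) ^_) (cong (2 ^ s +_) (+-identityʳ _)))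
        (^-distribˡ-+-* (y !) (2 ^ s) (2 ^ s))))
        (trans (e c M ((y !) ^ (2 ^ s))) (trans (cong (λ t → c * (t * t)) eqM) (trans eqc (cong _! n+n))))
      bound : c * (M * M) ≤ 2 ^ (suc s * (2 ^ suc s * y))
      bound = ≤-trans (*-mono-≤ bc (*-mono-≤ bM bM))
        (≤-reflexive (trans (cong (2 ^ (n + n) *_) (sym (^-distribˡ-+-* 2 (s * n) (s * n))))
        (trans (sym (^-distribˡ-+-* 2 (n + n) (s * n + s * n))) (cong (2 ^_) (trans (e′ s n) (cong (suc s *_) n+n))))))
        where
        e′ : ∀ s n → (n + n) + (s * n + s * n) ≡ suc s * (n + n)
        e′ = ℕ-solve

  -- An increasing list of some primes in (x, y], with the running lower bound that `Ascending`
  -- uses.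
  Chain : ℕ → List ℕ → ℕ → Set
  Chain x [] y = x ≤ y
  Chain x (p ∷ P) y = x < p × Prime p × Chain p P y

  chain-++ : ∀ {x} P {y Q z} → Chain x P y → Chain y Q z → Chain x (P ++ Q) z
  chain-++ {x} [] {Q = []} x≤y c = ≤-trans x≤y c
  chain-++ {x} [] {Q = q ∷ Q} x≤y (y<q , pq , c) = ≤-<-trans x≤y y<q , pq , c
  chain-++ (p ∷ P) (x<p , pp , c) c′ = x<p , pp , chain-++ P c c′

  chain-≤ : ∀ {x} P {y} → Chain x P y → x ≤ y
  chain-≤ [] x≤y = x≤y
  chain-≤ (p ∷ P) (x<p , _ , c) = ≤-trans (<⇒≤ x<p) (chain-≤ P c)

  chain-weakenˡ : ∀ {x x′} P {y} → x′ ≤ x → Chain x P y → Chain x′ P y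
  chain-weakenˡ [] x′≤x x≤y = ≤-trans x′≤x x≤y
  chain-weakenˡ (p ∷ P) x′≤x (x<p , c) = ≤-<-trans x′≤x x<p , c

  chain-All : ∀ {x} P {y} → Chain x P y → All (λ p → x < p × p ≤ y × Prime p) P
  chain-All [] c = []
  chain-All (p ∷ P) (x<p , pp , c) = (x<p , chain-≤ P c , pp) ∷ chain-All P (chain-weakenˡ P (<⇒≤ x<p) c)

  ^∣! : ∀ p .{{_ : NonZero p}} j → p ^ j ∣ (p * j) !
  ^∣! p zero = 1∣ _
  ^∣! p (suc j) = subst (λ t → p ^ suc j ∣ t !) (suc-pred (p * suc j)) (*-pres-∣
    (subst (p ∣_) (sym (suc-pred (p * suc j))) (m∣m*n (suc j)))
    (∣-trans (^∣! p j) (m≤n⇒m!∣n! (s≤s⁻¹ (subst (p * j <_) (sym (suc-pred (p * suc j))) (*-monoʳ-< p (n<1+n j)))))))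
    where
    instance _ = m*n≢0 p (suc j)

  prime∣!⇒≤ : ∀ {p} y → Prime p → p ∣ y ! → p ≤ y
  prime∣!⇒≤ zero pp d = ⊥-elim (¬prime[1] (subst Prime (∣1⇒≡1 d) pp))
  prime∣!⇒≤ (suc y) pp d with euclidsLemma (suc y) (y !) pp d
  ... | inj₁ d′ = ∣⇒≤ d′
  ... | inj₂ d′ = m≤n⇒m≤1+n (prime∣!⇒≤ y pp d′)

  prime∣^⇒∣ : ∀ {p} a j → Prime p → p ∣ a ^ j → p ∣ a
  prime∣^⇒∣ a zero pp d = ⊥-elim (¬prime[1] (subst Prime (∣1⇒≡1 d) pp))
  prime∣^⇒∣ a (suc j) pp d with euclidsLemma a (a ^ j) pp d
  ... | inj₁ d′ = d′
  ... | inj₂ d′ = prime∣^⇒∣ a j pp d′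

  ^∣*-cancel : ∀ {p a M} j → Prime p → ¬ p ∣ a → p ^ j ∣ a * M → p ^ j ∣ M
  ^∣*-cancel zero pp ∤a d = 1∣ _
  ^∣*-cancel {p} {a} {M} (suc j) pp ∤a d with ^∣*-cancel {p} {a} {M} j pp ∤a (∣-trans (n∣m*n p) d)
  ... | divides q refl with euclidsLemma a q pp
    (*-cancelʳ-∣ (p ^ j) {{m^n≢0 p j {{prime⇒nonZero pp}}}} (subst (p * p ^ j ∣_) (sym (*-assoc a q (p ^ j))) d))
  ...   | inj₁ p∣a = ⊥-elim (∤a p∣a)
  ...   | inj₂ (divides r refl) = divides r (*-assoc r p (p ^ j))

  Πpow : (ℕ → ℕ) → List ℕ → ℕ
  Πpow f [] = 1
  Πpow f (p ∷ P) = p ^ f p * Πpow f P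

  Σlist : (ℕ → ℕ) → List ℕ → ℕ
  Σlist f [] = 0
  Σlist f (p ∷ P) = f p + Σlist f P

  -- The primes are distinct: after `p ^ f p` is divided out of `M`, the powers of the later primes
  -- still divide the quotient.
  Πpow∣ : ∀ f {x y} P M → Chain x P y → All (λ p → p ^ f p ∣ M) P → Πpow f P ∣ M
  Πpow∣ f [] M c _ = 1∣ M
  Πpow∣ f (p ∷ P) M (x<p , pp , c) (divides q refl ∷ ds) =
    subst (p ^ f p * Πpow f P ∣_) (*-comm (p ^ f p) q) (*-monoʳ-∣ (p ^ f p)
      (Πpow∣ f P q c (All.zipWith (λ { {p′} (d , (p<p′ , _ , pp′)) →
        ^∣*-cancel (f p′) pp′ (λ p′∣ → <⇒≱ p<p′ (∣⇒≤ {{prime⇒nonZero pp}} (prime∣^⇒∣ p (f p) pp′ p′∣)))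
          (subst (p′ ^ f p′ ∣_) (*-comm q (p ^ f p)) d) }) (ds , chain-All P c))))

  Πpow-≥ : ∀ f {a} P → All (λ p → a ≤ p) P → a ^ Σlist f P ≤ Πpow f P
  Πpow-≥ f [] [] = ≤-refl
  Πpow-≥ f {a} (p ∷ P) (a≤p ∷ as) = ≤-trans (≤-reflexive (^-distribˡ-+-* a (f p) (Σlist f P)))
    (*-mono-≤ (^-monoˡ-≤ (f p) a≤p) (Πpow-≥ f P as))

  2^-cancel-≤ : ∀ {a b} → 2 ^ a ≤ 2 ^ b → a ≤ b
  2^-cancel-≤ {a} {b} p with a ≤? b
  ... | yes q = q
  ... | no ¬q = ⊥-elim (<⇒≱ (^-monoʳ-< 2 (s≤s (s≤s z≤n)) (≰⇒> ¬q)) p)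

  -- Every p > 2^x divides (2^(s+x))!/((2^x)!)^(2^s) to the power ⌊2^(s+x)/p⌋ at least.
  Σ-quotients : ∀ x s {z} P (f : ℕ → ℕ) → Chain (2 ^ x) P z → All (λ p → p * f p ≤ 2 ^ s * 2 ^ x) P →
    x * Σlist f P ≤ s * (2 ^ s * 2 ^ x)
  Σ-quotients x s {z} P f c fs = bound (multinomial (2 ^ x) s)
    where
    n = 2 ^ s * 2 ^ x
    bound : (∃ λ M → M * ((2 ^ x) !) ^ (2 ^ s) ≡ n ! × M ≤ 2 ^ (s * n)) → x * Σlist f P ≤ s * n
    bound (M , eqM , bM) = 2^-cancel-≤ (≤-trans (≤-reflexive (sym (^-*-assoc 2 x (Σlist f P))))
      (≤-trans (Πpow-≥ f P (All.map (λ (a<p , _) → <⇒≤ a<p) (chain-All P c)))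
        (≤-trans (∣⇒≤ {{M≢0}} (Πpow∣ f P M c ds)) bM)))
      where
      Y = ((2 ^ x) !) ^ (2 ^ s)
      M≢0 : NonZero M
      M≢0 = m*n≢0⇒m≢0 M {Y} {{subst NonZero (sym eqM) (n !≢0)}}
      ds : All (λ p → p ^ f p ∣ M) P
      ds = All.zipWith (λ { {p} (pf≤n , (x<p , _ , pp)) → ^∣*-cancel {p} {Y} (f p) pp
        (λ d → <⇒≱ x<p (prime∣!⇒≤ (2 ^ x) pp (prime∣^⇒∣ ((2 ^ x) !) (2 ^ s) pp d)))
        (subst (p ^ f p ∣_) (trans (sym eqM) (*-comm M Y))
          (∣-trans (^∣! p {{prime⇒nonZero pp}} (f p)) (m≤n⇒m!∣n! pf≤n))) }) (fs , chain-All P c)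

  opaque
    primesFrom : ℕ → ℕ → List ℕ
    primesFrom a zero = []
    primesFrom a (suc n) with prime? (suc a)
    ... | yes _ = suc a ∷ primesFrom (suc a) n
    ... | no _ = primesFrom (suc a) n

    primesFrom-chain : ∀ a n → Chain a (primesFrom a n) (a + n)
    primesFrom-chain a zero = m≤m+n a 0
    primesFrom-chain a (suc n) with prime? (suc a)
    ... | yes p = n<1+n a , p , subst (Chain (suc a) (primesFrom (suc a) n)) (sym (+-suc a n))
      (primesFrom-chain (suc a) n)
    ... | no _ = subst (Chain a (primesFrom (suc a) n)) (sym (+-suc a n))
      (chain-weakenˡ _ (n≤1+n a) (primesFrom-chain (suc a) n))

    ∈-primesFrom : ∀ a n {p} → Prime p → a < p → p ≤ a + n → p ∈ primesFrom a n
    ∈-primesFrom a zero {p} pp a<p p≤ = ⊥-elim (<⇒≱ a<p (subst (p ≤_) (+-identityʳ a) p≤))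
    ∈-primesFrom a (suc n) {p} pp a<p p≤ with prime? (suc a) | suc a ≟ p
    ... | yes _ | yes refl = here refl
    ... | no ¬p | yes refl = ⊥-elim (¬p pp)
    ... | yes _ | no a≢p = there (∈-primesFrom (suc a) n pp (≤∧≢⇒< a<p a≢p) (subst (p ≤_) (+-suc a n) p≤))
    ... | no _ | no a≢p = ∈-primesFrom (suc a) n pp (≤∧≢⇒< a<p a≢p) (subst (p ≤_) (+-suc a n) p≤)

  -- The primes in (2^i, 2^j].
  primes₂ : ℕ → ℕ → List ℕ
  primes₂ i j = primesFrom (2 ^ i) (2 ^ j ∸ 2 ^ i)

  primes₂-chain : ∀ {i j} → i ≤ j → Chain (2 ^ i) (primes₂ i j) (2 ^ j)
  primes₂-chain {i} {j} i≤j = subst (Chain (2 ^ i) (primes₂ i j)) (m+[n∸m]≡n (^-monoʳ-≤ 2 i≤j))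
    (primesFrom-chain (2 ^ i) (2 ^ j ∸ 2 ^ i))

  ∈-primes₂ : ∀ i j {p} → Prime p → 2 ^ i < p → p ≤ 2 ^ j → p ∈ primes₂ i j
  ∈-primes₂ i j {p} pp lo hi = ∈-primesFrom (2 ^ i) (2 ^ j ∸ 2 ^ i) pp lo
    (subst (p ≤_) (sym (m+[n∸m]≡n (≤-trans (<⇒≤ lo) hi))) hi)

  open Valuation

  σ-scaled : ∀ (v : ℕ → K) (f : ℕ → ℕ) a {P} → All (λ p → a ⊗ v p ≼ ι (f p)) P → a ⊗ σ v P ≼ ι (Σlist f P)
  σ-scaled v f a [] = ≼-reflexive (trans (⊗-zeroʳ a) (sym ι-0))
  σ-scaled v f a {p ∷ P} (h ∷ hs) = subst₂ _≼_ (sym (⊗-distribˡ a (v p) (σ v P))) (sym (ι-+ (f p) (Σlist f P)))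
    (⊕-mono h (σ-scaled v f a hs))

  Σlist-* : ∀ c (f : ℕ → ℕ) P → Σlist (λ p → c * f p) P ≡ c * Σlist f P
  Σlist-* c f [] = sym (*-zeroʳ c)
  Σlist-* c f (p ∷ P) = trans (cong (c * f p +_) (Σlist-* c f P)) (sym (*-distribˡ-+ c (f p) (Σlist f P)))

  -- Made total by the value 0 for divisor 0, so that it can be summed by `Σlist`.
  quotient : ℕ → ℕ → ℕ
  quotient n zero = 0
  quotient n (suc p) = n / suc p

  quotient-bounds : ∀ n p .{{_ : NonZero p}} → p * quotient n p ≤ n × n < p * quotient n p + p
  quotient-bounds n (suc p) =
    ≤-trans (≤-reflexive (*-comm (suc p) (n / suc p))) (m/n*n≤m n (suc p)) ,
    ≤-<-trans (≤-reflexive (trans (m≡m%n+[m/n]*n n (suc p))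
      (trans (+-comm (n % suc p) _) (cong (_+ n % suc p) (*-comm (n / suc p) (suc p))))))
      (+-monoʳ-< (suc p * (n / suc p)) (m%n<n n (suc p)))

  -- With n = 2^(x + m + 5) all quotients ⌊n/p⌋ are at least 32, so rounding costs at most a factor
  -- 33/32. `Σ-quotients` with s = m + 5 then bounds the sum of 1/p by (33/32)(m + 5)/x, and the
  -- hypothesis says that this is at most 7/20.
  mertens : ∀ x m {P} → 660 * (m + 5) ≤ 224 * x → 0 < x → Chain (2 ^ x) P (2 ^ (x + m)) → ι 20 ⊗ σ inv P ≼ ι 7
  mertens x m {P} hyp x>0 c = ⊗-cancel-≼ (32 * x * n) {{m*n≢0 (32 * x) n}}
    (≼-trans step₁ (≼-trans (ι-mono step₂) (≼-reflexive (ι-* (32 * x * n) 7))))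
    where
    s = m + 5
    n = 2 ^ s * 2 ^ x
    instance _ = m^n≢0 2 s
    instance _ = m^n≢0 2 x
    instance _ = m*n≢0 (2 ^ s) (2 ^ x)
    instance _ = m*n≢0 32 x {{_}} {{>-nonZero x>0}}
    f = quotient n
    inRange = chain-All P c
    large : ∀ {p} .{{_ : NonZero p}} → p ≤ 2 ^ (x + m) → 32 * n ≤ p * (33 * f p)
    large {p} p≤ = ≤-trans (*-monoʳ-≤ 32 (<⇒≤ (proj₂ (quotient-bounds n p))))
      (≤-trans (≤-reflexive (*-distribˡ-+ 32 (p * f p) p))
        (≤-trans (+-monoʳ-≤ (32 * (p * f p)) (≤-trans (≤-reflexive (*-comm 32 p)) (*-monoʳ-≤ p 32≤f)))
          (≤-reflexive (e p (f p)))))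
      where
      e : ∀ p q → 32 * (p * q) + p * q ≡ p * (33 * q)
      e = ℕ-solve
      n≡ : n ≡ 32 * 2 ^ (x + m)
      n≡ = trans (cong (_* 2 ^ x) (^-distribˡ-+-* 2 m 5))
        (trans (e′ (2 ^ m) (2 ^ x)) (cong (32 *_) (sym (^-distribˡ-+-* 2 x m))))
        where
        e′ : ∀ a b → a * 32 * b ≡ 32 * (b * a)
        e′ = ℕ-solve
      32≤f : 32 ≤ f p
      32≤f = s≤s⁻¹ (*-cancelˡ-< p 32 (suc (f p)) (≤-<-trans
        (≤-trans (*-monoˡ-≤ 32 p≤) (≤-reflexive (trans (*-comm (2 ^ (x + m)) 32) (sym n≡))))
        (subst (n <_) (trans (+-comm (p * f p) p) (sym (*-suc p (f p)))) (proj₂ (quotient-bounds n p)))))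
    term : ∀ {p} → 2 ^ x < p × p ≤ 2 ^ (x + m) × Prime p → ι (32 * n) ⊗ inv p ≼ ι (33 * f p)
    term {p} (_ , p≤ , pp) = subst (ι (32 * n) ⊗ inv p ≼_) (cancel (33 * f p))
      (⊗-monoʳ (inv p) (inv≥0 p) (ι-mono (large p≤)))
      where
      instance _ = prime⇒nonZero pp
      opaque
        unfolding K
        e : ∀ a b i → (a ⊗ b) ⊗ i ≡ b ⊗ (i ⊗ a)
        e = RS.solve-∀ K-ring
      cancel : ∀ y → ι (p * y) ⊗ inv p ≡ ι y
      cancel y = trans (cong (_⊗ inv p) (ι-* p y)) (trans (e (ι p) (ι y) (inv p))
        (trans (cong (ι y ⊗_) (inv-inverse p)) (⊗-identityʳ _)))
    step₁ : ι (32 * x * n) ⊗ (ι 20 ⊗ σ inv P) ≼ ι (20 * x * (33 * Σlist f P))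
    step₁ = subst₂ _≼_ eq (sym (trans (cong (λ t → ι (20 * x * t)) (sym (Σlist-* 33 f P))) (ι-* (20 * x) _)))
      (⊗-monoˡ (ι (20 * x)) (ι≥0 (20 * x)) (σ-scaled inv (λ p → 33 * f p) (ι (32 * n)) (All.map term inRange)))
      where
      opaque
        unfolding K
        e : ∀ a b c → (a ⊗ b) ⊗ c ≡ b ⊗ (a ⊗ c)
        e = RS.solve-∀ K-ring
      e′ : ∀ x n → 20 * x * (32 * n) ≡ 20 * (32 * x * n)
      e′ = ℕ-solve
      eq : ι (20 * x) ⊗ (ι (32 * n) ⊗ σ inv P) ≡ ι (32 * x * n) ⊗ (ι 20 ⊗ σ inv P)
      eq = trans (sym (⊗-assoc _ _ _)) (trans (cong (_⊗ σ inv P)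
        (trans (sym (ι-* (20 * x) (32 * n))) (trans (cong ι (e′ x n)) (ι-* 20 (32 * x * n)))))
        (e (ι 20) (ι (32 * x * n)) (σ inv P)))
    step₂ : 20 * x * (33 * Σlist f P) ≤ 32 * x * n * 7
    step₂ = ≤-trans (≤-reflexive (e₁ x (Σlist f P)))
      (≤-trans (*-monoʳ-≤ 660 (Σ-quotients x s P f c (All.map quotient≤ inRange)))
      (≤-trans (≤-reflexive (sym (*-assoc 660 s n))) (≤-trans (*-monoˡ-≤ n hyp) (≤-reflexive (e₂ x n)))))
      where
      e₁ : ∀ x y → 20 * x * (33 * y) ≡ 660 * (x * y)
      e₁ = ℕ-solve
      e₂ : ∀ x n → 224 * x * n ≡ 32 * x * n * 7
      e₂ = ℕ-solve
      quotient≤ : ∀ {p} → 2 ^ x < p × p ≤ 2 ^ (x + m) × Prime p → p * f p ≤ n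
      quotient≤ {p} (_ , _ , pp) = proj₁ (quotient-bounds n p {{prime⇒nonZero pp}})

  ι-*⊗ : ∀ a b x → ι (a * b) ⊗ x ≡ ι a ⊗ (ι b ⊗ x)
  ι-*⊗ a b x = trans (cong (_⊗ x) (ι-* a b)) (⊗-assoc _ _ _)

  -- The primes in (2^3q, 2^6q], cut into pieces on each of which the sieve density sums to less than 1.
  block : ℕ → List ℕ
  block q = primes₂ (3 * q) (3 * q + q) ++ (primes₂ (3 * q + q) (3 * q + q + q) ++ primes₂ (3 * q + q + q)
    (3 * q + q + q + q))

  block-chain : ∀ q → Chain (2 ^ (3 * q)) (block q) (2 ^ (3 * (q + q)))
  block-chain q = subst (λ j → Chain (2 ^ (3 * q)) (block q) (2 ^ j)) (e q)
    (chain-++ (primes₂ (3 * q) (3 * q + q)) (primes₂-chain (m≤m+n (3 * q) q))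
      (chain-++ (primes₂ (3 * q + q) (3 * q + q + q)) (primes₂-chain (m≤m+n (3 * q + q) q))
        (primes₂-chain (m≤m+n (3 * q + q + q) q))))
    where
    e : ∀ q → 3 * q + q + q + q ≡ 3 * (q + q)
    e = ℕ-solve

  ∈-block : ∀ q {p} → Prime p → 2 ^ (3 * q) < p → p ≤ 2 ^ (3 * (q + q)) → p ∈ block q
  ∈-block q {p} pp lo hi with p ≤? 2 ^ (3 * q + q) | p ≤? 2 ^ (3 * q + q + q)
  ... | yes h | _ = ∈-++⁺ˡ (∈-primes₂ (3 * q) (3 * q + q) pp lo h)
  ... | no h | yes h′ = ∈-++⁺ʳ (primes₂ (3 * q) (3 * q + q))
    (∈-++⁺ˡ (∈-primes₂ (3 * q + q) (3 * q + q + q) pp (≰⇒> h) h′))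
  ... | no h | no h′ = ∈-++⁺ʳ (primes₂ (3 * q) (3 * q + q))
    (∈-++⁺ʳ (primes₂ (3 * q + q) (3 * q + q + q))
    (∈-primes₂ (3 * q + q + q) (3 * q + q + q + q) pp (≰⇒> h′) (subst (λ j → p ≤ 2 ^ j) (e q) hi)))
    where
    e : ∀ q → 3 * (q + q) ≡ 3 * q + q + q + q
    e = ℕ-solve

  chain-length : ∀ {x} P {y} → Chain x P y → x + length P ≤ y
  chain-length {x} [] x≤y = subst (_≤ _) (sym (+-identityʳ x)) x≤y
  chain-length {x} (p ∷ P) (x<p , _ , c) = ≤-trans (≤-reflexive (+-suc x (length P)))
    (≤-trans (+-monoˡ-≤ (length P) x<p) (chain-length P c))

  block-length : ∀ q → length (block q) ≤ 2 ^ (3 * (q + q))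
  block-length q = ≤-trans (m≤n+m (length (block q)) (2 ^ (3 * q))) (chain-length (block q) (block-chain q))

  σ-double : ∀ (v : ℕ → K) P → σ (λ p → v p ⊕ v p) P ≡ σ v P ⊕ σ v P
  σ-double v [] = sym (⊕-identityˡ 0K)
  σ-double v (p ∷ P) = trans (cong ((v p ⊕ v p) ⊕_) (σ-double v P)) (e (v p) (σ v P))
    where
    opaque
      unfolding K
      e : ∀ x s → (x ⊕ x) ⊕ (s ⊕ s) ≡ (x ⊕ s) ⊕ (x ⊕ s)
      e = RS.solve-∀ K-ring

  density-InUnit : ∀ {p} → Prime p → InUnit density p
  density-InUnit {p} pp = 0≼⊕ (inv≥0 p) (inv≥0 p) ,
    subst₂ _≼_ eq (trans (⊗-comm (ι p) (inv p)) (inv-inverse p)) (⊗-monoʳ (inv p) (inv≥0 p) (ι-mono (nonTrivial⇒n>1 p)))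
    where
    instance _ = prime⇒nonZero pp
    instance _ = prime⇒nonTrivial pp
    opaque
      unfolding K
      e : ∀ x → (1K ⊕ 1K) ⊗ x ≡ x ⊕ x
      e = RS.solve-∀ K-ring
    eq : ι 2 ⊗ inv p ≡ density p
    eq = trans (cong (_⊗ inv p) (trans (ι-+ 1 1) (cong₂ _⊕_ ι-1 ι-1))) (e (inv p))

  chain-InUnit : ∀ {x y} P → Chain x P y → All (InUnit density) P
  chain-InUnit P c = All.map (λ (_ , _ , pp) → density-InUnit pp) (chain-All P c)

  -- For x ≥ 3q the hypothesis of `mertens` follows from 12 q ≥ 3300; this is where the threshold
  -- 300 comes from.
  part-σ : ∀ x q → 300 ≤ q → 3 * q ≤ x → ι 10 ⊗ σ density (primes₂ x (x + q)) ≼ ι 7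
  part-σ x q q≥ x≥ = subst (_≼ ι 7) eq (mertens x q hyp x>0 (primes₂-chain (m≤m+n x q)))
    where
    P = primes₂ x (x + q)
    e′ : ∀ q → 660 * (q + 5) ≡ 660 * q + 3300
    e′ = ℕ-solve
    e″ : ∀ q → 660 * q + 12 * q ≡ 224 * (3 * q)
    e″ = ℕ-solve
    hyp : 660 * (q + 5) ≤ 224 * x
    hyp = ≤-trans (≤-reflexive (e′ q)) (≤-trans (+-monoʳ-≤ (660 * q)
      (≤-trans (≤ᵇ⇒≤ 3300 (12 * 300) tt) (*-monoʳ-≤ 12 q≥)))
      (≤-trans (≤-reflexive (e″ q)) (*-monoʳ-≤ 224 x≥)))
    x>0 : 0 < x
    x>0 = ≤-trans (≤-trans (s≤s z≤n) q≥) (≤-trans (m≤n*m q 3) x≥)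
    opaque
      unfolding K
      e : ∀ t s → (t ⊕ t) ⊗ s ≡ t ⊗ (s ⊕ s)
      e = RS.solve-∀ K-ring
    eq : ι 20 ⊗ σ inv P ≡ ι 10 ⊗ σ density P
    eq = trans (cong (_⊗ σ inv P) (ι-+ 10 10)) (trans (e (ι 10) (σ inv P)) (cong (ι 10 ⊗_) (sym (σ-double inv P))))

  part-π : ∀ x q → 300 ≤ q → 3 * q ≤ x → ι 3 ≼ ι 10 ⊗ π density (primes₂ x (x + q))
  part-π x q q≥ x≥ = ≼-trans (≼-reflexive eq₁) (≼-trans (⊖-mono (≼-refl {ι 10}) (part-σ x q q≥ x≥))
    (≼-trans (≼-reflexive (e (ι 10) (σ density P)))
    (⊗-monoˡ (ι 10) (ι≥0 10) (1-σ≤π density (chain-InUnit P (primes₂-chain (m≤m+n x q)))))))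
    where
    P = primes₂ x (x + q)
    opaque
      unfolding K
      e : ∀ t s → t ⊖ t ⊗ s ≡ t ⊗ (1K ⊖ s)
      e = RS.solve-∀ K-ring
      e₂ : ∀ a b → a ≡ (a ⊕ b) ⊖ b
      e₂ = RS.solve-∀ K-ring
    eq₁ : ι 3 ≡ ι 10 ⊖ ι 7
    eq₁ = trans (e₂ (ι 3) (ι 7)) (cong (_⊖ ι 7) (sym (ι-+ 3 7)))

  block-σ : ∀ q → 300 ≤ q → ι 10 ⊗ σ density (block q) ≼ ι 21
  block-σ q q≥ = subst₂ _≼_ eq (trans (cong (ι 7 ⊕_) (sym (ι-+ 7 7))) (sym (ι-+ 7 14)))
    (⊕-mono (part-σ (3 * q) q q≥ ≤-refl) (⊕-mono (part-σ (3 * q + q) q q≥ (m≤m+n _ q))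
      (part-σ (3 * q + q + q) q q≥ (≤-trans (m≤m+n (3 * q) q) (m≤m+n _ q)))))
    where
    P₁ = primes₂ (3 * q) (3 * q + q)
    P₂ = primes₂ (3 * q + q) (3 * q + q + q)
    P₃ = primes₂ (3 * q + q + q) (3 * q + q + q + q)
    eq : ι 10 ⊗ σ density P₁ ⊕ (ι 10 ⊗ σ density P₂ ⊕ ι 10 ⊗ σ density P₃) ≡ ι 10 ⊗ σ density (block q)
    eq = trans (cong (ι 10 ⊗ σ density P₁ ⊕_) (trans (sym (⊗-distribˡ _ _ _))
      (cong (ι 10 ⊗_) (sym (σ-++ density P₂ P₃)))))
      (trans (sym (⊗-distribˡ _ _ _)) (cong (ι 10 ⊗_) (sym (σ-++ density P₁ (P₂ ++ P₃)))))

  -- Each of the three pieces contributes 3/10. On the whole block `1-σ≤π` would give only 1 -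
  -- 21/10, which is negative.
  block-π : ∀ q → 300 ≤ q → ι 27 ≼ ι 1000 ⊗ π density (block q)
  block-π q q≥ = subst₂ _≼_ (trans (cong (ι 3 ⊗_) (sym (ι-* 3 3))) (sym (ι-* 3 9))) eq
    (⊗-mono (0≼10π P₁ c₁) (0≼⊗ (ι≥0 3) (ι≥0 3)) (part-π (3 * q) q q≥ ≤-refl)
      (⊗-mono (0≼10π P₂ c₂) (ι≥0 3) (part-π (3 * q + q) q q≥ (m≤m+n _ q))
        (part-π (3 * q + q + q) q q≥ (≤-trans (m≤m+n (3 * q) q) (m≤m+n _ q)))))
    where
    P₁ = primes₂ (3 * q) (3 * q + q)
    P₂ = primes₂ (3 * q + q) (3 * q + q + q)
    P₃ = primes₂ (3 * q + q + q) (3 * q + q + q + q)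
    c₁ = chain-InUnit P₁ (primes₂-chain (m≤m+n (3 * q) q))
    c₂ = chain-InUnit P₂ (primes₂-chain (m≤m+n (3 * q + q) q))
    0≼10π : ∀ P → All (InUnit density) P → 0K ≼ ι 10 ⊗ π density P
    0≼10π P us = 0≼⊗ (ι≥0 10) (π≥0 density us)
    opaque
      unfolding K
      e : ∀ t a b c → (t ⊗ a) ⊗ ((t ⊗ b) ⊗ (t ⊗ c)) ≡ (t ⊗ (t ⊗ t)) ⊗ (a ⊗ (b ⊗ c))
      e = RS.solve-∀ K-ring
    eq : (ι 10 ⊗ π density P₁) ⊗ ((ι 10 ⊗ π density P₂) ⊗ (ι 10 ⊗ π density P₃)) ≡ ι 1000 ⊗ π density (block q)
    eq = trans (e (ι 10) (π density P₁) (π density P₂) (π density P₃))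
      (cong₂ _⊗_ (trans (cong (ι 10 ⊗_) (sym (ι-* 10 10))) (sym (ι-* 10 100)))
        (trans (cong (π density P₁ ⊗_) (sym (π-++ density P₂ P₃))) (sym (π-++ density P₁ (P₂ ++ P₃)))))

  -- Truncation errors on a block

  module Tail (v : ℕ → K) {P : List ℕ} (units : All (InUnit v) P) (small : ι 10 ⊗ σ v P ≼ ι 21) where

    ε-step : ∀ k → ι (10 * suc k) ⊗ ε v (suc k) P ≼ ι 21 ⊗ ε v k P
    ε-step k = ≼-trans (≼-reflexive (ι-*⊗ 10 (suc k) _)) (≼-trans (⊗-monoˡ (ι 10) (ι≥0 10) (ε-ratio v k units))
      (≼-trans (≼-reflexive (sym (⊗-assoc _ _ _))) (⊗-monoʳ (ε v k P) (ε≥0 v k units) small)))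

    -- The bound (21/10)^k / k! from iterating `ε-ratio`, with denominators cleared.
    ε-factorial : ∀ k → ι (10 ^ k * k !) ⊗ ε v k P ≼ ι (21 ^ k)
    ε-factorial zero = ≼-reflexive (⊗-identityʳ _)
    ε-factorial (suc k) = ≼-trans (≼-reflexive (trans (cong (λ n → ι n ⊗ ε v (suc k) P) (e (10 ^ k) k (k !)))
      (ι-*⊗ (10 ^ k * k !) (10 * suc k) _)))
      (≼-trans (⊗-monoˡ (ι (10 ^ k * k !)) (ι≥0 _) (ε-step k))
        (≼-trans (≼-reflexive (trans (sym (⊗-assoc _ _ _)) (trans (cong (_⊗ ε v k P) (⊗-comm _ _)) (⊗-assoc _ _ _))))
          (≼-trans (⊗-monoˡ (ι 21) (ι≥0 21) (ε-factorial k)) (≼-reflexive (sym (ι-* 21 (21 ^ k)))))))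
      where
      e : ∀ t k f → 10 * t * (suc k * f) ≡ t * f * (10 * suc k)
      e = ℕ-solve

    -- (21/10)^9 / 9! is about 0.00219. Degree 9 is the first omitted one at the lowest level, 8.
    ε₉ : ι 10000 ⊗ ε v 9 P ≼ ι 22
    ε₉ = ⊗-cancel-≼ (10 ^ 9 * 9 !) (≼-trans (≼-reflexive
      (trans (sym (⊗-assoc _ _ _)) (trans (cong (_⊗ ε v 9 P) (⊗-comm _ _)) (⊗-assoc _ _ _))))
      (≼-trans (⊗-monoˡ (ι 10000) (ι≥0 10000) (ε-factorial 9)) (≼-trans (≼-reflexive (sym (ι-* 10000 (21 ^ 9))))
        (≼-trans (ι-mono (≤ᵇ⇒≤ (10000 * 21 ^ 9) (10 ^ 9 * 9 ! * 22) tt)) (≼-reflexive (ι-* (10 ^ 9 * 9 !) 22))))))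

    -- Two steps of the ratio multiply by at most (21/10)² / (10 · 11), which is less than 1/16.
    ε-decay : ∀ k → 9 ≤ k → ι 16 ⊗ ε v (suc (suc k)) P ≼ ε v k P
    ε-decay k k≥ = ⊗-cancel-≼ 441 (≼-trans (≼-reflexive (sym (ι-*⊗ 441 16 _)))
      (≼-trans (⊗-monoʳ _ (ε≥0 v (suc (suc k)) units) (ι-mono (≤ᵇ⇒≤ (441 * 16) (100 * 110) tt)))
      (≼-trans (≼-reflexive (ι-*⊗ 100 110 _)) (≼-trans
        (⊗-monoˡ (ι 100) (ι≥0 100) (≼-trans (⊗-monoʳ _ (ε≥0 v (suc (suc k)) units)
        (ι-mono (*-monoʳ-≤ 10 (s≤s (s≤s k≥))))) (ε-step (suc k))))
        (≼-trans (≼-reflexive (trans (sym (⊗-assoc _ _ _))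
          (trans (cong (_⊗ ε v (suc k) P) (⊗-comm _ _)) (⊗-assoc _ _ _))))
          (≼-trans (⊗-monoˡ (ι 21) (ι≥0 21) (≼-trans (⊗-monoʳ _ (ε≥0 v (suc k) units)
            (ι-mono (*-monoʳ-≤ 10 (s≤s k≥)))) (ε-step k)))
            (≼-reflexive (sym (ι-*⊗ 21 21 _)))))))))

    ε-tail : ∀ d → ι (10000 * 16 ^ d) ⊗ ε v (suc ((4 + d) + (4 + d))) P ≼ ι 22
    ε-tail zero = ε₉
    ε-tail (suc d) = ≼-trans (≼-reflexive (trans (cong (λ j → ι (10000 * 16 ^ suc d) ⊗ ε v (suc (suc j)) P)
      (+-suc (4 + d) (4 + d)))
        (trans (cong (λ n → ι n ⊗ ε v (suc (suc (suc ((4 + d) + (4 + d))))) P) (e (16 ^ d)))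
          (ι-*⊗ (10000 * 16 ^ d) 16 _))))
      (≼-trans (⊗-monoˡ (ι (10000 * 16 ^ d)) (ι≥0 _)
        (ε-decay _ (s≤s (≤-trans (≤ᵇ⇒≤ 8 8 tt) (+-mono-≤ (m≤m+n 4 d) (m≤m+n 4 d)))))) (ε-tail d))
      where
      e : ∀ t → 10000 * (16 * t) ≡ 10000 * t * 16
      e = ℕ-solve

  -- The weighted sieve

  -- `d` counts the blocks still to follow. The block of the largest primes gets level 8 and each
  -- earlier one two more, which is affordable since its primes have half as many bits. The level is
  -- even so that the truncation is an upper bound.
  level : ℕ → ℕ
  level d = (4 + d) + (4 + d)

  -- The primes in (2^3x, 2^24x]; a sifted value may still have up to seven of them.
  window : ℕ → List ℕ
  window x = block x ++ (block (x + x) ++ block (x + x + (x + x)))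

  -- The truncations of all blocks times 8, the maximum of Kuhn's weight.
  upper : ℕ → ℕ → Tree
  upper zero q = const 8
  upper (suc d) q = truncated (level d) (block q) (upper d (q + q))

  -- The Brun–Hooley inequality x₁⋯x_d X ≥ y₁⋯y_d X − Σ_l (y_l − x_l) ∏_{j≠l} y_j · 8, where x_l is the sifting
  -- indicator of the l-th block, y_l ≥ x_l its truncation, and X = 8 − #{window primes dividing the value} is Kuhn's weight.
  lower : ℕ → ℕ → Tree
  lower zero q = const 8 ⊟ elementary 1 (window q) (const 1)
  lower (suc d) q = truncated (level d) (block q) (lower d (q + q)) ⊟ elementary (suc (level d)) (block q)
    (upper d (q + q))

  window-chain : ∀ x → Chain (2 ^ (3 * x)) (window x) (2 ^ (24 * x))
  window-chain x = subst (λ j → Chain (2 ^ (3 * x)) (window x) (2 ^ j)) (e x)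
    (chain-++ (block x) (block-chain x) (chain-++ (block (x + x)) (block-chain (x + x))
      (block-chain (x + x + (x + x)))))
    where
    e : ∀ x → 3 * (x + x + (x + x) + (x + x + (x + x))) ≡ 24 * x
    e = ℕ-solve

  -- For the density this says that a value has 6.3 window primes on average. It is the reason for
  -- the 8 in Kuhn's weight, whose mean then is at least 1.7.
  window-σ : ∀ v x → (∀ q → 300 ≤ q → ι 10 ⊗ σ v (block q) ≼ ι 21) → 300 ≤ x → ι 10 ⊗ σ v (window x) ≼ ι 63
  window-σ v x bound x≥ = subst₂ _≼_ eq (trans (cong (ι 21 ⊕_) (sym (ι-+ 21 21))) (sym (ι-+ 21 42)))
    (⊕-mono (bound x x≥) (⊕-mono (bound (x + x) x+x≥) (bound (x + x + (x + x)) (≤-trans x+x≥ (m≤m+n _ _)))))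
    where
    x+x≥ : 300 ≤ x + x
    x+x≥ = ≤-trans x≥ (m≤m+n x x)
    B₁ = block x
    B₂ = block (x + x)
    B₃ = block (x + x + (x + x))
    eq : ι 10 ⊗ σ v B₁ ⊕ (ι 10 ⊗ σ v B₂ ⊕ ι 10 ⊗ σ v B₃) ≡ ι 10 ⊗ σ v (window x)
    eq = trans (cong (ι 10 ⊗ σ v B₁ ⊕_) (trans (sym (⊗-distribˡ _ _ _)) (cong (ι 10 ⊗_) (sym (σ-++ v B₂ B₃)))))
      (trans (sym (⊗-distribˡ _ _ _)) (cong (ι 10 ⊗_) (sym (σ-++ v B₁ (B₂ ++ B₃)))))

  module Density where

    U L : ℕ → ℕ → K
    U d q = eval-tree density (upper d q)
    L d q = eval-tree density (lower d q)

    units : ∀ q → All (InUnit density) (block q)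
    units q = chain-InUnit (block q) (block-chain q)

    E : ℕ → ℕ → K
    E d q = τ density (level d) (block q)

    -- A truncation at an even level is at least the full product.
    E-bound : ∀ d q → 300 ≤ q → ι 27 ≼ ι 1000 ⊗ E d q
    E-bound d q q≥ = ≼-trans (block-π q q≥) (⊗-monoˡ (ι 1000) (ι≥0 1000)
      (subst₂ _≼_ (⊕-identityʳ _) (sym (τ-even density (4 + d) (block q)))
        (⊕-mono (≼-refl {π density (block q)}) (excess≥0 density (level d) (units q)))))

    U-step : ∀ d q → U (suc d) q ≡ E d q ⊗ U d (q + q)
    U-step d q = eval-truncated density (level d) (block q) (upper d (q + q))

    E≥0 : ∀ d q → 300 ≤ q → 0K ≼ E d q
    E≥0 d q q≥ = ⊗-cancel-≼ 1000 (≼-trans (≼-reflexive (⊗-zeroʳ _)) (≼-trans (ι≥0 27) (E-bound d q q≥)))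

    double≥ : ∀ {q} → 300 ≤ q → 300 ≤ q + q
    double≥ {q} q≥ = ≤-trans q≥ (m≤m+n q q)

    -- Each block costs a factor 27/1000, which is more than 1/64. A crude constant is enough, as
    -- 64^d is only a power of 2^d.
    U-bound : ∀ d q → 300 ≤ q → ι 8 ≼ ι (64 ^ d) ⊗ U d q
    U-bound zero q q≥ = ≼-reflexive (sym (trans (cong (_⊗ ι 8) ι-1) (⊗-identityˡ _)))
    U-bound (suc d) q q≥ = ≼-trans (≼-reflexive (sym (⊗-identityˡ _))) (≼-trans
      (⊗-mono (0≼⊗ (ι≥0 64) (E≥0 d q q≥)) (ι≥0 8) E≥1∕64 (U-bound d (q + q) (double≥ q≥)))
      (≼-reflexive (trans (e (ι 64) (E d q) (ι (64 ^ d)) (U d (q + q)))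
        (cong₂ _⊗_ (sym (ι-* 64 (64 ^ d))) (sym (U-step d q))))))
      where
      opaque
        unfolding K
        e : ∀ a b c d → (a ⊗ b) ⊗ (c ⊗ d) ≡ (a ⊗ c) ⊗ (b ⊗ d)
        e = RS.solve-∀ K-ring
        e′ : ∀ a b c → a ⊗ (b ⊗ c) ≡ b ⊗ (a ⊗ c)
        e′ = RS.solve-∀ K-ring
      E≥1∕64 : 1K ≼ ι 64 ⊗ E d q
      E≥1∕64 = ⊗-cancel-≼ 1000 (≼-trans (≼-reflexive (⊗-identityʳ _)) (≼-trans (ι-mono (≤ᵇ⇒≤ 1000 (64 * 27) tt))
        (≼-trans (≼-reflexive (ι-* 64 27)) (≼-trans (⊗-monoˡ (ι 64) (ι≥0 64) (E-bound d q q≥))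
          (≼-reflexive (e′ (ι 64) (ι 1000) (E d q)))))))

    U≥0 : ∀ d q → 300 ≤ q → 0K ≼ U d q
    U≥0 zero q q≥ = ι≥0 8
    U≥0 (suc d) q q≥ = subst (0K ≼_) (sym (U-step d q)) (0≼⊗ (E≥0 d q q≥) (U≥0 d (q + q) (double≥ q≥)))

    -- The constants 1/8 + 7/(80·16^d) decrease by 105/(1280·16^d), which exceeds ε/E ≤ (22/27)/(10·16^d).
    L-bound : ∀ d q → 300 ≤ q → ι (10 * 16 ^ d + 7) ⊗ U d q ≼ ι (80 * 16 ^ d) ⊗ L d q
    L-bound zero q q≥ = ≼-trans (≼-reflexive (sym (ι-* 17 8))) (diff⇒≼ (⊗-cancel-≼ 1 (subst₂ _≼_ (sym (⊗-zeroʳ _)) eq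
      (0≼⊗ (ι≥0 8) (≼⇒diff (window-σ density q block-σ q≥))))))
      where
      s = σ density (window q)
      opaque
        unfolding K
        e : ∀ a b c d s → a ⊗ c ≡ d → a ⊗ (b ⊖ c ⊗ s) ≡ a ⊗ b ⊖ d ⊗ s
        e a b c d s refl = e′ a b c s
          where
          e′ : ∀ a b c s → a ⊗ (b ⊖ c ⊗ s) ≡ a ⊗ b ⊖ (a ⊗ c) ⊗ s
          e′ = RS.solve-∀ K-ring
        e₂ : ∀ x y z s → (y ⊖ z) ⊖ x ⊗ s ≡ (y ⊖ x ⊗ s) ⊖ z
        e₂ = RS.solve-∀ K-ring
        e₃ : ∀ a b s → a ⊗ b ⊖ a ⊗ s ≡ a ⊗ (b ⊖ s)
        e₃ = RS.solve-∀ K-ring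
        e₄ : ∀ a b → a ≡ (b ⊕ a) ⊖ b
        e₄ = RS.solve-∀ K-ring
      L≡ : L 0 q ≡ ι 8 ⊖ s
      L≡ = cong (ι 8 ⊖_) (trans (eval-elementary density 1 (window q) (const 1))
        (trans (cong₂ _⊗_ (ε₁≡σ density (window q)) ι-1) (⊗-identityʳ _)))
      eq : ι 8 ⊗ (ι 63 ⊖ ι 10 ⊗ s) ≡ ι 1 ⊗ (ι 80 ⊗ L 0 q ⊖ ι 136)
      eq = trans (e (ι 8) (ι 63) (ι 10) (ι 80) s (sym (ι-* 8 10)))
        (trans (cong (_⊖ ι 80 ⊗ s) (trans (sym (ι-* 8 63))
        (trans (e₄ (ι 504) (ι 136)) (cong (_⊖ ι 136) (trans (sym (ι-+ 136 504)) (ι-* 80 8))))))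
        (trans (e₂ (ι 80) (ι 80 ⊗ ι 8) (ι 136) s) (trans
          (cong (_⊖ ι 136) (trans (e₃ (ι 80) (ι 8) s) (cong (ι 80 ⊗_) (sym L≡))))
          (sym (trans (cong (_⊗ (ι 80 ⊗ L 0 q ⊖ ι 136)) ι-1) (⊗-identityˡ _))))))
    -- The induction hypothesis enters with the factor 160000 E, `E-bound` with 1050 and the tail
    -- with 1280; as 1050 · 27 = 1280 · 22 + 190, a slack of 190 remains.
    L-bound (suc d) q q≥ = diff⇒≼ (⊗-cancel-≼ 10000 (subst₂ _≼_ (sym (⊗-zeroʳ _)) eq
      (0≼⊕ (0≼⊗ (0≼⊗ (ι≥0 (16 * 10000)) (E≥0 d q q≥)) (≼⇒diff (L-bound d (q + q) (double≥ q≥))))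
        (0≼⊗ (0≼⊕ (0≼⊗ (ι≥0 1050) (≼⇒diff (E-bound d q q≥)))
          (0≼⊕ (0≼⊗ (ι≥0 1280) (≼⇒diff (Tail.ε-tail density (units q) (block-σ q q≥) d))) (ι≥0 190)))
          (U≥0 d (q + q) (double≥ q≥))))))
      where
      X = E d q
      Y = ε density (suc (level d)) (block q)
      Z = U d (q + q)
      V = L d (q + q)
      g = ι (16 ^ d)
      L-step : L (suc d) q ≡ X ⊗ V ⊖ Y ⊗ Z
      L-step = cong₂ _⊖_ (eval-truncated density (level d) (block q) (lower d (q + q)))
        (eval-elementary density (suc (level d)) (block q) (upper d (q + q)))
      n : ℕ → K
      n = ι
      opaque
        unfolding K
        -- The numerals are variables and their relations hypotheses, since `ι` is opaque and the
        -- ring solver cannot compute with its values.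
        e : ∀ t g X Y Z V c₁₆ c₁₀ c₇ c₈₀ c₁₀₅₀ c₁₀₀₀ c₂₇ c₁₂₈₀ c₂₂ c₁₉₀ →
          c₁₆ ⊗ c₇ ≡ c₇ ⊕ n 105 → t ⊗ n 105 ≡ c₁₀₅₀ ⊗ c₁₀₀₀ → c₁₂₈₀ ≡ c₁₆ ⊗ c₈₀ → c₁₀₅₀ ⊗ c₂₇ ≡ c₁₂₈₀ ⊗ c₂₂ ⊕ c₁₉₀ →
          ((c₁₆ ⊗ t) ⊗ X) ⊗ ((c₈₀ ⊗ g) ⊗ V ⊖ (c₁₀ ⊗ g ⊕ c₇) ⊗ Z) ⊕
            (c₁₀₅₀ ⊗ (c₁₀₀₀ ⊗ X ⊖ c₂₇) ⊕ (c₁₂₈₀ ⊗ (c₂₂ ⊖ (t ⊗ g) ⊗ Y) ⊕ c₁₉₀)) ⊗ Z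
          ≡ t ⊗ ((c₈₀ ⊗ (c₁₆ ⊗ g)) ⊗ (X ⊗ V ⊖ Y ⊗ Z) ⊖ (c₁₀ ⊗ (c₁₆ ⊗ g) ⊕ c₇) ⊗ (X ⊗ Z))
        e t g X Y Z V c₁₆ c₁₀ c₇ c₈₀ c₁₀₅₀ c₁₀₀₀ c₂₇ c₁₂₈₀ c₂₂ c₁₉₀ h₁ h₂ h₃ h₄ =
          trans (r₁ t g X Y Z V c₁₆ c₁₀ c₇ c₈₀ c₁₀₅₀ c₁₀₀₀ c₂₇ c₁₂₈₀ c₂₂ c₁₉₀)
            (trans (cong₂ (λ a b → a ⊕ b) (cong₂ (λ a b → ((c₁₆ ⊗ t) ⊗ X) ⊗ ((c₈₀ ⊗ g) ⊗ V ⊖ (c₁₀ ⊗ g) ⊗ Z) ⊖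
              (t ⊗ X ⊗ Z) ⊗ a ⊕ (X ⊗ Z) ⊗ b) h₁ (sym h₂))
                (cong₂ (λ a b → ((c₁₂₈₀ ⊗ c₂₂ ⊕ c₁₉₀) ⊖ a) ⊗ Z ⊖ b ⊗ ((t ⊗ g) ⊗ Y ⊗ Z)) h₄ h₃))
              (r₂ t g X Y Z V c₁₆ c₁₀ c₇ c₈₀ (n 105) (c₁₂₈₀ ⊗ c₂₂ ⊕ c₁₉₀)))
          where
          r₁ : ∀ t g X Y Z V c₁₆ c₁₀ c₇ c₈₀ c₁₀₅₀ c₁₀₀₀ c₂₇ c₁₂₈₀ c₂₂ c₁₉₀ →
            ((c₁₆ ⊗ t) ⊗ X) ⊗ ((c₈₀ ⊗ g) ⊗ V ⊖ (c₁₀ ⊗ g ⊕ c₇) ⊗ Z) ⊕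
              (c₁₀₅₀ ⊗ (c₁₀₀₀ ⊗ X ⊖ c₂₇) ⊕ (c₁₂₈₀ ⊗ (c₂₂ ⊖ (t ⊗ g) ⊗ Y) ⊕ c₁₉₀)) ⊗ Z
            ≡ (((c₁₆ ⊗ t) ⊗ X) ⊗ ((c₈₀ ⊗ g) ⊗ V ⊖ (c₁₀ ⊗ g) ⊗ Z) ⊖ (t ⊗ X ⊗ Z) ⊗ (c₁₆ ⊗ c₇) ⊕ (X ⊗ Z) ⊗ (c₁₀₅₀ ⊗ c₁₀₀₀))
              ⊕ (((c₁₂₈₀ ⊗ c₂₂ ⊕ c₁₉₀) ⊖ c₁₀₅₀ ⊗ c₂₇) ⊗ Z ⊖ c₁₂₈₀ ⊗ ((t ⊗ g) ⊗ Y ⊗ Z))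
          r₁ = RS.solve-∀ K-ring
          r₂ : ∀ t g X Y Z V c₁₆ c₁₀ c₇ c₈₀ c₁₀₅ w →
            (((c₁₆ ⊗ t) ⊗ X) ⊗ ((c₈₀ ⊗ g) ⊗ V ⊖ (c₁₀ ⊗ g) ⊗ Z) ⊖ (t ⊗ X ⊗ Z) ⊗ (c₇ ⊕ c₁₀₅) ⊕ (X ⊗ Z) ⊗ (t ⊗ c₁₀₅))
              ⊕ ((w ⊖ w) ⊗ Z ⊖ (c₁₆ ⊗ c₈₀) ⊗ ((t ⊗ g) ⊗ Y ⊗ Z))
            ≡ t ⊗ ((c₈₀ ⊗ (c₁₆ ⊗ g)) ⊗ (X ⊗ V ⊖ Y ⊗ Z) ⊖ (c₁₀ ⊗ (c₁₆ ⊗ g) ⊕ c₇) ⊗ (X ⊗ Z))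
          r₂ = RS.solve-∀ K-ring
      eq : (ι (16 * 10000) ⊗ X) ⊗ (ι (80 * 16 ^ d) ⊗ V ⊖ ι (10 * 16 ^ d + 7) ⊗ Z)
          ⊕ (ι 1050 ⊗ (ι 1000 ⊗ X ⊖ ι 27) ⊕ (ι 1280 ⊗ (ι 22 ⊖ ι (10000 * 16 ^ d) ⊗ Y) ⊕ ι 190)) ⊗ Z
        ≡ ι 10000 ⊗ (ι (80 * 16 ^ suc d) ⊗ L (suc d) q ⊖ ι (10 * 16 ^ suc d + 7) ⊗ U (suc d) q)
      eq = trans (cong₂ _⊕_ (cong₂ (λ a b → (a ⊗ X) ⊗ b) (ι-* 16 10000)
        (cong₂ (λ a b → a ⊗ V ⊖ b ⊗ Z) (ι-* 80 (16 ^ d))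
        (trans (ι-+ (10 * 16 ^ d) 7) (cong (_⊕ ι 7) (ι-* 10 (16 ^ d))))))
          (cong (λ a → (ι 1050 ⊗ (ι 1000 ⊗ X ⊖ ι 27) ⊕ (ι 1280 ⊗ (ι 22 ⊖ a ⊗ Y) ⊕ ι 190)) ⊗ Z) (ι-* 10000 (16 ^ d))))
        (trans (e (ι 10000) g X Y Z V (ι 16) (ι 10) (ι 7) (ι 80) (ι 1050) (ι 1000) (ι 27) (ι 1280) (ι 22) (ι 190)
            (trans (sym (ι-* 16 7)) (ι-+ 7 105)) (trans (sym (ι-* 10000 105)) (ι-* 1050 1000)) (ι-* 16 80)
              (trans (sym (ι-* 1050 27)) (trans (ι-+ (1280 * 22) 190) (cong (_⊕ ι 190) (ι-* 1280 22)))))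
          (cong (ι 10000 ⊗_) (cong₂ _⊖_ (cong₂ _⊗_ (trans (cong (ι 80 ⊗_) (sym (ι-* 16 (16 ^ d))))
            (sym (ι-* 80 (16 ^ suc d)))) (sym L-step))
            (cong₂ _⊗_ (trans (cong (_⊕ ι 7) (trans (cong (ι 10 ⊗_) (sym (ι-* 16 (16 ^ d))))
              (sym (ι-* 10 (16 ^ suc d))))) (sym (ι-+ (10 * 16 ^ suc d) 7))) (sym (U-step d q))))))

    main-term : ∀ d q → 300 ≤ q → 1K ≼ ι (64 ^ d) ⊗ L d q
    main-term d q q≥ = ⊗-cancel-≼ (10 * 16 ^ d) {{m*n≢0 10 (16 ^ d) {{_}} {{m^n≢0 16 d}}}} (⊗-cancel-≼ 8
      (≼-trans (≼-reflexive (e₁ (ι 8) c)) (≼-trans (⊗-monoˡ c (ι≥0 _) (U-bound d q q≥))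
        (≼-trans (≼-reflexive (e₂ c (ι (64 ^ d)) (U d q))) (≼-trans (⊗-monoˡ (ι (64 ^ d)) (ι≥0 _) step)
          (≼-reflexive (trans (cong (λ a → ι (64 ^ d) ⊗ (a ⊗ L d q))
            (trans (cong ι (*-assoc 8 10 (16 ^ d))) (ι-* 8 (10 * 16 ^ d)))) (e₃ (ι (64 ^ d)) (ι 8) c (L d q)))))))))
      where
      c = ι (10 * 16 ^ d)
      step : c ⊗ U d q ≼ ι (80 * 16 ^ d) ⊗ L d q
      step = ≼-trans (⊗-monoʳ (U d q) (U≥0 d q q≥) (ι-mono (m≤m+n _ 7))) (L-bound d q q≥)
      opaque
        unfolding K
        e₁ : ∀ a c → a ⊗ (c ⊗ 1K) ≡ c ⊗ a
        e₁ = RS.solve-∀ K-ring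
        e₂ : ∀ c s u → c ⊗ (s ⊗ u) ≡ s ⊗ (c ⊗ u)
        e₂ = RS.solve-∀ K-ring
        e₃ : ∀ s a c l → s ⊗ ((a ⊗ c) ⊗ l) ≡ a ⊗ (c ⊗ (s ⊗ l))
        e₃ = RS.solve-∀ K-ring

  -- The size of the rounding error

  step-pow : ∀ s b → (1 + s) ^ suc b + 2 * (1 + s) ^ b ≤ (3 + s) ^ suc b
  step-pow s b = ≤-trans (≤-reflexive (e s ((1 + s) ^ b))) (*-monoʳ-≤ (3 + s) (^-monoˡ-≤ b (m≤n+m (1 + s) 2)))
    where
    e : ∀ s t → (1 + s) * t + 2 * t ≡ (3 + s) * t
    e = ℕ-solve

  weight-step : ∀ s b c w₁ w₂ → w₁ ≤ (1 + s) ^ suc b * c → w₂ ≤ (1 + s) ^ b * c → w₁ + (w₂ + w₂) ≤ (3 + s) ^ suc b * c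
  weight-step s b c w₁ w₂ h₁ h₂ = ≤-trans (+-mono-≤ h₁ (+-mono-≤ h₂ h₂))
    (≤-trans (≤-reflexive (e ((1 + s) ^ suc b) ((1 + s) ^ b) c)) (*-monoˡ-≤ c (step-pow s b)))
    where
    e : ∀ A B c → A * c + (B * c + B * c) ≡ (A + 2 * B) * c
    e = ℕ-solve

  3+2l : ∀ l → 3 + 2 * l ≡ 1 + 2 * suc l
  3+2l = ℕ-solve

  -- Each of `b` slots is empty or holds one of the primes together with one of its two classes. A
  -- further prime raises the base by 2, which is `step-pow`.
  weight-truncated : ∀ b P A → weight (truncated b P A) ≤ (1 + 2 * length P) ^ b * weight A
  weight-truncated zero P A = ≤-reflexive (sym (*-identityˡ _))
  weight-truncated (suc b) [] A = ≤-reflexive (sym (trans (cong (_* weight A) (^-zeroˡ (suc b))) (*-identityˡ _)))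
  weight-truncated (suc b) (p ∷ P) A = subst (λ t → weight (truncated (suc b) (p ∷ P) A) ≤ t ^ suc b * weight A)
    (3+2l (length P))
    (weight-step (2 * length P) b (weight A) _ _ (weight-truncated (suc b) P A) (weight-truncated b P A))

  weight-elementary : ∀ k P A → weight (elementary k P A) ≤ (1 + 2 * length P) ^ k * weight A
  weight-elementary zero P A = ≤-reflexive (sym (*-identityˡ _))
  weight-elementary (suc k) [] A = z≤n
  weight-elementary (suc k) (p ∷ P) A = subst (λ t → weight (elementary (suc k) (p ∷ P) A) ≤ t ^ suc k * weight A)
    (3+2l (length P))
    (weight-step (2 * length P) k (weight A) _ _ (weight-elementary (suc k) P A) (weight-elementary k P A))

  1+2^≤ : ∀ l a → l ≤ 2 ^ a → 1 + 2 * l ≤ 2 ^ (2 + a)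
  1+2^≤ l a h = ≤-trans (+-mono-≤ (m^n>0 2 a) (*-monoʳ-≤ 2 h)) (≤-trans (m≤m+n _ (2 ^ a)) (≤-reflexive (e (2 ^ a))))
    where
    e : ∀ t → t + 2 * t + t ≡ 2 * (2 * t)
    e = ℕ-solve

  block-power : ∀ q k → (1 + 2 * length (block q)) ^ k ≤ 2 ^ ((2 + 3 * (q + q)) * k)
  block-power q k = ≤-trans (^-monoˡ-≤ k (1+2^≤ (length (block q)) (3 * (q + q)) (block-length q)))
    (≤-reflexive (^-*-assoc 2 (2 + 3 * (q + q)) k))

  -- Without the 2 that comes from `1+2^≤` the exponent would be 12 (4 + d) q; for q ≥ 4 the excess
  -- is at most one more (4 + d) q.
  level-exponent : ∀ d q → 4 ≤ q → (2 + 3 * (q + q)) * level d ≤ 13 * ((4 + d) * q)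
  level-exponent d q q≥ = ≤-trans (≤-reflexive (e₁ d q))
    (≤-trans (+-monoʳ-≤ (12 * ((4 + d) * q)) (≤-trans (≤-reflexive (*-comm 4 (4 + d))) (*-monoʳ-≤ (4 + d) q≥)))
    (≤-reflexive (e₂ ((4 + d) * q))))
    where
    e₁ : ∀ d q → (2 + 3 * (q + q)) * ((4 + d) + (4 + d)) ≡ 12 * ((4 + d) * q) + 4 * (4 + d)
    e₁ = ℕ-solve
    e₂ : ∀ t → 12 * t + t ≡ 13 * t
    e₂ = ℕ-solve

  combine-exponents : ∀ d q → 13 * ((4 + d) * q) + 13 * ((6 + d) * q) ≡ 13 * ((5 + d) * (q + q))
  combine-exponents = ℕ-solve

  double-shift : ∀ d q → 2 ^ d * (q + q) ≡ 2 ^ suc d * q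
  double-shift d q = e (2 ^ d) q
    where
    e : ∀ t q → t * (q + q) ≡ 2 * t * q
    e = ℕ-solve

  -- The factor on the left closes the induction: 13 (5 + d)(q + q) is the cost 13 (4 + d) q of the
  -- block plus the exponent 13 (6 + d) q required for `suc d`. At the bottom, where `q` has become
  -- x, it is 65 x.
  weight-upper : ∀ d q → 4 ≤ q → weight (upper d q) * 2 ^ (13 * ((5 + d) * q)) ≤ 8 * 2 ^ (65 * (2 ^ d * q))
  weight-upper zero q q≥ = ≤-reflexive (cong (λ t → 8 * 2 ^ t) (e q))
    where
    e : ∀ q → 13 * (5 * q) ≡ 65 * (1 * q)
    e = ℕ-solve
  weight-upper (suc d) q q≥ = ≤-trans (*-monoˡ-≤ (2 ^ (13 * ((6 + d) * q)))
    (≤-trans (weight-truncated (level d) (block q) (upper d (q + q)))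
      (*-monoˡ-≤ w (≤-trans (block-power q (level d)) (^-monoʳ-≤ 2 (level-exponent d q q≥))))))
    (≤-trans (≤-reflexive (trans (e (2 ^ (13 * ((4 + d) * q))) w (2 ^ (13 * ((6 + d) * q))))
      (cong (w *_) (trans (sym (^-distribˡ-+-* 2 (13 * ((4 + d) * q)) (13 * ((6 + d) * q))))
      (cong (2 ^_) (combine-exponents d q))))))
      (≤-trans (weight-upper d (q + q) (≤-trans q≥ (m≤m+n q q)))
        (≤-reflexive (cong (λ t → 8 * 2 ^ (65 * t)) (double-shift d q)))))
    where
    w = weight (upper d (q + q))
    e : ∀ A w B → A * w * B ≡ w * (A * B)
    e = ℕ-solve

  window-length : ∀ x → length (window x) ≤ 2 ^ (24 * x)
  window-length x = ≤-trans (m≤n+m (length (window x)) (2 ^ (3 * x))) (chain-length (window x) (window-chain x))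

  -- The window adds 24 x to the 65 x of `weight-upper`. Each block contributes two trees within the
  -- same bound, hence one more factor 2 per block.
  weight-lower : ∀ d q → 4 ≤ q → weight (lower d q) * 2 ^ (13 * ((5 + d) * q)) ≤ 2 ^ (5 + d) * 2 ^ (89 * (2 ^ d * q))
  weight-lower zero q q≥ = ≤-trans (*-monoˡ-≤ (2 ^ (13 * (5 * q))) bound)
    (≤-reflexive (trans (*-assoc 32 (2 ^ (24 * q)) _)
    (cong (32 *_) (trans (sym (^-distribˡ-+-* 2 (24 * q) (13 * (5 * q)))) (cong (2 ^_) (e q))))))
    where
    e : ∀ q → 24 * q + 13 * (5 * q) ≡ 89 * (1 * q)
    e = ℕ-solve
    e′ : ∀ t → 8 * t + (4 * t) * 1 * 1 ≡ 12 * t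
    e′ = ℕ-solve
    bound : weight (lower 0 q) ≤ 32 * 2 ^ (24 * q)
    bound = ≤-trans (+-mono-≤ (≤-trans (≤-reflexive (sym (*-identityʳ 8))) (*-monoʳ-≤ 8 (m^n>0 2 (24 * q))))
        (≤-trans (weight-elementary 1 (window q) (const 1))
          (*-monoˡ-≤ 1 (*-monoˡ-≤ 1 (≤-trans (1+2^≤ (length (window q)) (24 * q) (window-length q))
          (≤-reflexive (sym (*-assoc 2 2 (2 ^ (24 * q))))))))))
      (≤-trans (≤-reflexive (e′ (2 ^ (24 * q)))) (*-monoˡ-≤ (2 ^ (24 * q)) (≤ᵇ⇒≤ 12 32 tt)))
  weight-lower (suc d) q q≥ = ≤-trans (*-monoˡ-≤ Z (+-mono-≤
        (≤-trans (weight-truncated (level d) (block q) (lower d (q + q)))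
          (*-monoˡ-≤ l (≤-trans (block-power q (level d)) (^-monoʳ-≤ 2 (level-exponent d q q≥)))))
        (≤-trans (weight-elementary (suc (level d)) (block q) (upper d (q + q)))
          (*-monoˡ-≤ u (*-mono-≤ (1+2^≤ (length (block q)) (3 * (q + q)) (block-length q))
          (≤-trans (block-power q (level d)) (^-monoʳ-≤ 2 (level-exponent d q q≥))))))))
    (≤-trans (≤-reflexive (trans (e A Z l u C) (cong (λ t → l * t + C * (u * t)) AZ)))
      (≤-trans (+-mono-≤ (weight-lower d (q + q) (≤-trans q≥ (m≤m+n q q)))
        (≤-trans (*-monoʳ-≤ C (weight-upper d (q + q) (≤-trans q≥ (m≤m+n q q)))) small))
        (≤-reflexive (trans (e′ (2 ^ (5 + d)) (2 ^ (89 * (2 ^ d * (q + q)))))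
          (cong (λ t → 2 ^ (6 + d) * 2 ^ (89 * t)) (double-shift d q))))))
    where
    l = weight (lower d (q + q))
    u = weight (upper d (q + q))
    A = 2 ^ (13 * ((4 + d) * q))
    Z = 2 ^ (13 * ((6 + d) * q))
    C = 2 ^ (2 + 3 * (q + q))
    y = 2 ^ d * (q + q)
    AZ : A * Z ≡ 2 ^ (13 * ((5 + d) * (q + q)))
    AZ = trans (sym (^-distribˡ-+-* 2 (13 * ((4 + d) * q)) (13 * ((6 + d) * q)))) (cong (2 ^_) (combine-exponents d q))
    e : ∀ A Z l u C → (A * l + C * A * u) * Z ≡ l * (A * Z) + C * (u * (A * Z))
    e = ℕ-solve
    e′ : ∀ a b → a * b + a * b ≡ 2 * a * b
    e′ = ℕ-solve
    small : C * (8 * 2 ^ (65 * y)) ≤ 2 ^ (5 + d) * 2 ^ (89 * y)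
    small = ≤-trans (≤-reflexive (trans (cong (C *_) (sym (^-distribˡ-+-* 2 3 (65 * y))))
      (sym (^-distribˡ-+-* 2 (2 + 3 * (q + q)) (3 + 65 * y)))))
      (≤-trans (^-monoʳ-≤ 2 exponents) (≤-reflexive (^-distribˡ-+-* 2 (5 + d) (89 * y))))
      where
      e₁ : ∀ q y → 2 + 3 * (q + q) + (3 + 65 * y) ≡ 5 + 3 * (q + q) + 65 * y
      e₁ = ℕ-solve
      e₂ : ∀ d y → 5 + d + 24 * y + 65 * y ≡ 5 + d + 89 * y
      e₂ = ℕ-solve
      exponents : 2 + 3 * (q + q) + (3 + 65 * y) ≤ 5 + d + 89 * y
      exponents = ≤-trans (≤-reflexive (e₁ q y)) (≤-trans
        (+-monoˡ-≤ (65 * y) (+-mono-≤ (m≤m+n 5 d) (*-mono-≤ (≤ᵇ⇒≤ 3 24 tt) (m≤n*m (q + q) (2 ^ d) {{m^n≢0 2 d}}))))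
        (≤-reflexive (e₂ d y)))

  -- The primes in the sieve trees ascend

  module _ (W β h x₀ : ℕ) (sound : ∀ {p} → Prime p → x₀ < p → Forms.Good W β h p) where
    open Forms W β h

    ascending-weaken : ∀ {x x′} A → x′ ≤ x → Ascending x A → Ascending x′ A
    ascending-weaken (const c) le a = tt
    ascending-weaken (A ⊞ B) le (a , b) = ascending-weaken A le a , ascending-weaken B le b
    ascending-weaken (A ⊟ B) le (a , b) = ascending-weaken A le a , ascending-weaken B le b
    ascending-weaken (hit p A) le (x<p , rest) = ≤-<-trans le x<p , rest

    ascending-truncated : ∀ b {x y} P A → x₀ ≤ x → Chain x P y → Ascending y A → Ascending x (truncated b P A)
    ascending-truncated zero P A x≥ c a = ascending-weaken A (chain-≤ P c) a
    ascending-truncated (suc b) [] A x≥ c a = ascending-weaken A c a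
    ascending-truncated (suc b) (p ∷ P) A x≥ (x<p , pp , c) a =
      ascending-weaken (truncated (suc b) P A) (<⇒≤ x<p) (ascending-truncated (suc b) P A p≥ c a) ,
      x<p , sound pp (≤-<-trans x≥ x<p) , ascending-truncated b P A p≥ c a
      where p≥ = ≤-trans x≥ (<⇒≤ x<p)

    ascending-elementary : ∀ b {x y} P A → x₀ ≤ x → Chain x P y → Ascending y A → Ascending x (elementary b P A)
    ascending-elementary zero P A x≥ c a = ascending-weaken A (chain-≤ P c) a
    ascending-elementary (suc b) [] A x≥ c a = tt
    ascending-elementary (suc b) (p ∷ P) A x≥ (x<p , pp , c) a =
      ascending-weaken (elementary (suc b) P A) (<⇒≤ x<p) (ascending-elementary (suc b) P A p≥ c a) ,
      x<p , sound pp (≤-<-trans x≥ x<p) , ascending-elementary b P A p≥ c a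
      where p≥ = ≤-trans x≥ (<⇒≤ x<p)

    x₀≤2q : ∀ q → x₀ ≤ 2 ^ (3 * q) → x₀ ≤ 2 ^ (3 * (q + q))
    x₀≤2q q le = ≤-trans le (^-monoʳ-≤ 2 (*-monoʳ-≤ 3 (m≤m+n q q)))

    ascending-upper : ∀ d q → x₀ ≤ 2 ^ (3 * q) → Ascending (2 ^ (3 * q)) (upper d q)
    ascending-upper zero q le = tt
    ascending-upper (suc d) q le = ascending-truncated (level d) (block q) _ le (block-chain q)
      (ascending-upper d (q + q) (x₀≤2q q le))

    ascending-lower : ∀ d q → x₀ ≤ 2 ^ (3 * q) → Ascending (2 ^ (3 * q)) (lower d q)
    ascending-lower zero q le = tt , ascending-elementary 1 (window q) (const 1) le (window-chain q) tt
    ascending-lower (suc d) q le =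
      ascending-truncated (level d) (block q) _ le (block-chain q) (ascending-lower d (q + q) (x₀≤2q q le)) ,
      ascending-elementary (suc (level d)) (block q) _ le (block-chain q) (ascending-upper d (q + q) (x₀≤2q q le))

  δ≤1 : ∀ d n → δ d n ≤ 1
  δ≤1 d n = case (d ∣? n)
    where
    case : Dec (d ∣ n) → δ d n ≤ 1
    case (yes p) = ≤-reflexive (δ-yes p)
    case (no ¬p) = subst (_≤ 1) (sym (δ-no ¬p)) z≤n

  doubled : ℕ → ℕ → ℕ
  doubled zero q = q
  doubled (suc d) q = doubled d (q + q)

  doubled≡ : ∀ d q → doubled d q ≡ 2 ^ d * q
  doubled≡ zero q = sym (*-identityˡ q)
  doubled≡ (suc d) q = trans (doubled≡ d (q + q)) (double-shift d q)

  Σℕ-+ : ∀ (f g : ℕ → ℕ) N → Σℕ N (λ k → f k + g k) ≡ Σℕ N f + Σℕ N g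
  Σℕ-+ f g zero = refl
  Σℕ-+ f g (suc N) = trans (cong (f N + g N +_) (Σℕ-+ f g N)) (e (f N) (g N) _ _)
    where
    e : ∀ a b c d → a + b + (c + d) ≡ (a + c) + (b + d)
    e = ℕ-solve

  Σℕ-Σlist : ∀ (f : ℕ → ℕ → ℕ) P N → Σℕ N (λ k → Σlist (f k) P) ≡ Σlist (λ p → Σℕ N (λ k → f k p)) P
  Σℕ-Σlist f [] zero = refl
  Σℕ-Σlist f [] (suc N) = Σℕ-Σlist f [] N
  Σℕ-Σlist f (p ∷ P) N = trans (Σℕ-+ (λ k → f k p) (λ k → Σlist (f k) P) N)
    (cong (Σℕ N (λ k → f k p) +_) (Σℕ-Σlist f P N))

  -- Pointwise sieve inequalities

  module Sift (W β h x₀ : ℕ) (sound : ∀ {p} → Prime p → x₀ < p → Forms.Good W β h p) where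
    open Forms W β h

    hit-count : ℕ → ℕ → ℕ
    hit-count k p = δ p (form₁ k) + δ p (form₂ k)

    square-count : ℕ → ℕ → ℕ
    square-count k p = δ (p * p) (form₁ k) + δ (p * p) (form₂ k)

    block-hits : ℕ → ℕ → ℕ → ℕ
    block-hits k zero q = 0
    block-hits k (suc d) q = Σlist (hit-count k) (block q) + block-hits k d (q + q)

    -- A prime dividing both forms divides their difference `h`. This puts the indicators into the
    -- unit interval, as the Bonferroni bounds require.
    hit-count≤1 : ∀ k {p} → Good p → hit-count k p ≤ 1
    hit-count≤1 k {p} (_ , _ , ∤h) = case (p ∣? form₁ k)
      where
      case : Dec (p ∣ form₁ k) → hit-count k p ≤ 1
      case (no ¬d) = subst (λ t → t + δ p (form₂ k) ≤ 1) (sym (δ-no ¬d)) (δ≤1 p (form₂ k))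
      case (yes d) = subst (λ t → δ p (form₁ k) + t ≤ 1)
        (sym (δ-no λ d′ → ∤h (∣m+n∣m⇒∣n (subst (p ∣_) (sym (+-assoc (W * k) β h)) d′) d)))
        (subst (_≤ 1) (sym (+-identityʳ _)) (δ≤1 p (form₁ k)))

    hits≡ : ∀ k p → hits k p ≡ ι (hit-count k p)
    hits≡ k p = sym (ι-+ (δ p (form₁ k)) (δ p (form₂ k)))

    good-units : ∀ k {q y} P → x₀ ≤ q → Chain q P y → All (InUnit (hits k)) P
    good-units k P x≥ c = All.map (λ { {p} (x<p , _ , pp) → subst (0K ≼_) (sym (hits≡ k p)) (ι≥0 (hit-count k p)) ,
      subst₂ _≼_ (sym (hits≡ k p)) ι-1 (ι-mono (hit-count≤1 k (sound pp (≤-<-trans x≥ x<p)))) }) (chain-All P c)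

    module At (k : ℕ) where
      v = hits k

      -- The exact sifting indicators of all blocks times Kuhn's weight; negative if there are more
      -- than 8 hits in the window and none in the blocks.
      sifted : ℕ → ℕ → K
      sifted zero q = ι 8 ⊖ σ v (window q)
      sifted (suc d) q = π v (block q) ⊗ sifted d (q + q)

      units : ∀ q → x₀ ≤ 2 ^ (3 * q) → All (InUnit v) (block q)
      units q le = good-units k (block q) le (block-chain q)

      σ-hits : ∀ P → σ v P ≡ ι (Σlist (hit-count k) P)
      σ-hits [] = sym ι-0
      σ-hits (p ∷ P) = trans (cong₂ _⊕_ (hits≡ k p) (σ-hits P)) (sym (ι-+ (hit-count k p) _))

      double : ∀ q → x₀ ≤ 2 ^ (3 * q) → x₀ ≤ 2 ^ (3 * (q + q))
      double = x₀≤2q W β h x₀ sound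

      τ-split : ∀ d q → τ v (level d) (block q) ≡ π v (block q) ⊕ excess v (level d) (block q)
      τ-split d q = τ-even v (4 + d) (block q)

      upper≡ : ∀ d q → eval-tree v (upper (suc d) q) ≡ (π v (block q) ⊕ excess v (level d) (block q)) ⊗ eval-tree v
        (upper d (q + q))
      upper≡ d q = trans (eval-truncated v (level d) (block q) (upper d (q + q)))
        (cong (_⊗ eval-tree v (upper d (q + q))) (τ-split d q))

      upper≥0 : ∀ d q → x₀ ≤ 2 ^ (3 * q) → 0K ≼ eval-tree v (upper d q)
      upper≥0 zero q le = ι≥0 8
      upper≥0 (suc d) q le = subst (0K ≼_) (sym (upper≡ d q))
        (0≼⊗ (0≼⊕ (π≥0 v (units q le)) (excess≥0 v (level d) (units q le))) (upper≥0 d (q + q) (double q le)))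

      sifted≤upper : ∀ d q → x₀ ≤ 2 ^ (3 * q) → sifted d q ≼ eval-tree v (upper d q)
      sifted≤upper zero q le = diff⇒≼ (subst (0K ≼_) (trans (sym (σ-hits (window q))) (e (ι 8) (σ v (window q))))
        (ι≥0 _))
        where
        opaque
          unfolding K
          e : ∀ a s → s ≡ a ⊖ (a ⊖ s)
          e = RS.solve-∀ K-ring
      sifted≤upper (suc d) q le = diff⇒≼ (subst (0K ≼_)
        (trans (e (π v (block q)) (excess v (level d) (block q)) _ _) (cong (_⊖ sifted (suc d) q) (sym (upper≡ d q))))
        (0≼⊕ (0≼⊗ (excess≥0 v (level d) (units q le)) (upper≥0 d (q + q) (double q le)))
          (0≼⊗ (π≥0 v (units q le)) (≼⇒diff (sifted≤upper d (q + q) (double q le))))))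
        where
        opaque
          unfolding K
          e : ∀ a b u x → b ⊗ u ⊕ a ⊗ (u ⊖ x) ≡ (a ⊕ b) ⊗ u ⊖ a ⊗ x
          e = RS.solve-∀ K-ring

      -- With truncation error D ≤ Y, the difference is (π + D)(X - L) + (Y - D) U + D (U - X), a
      -- sum of nonnegative terms. The weight X may be negative, so only X ≤ U is used of it.
      lower≤sifted : ∀ d q → x₀ ≤ 2 ^ (3 * q) → eval-tree v (lower d q) ≼ sifted d q
      lower≤sifted zero q le = ≼-reflexive (cong (ι 8 ⊖_)
        (trans (eval-elementary v 1 (window q) (const 1)) (trans (cong₂ _⊗_ (ε₁≡σ v (window q)) ι-1) (⊗-identityʳ _))))
      lower≤sifted (suc d) q le = diff⇒≼ (subst (0K ≼_)
        (trans (e (π v (block q)) D Y U X L) (cong (sifted (suc d) q ⊖_) (sym lower≡)))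
        (0≼⊕ (0≼⊗ (0≼⊕ (π≥0 v (units q le)) (excess≥0 v (level d) (units q le)))
          (≼⇒diff (lower≤sifted d (q + q) (double q le))))
          (0≼⊕ (0≼⊗ (≼⇒diff (excess≤ε v (level d) (units q le))) (upper≥0 d (q + q) (double q le)))
            (0≼⊗ (excess≥0 v (level d) (units q le)) (≼⇒diff (sifted≤upper d (q + q) (double q le)))))))
        where
        D = excess v (level d) (block q)
        Y = ε v (suc (level d)) (block q)
        U = eval-tree v (upper d (q + q))
        L = eval-tree v (lower d (q + q))
        X = sifted d (q + q)
        lower≡ : eval-tree v (lower (suc d) q) ≡ (π v (block q) ⊕ D) ⊗ L ⊖ Y ⊗ U
        lower≡ = cong₂ _⊖_ (trans (eval-truncated v (level d) (block q) (lower d (q + q))) (cong (_⊗ L) (τ-split d q)))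
          (eval-elementary v (suc (level d)) (block q) (upper d (q + q)))
        opaque
          unfolding K
          e : ∀ a D Y U X L → (a ⊕ D) ⊗ (X ⊖ L) ⊕ ((Y ⊖ D) ⊗ U ⊕ D ⊗ (U ⊖ X)) ≡ a ⊗ X ⊖ ((a ⊕ D) ⊗ L ⊖ Y ⊗ U)
          e = RS.solve-∀ K-ring

      sifted≤8 : ∀ d q → x₀ ≤ 2 ^ (3 * q) → sifted d q ≼ ι 8
      sifted≤8 zero q le = sifted≤upper zero q le
      sifted≤8 (suc d) q le = ≼-trans (⊗-monoˡ _ (π≥0 v (units q le)) (sifted≤8 d (q + q) (double q le)))
        (≼-trans (⊗-monoʳ (ι 8) (ι≥0 8) (π≤1 v (units q le))) (≼-reflexive (⊗-identityˡ _)))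

      sifted≤0-window : ∀ d q → x₀ ≤ 2 ^ (3 * q) → 8 ≤ Σlist (hit-count k) (window (doubled d q)) → sifted d q ≼ 0K
      sifted≤0-window zero q le h = ≼-trans (⊖-mono (≼-refl {ι 8})
        (≼-trans (ι-mono h) (≼-reflexive (sym (σ-hits (window q)))))) (≼-reflexive (⊖-self (ι 8)))
      sifted≤0-window (suc d) q le h = ≼-trans (⊗-monoˡ _ (π≥0 v (units q le))
        (sifted≤0-window d (q + q) (double q le) h)) (≼-reflexive (⊗-zeroʳ _))

      π-hit : ∀ {P} → All (InUnit v) P → 1 ≤ Σlist (hit-count k) P → π v P ≡ 0K
      π-hit {p ∷ P} (u ∷ us) h with hit-count k p in eq
      ... | zero = trans (cong ((1K ⊖ v p) ⊗_) (π-hit us h)) (⊗-zeroʳ _)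
      ... | suc zero = trans (cong (_⊗ π v P) (trans (cong (1K ⊖_) (trans (hits≡ k p) (trans (cong ι eq) ι-1)))
        (⊖-self 1K))) (⊗-zeroˡ _)
      ... | suc (suc n) = ⊥-elim (impossible (ι-cancel-≤
        (subst₂ _≼_ (trans (hits≡ k p) (cong ι eq)) (sym ι-1) (proj₂ u))))
        where
        impossible : ¬ suc (suc n) ≤ 1
        impossible (s≤s ())

      sifted≤0-block : ∀ d q → x₀ ≤ 2 ^ (3 * q) → 1 ≤ block-hits k d q → sifted d q ≡ 0K
      sifted≤0-block (suc d) q le h with 1 ≤? Σlist (hit-count k) (block q)
      ... | yes h′ = trans (cong (_⊗ sifted d (q + q)) (π-hit (units q le) h′)) (⊗-zeroˡ _)
      ... | no ¬h′ = trans (cong (π v (block q) ⊗_) (sifted≤0-block d (q + q) (double q le)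
          (subst (λ t → 1 ≤ t + block-hits k d (q + q)) (n<1⇒n≡0 (≰⇒> ¬h′)) h))) (⊗-zeroʳ _)

      Sifted : ℕ → ℕ → Set
      Sifted d q = block-hits k d q ≡ 0 × Σlist (hit-count k) (window (doubled d q)) ≤ 7 × Σlist (square-count k)
        (window (doubled d q)) ≡ 0

      sifted? : ∀ d q → Dec (Sifted d q)
      sifted? d q with block-hits k d q ≟ 0 | Σlist (hit-count k) (window (doubled d q)) ≤? 7 | Σlist (square-count k)
        (window (doubled d q)) ≟ 0
      ... | no ¬a | _ | _ = no (λ (a , _) → ¬a a)
      ... | yes _ | no ¬b | _ = no (λ (_ , b , _) → ¬b b)
      ... | yes _ | yes _ | no ¬c = no (λ (_ , _ , c) → ¬c c)
      ... | yes a | yes b | yes c = yes (a , b , c)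

      -- A prime in a block or eight hits in the window make the weight at most 0. In the only other
      -- case a square divides a form, and the weight, at most 8, is charged to it.
      unsifted-bound : ∀ d q → x₀ ≤ 2 ^ (3 * q) → ¬ Sifted d q → eval-tree v (lower d q) ≼ ι
        (8 * Σlist (square-count k) (window (doubled d q)))
      unsifted-bound d q le ¬s with 1 ≤? block-hits k d q | 8 ≤? Σlist (hit-count k) (window (doubled d q)) | 1 ≤?
        Σlist (square-count k) (window (doubled d q))
      ... | yes a | _ | _ = ≼-trans (lower≤sifted d q le) (≼-trans (≼-reflexive (sifted≤0-block d q le a)) (ι≥0 _))
      ... | no _ | yes b | _ = ≼-trans (lower≤sifted d q le) (≼-trans (sifted≤0-window d q le b) (ι≥0 _))
      ... | no _ | no _ | yes c = ≼-trans (lower≤sifted d q le) (≼-trans (sifted≤8 d q le) (ι-mono (*-monoʳ-≤ 8 c)))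
      ... | no ¬a | no ¬b | no ¬c = ⊥-elim (¬s (n<1⇒n≡0 (≰⇒> ¬a) , s≤s⁻¹ (≰⇒> ¬b) , n<1⇒n≡0 (≰⇒> ¬c)))

    -- A square p² hits each form at most N/p² + 1 times, and p > y = 2^(3x), so `y` times this is
    -- at most N/p + y. Summing over the window reuses its density and saves a factor 2^(3x) over
    -- `N`.
    square-sum : ∀ N x → 300 ≤ x → x₀ ≤ 2 ^ (3 * x) →
      10 * (2 ^ (3 * x) * Σℕ N (λ k → Σlist (square-count k) (window x))) ≤ 20 * 2 ^ (27 * x) + 63 * N
    square-sum N x x≥ le = ι-cancel-≤ (≼-trans (≼-reflexive eq₁)
      (≼-trans (⊗-monoˡ (ι 10) (ι≥0 10) total) (≼-trans (≼-reflexive eq₂)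
        (≼-trans (⊕-mono (ι-mono main) (⊗-monoˡ (ι N) (ι≥0 N) (window-σ density x block-σ x≥))) (≼-reflexive eq₃)))))
      where
      y = 2 ^ (3 * x)
      P = window x
      counts : ℕ → ℕ
      counts p = Σℕ N (λ k → square-count k p)
      one : ∀ γ {p} → Prime p → y < p → ι y ⊗ ι (Σℕ N (λ k → δ (p * p) (W * k + γ))) ≼ ι y ⊕ ι N ⊗ inv p
      one γ {p} pp y<p = bound (Σℕ N (λ k → δ (p * p) (W * k + γ)))
        (count-form (p * p) {W} (prime-square-coprime pp (proj₁ (proj₂ (sound pp (≤-<-trans le y<p))))) γ N)
        where
        instance _ = prime⇒nonZero pp
        instance _ = m*n≢0 p p
        opaque
          unfolding K
          e : ∀ i p t → i ⊗ (p ⊗ t) ≡ (i ⊗ p) ⊗ t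
          e = RS.solve-∀ K-ring
          e′ : ∀ y c → y ⊗ (1K ⊕ c) ≡ y ⊕ y ⊗ c
          e′ = RS.solve-∀ K-ring
        bound : ∀ C → p * p * C ≤ N + p * p → ι y ⊗ ι C ≼ ι y ⊕ ι N ⊗ inv p
        bound zero _ = ≼-trans (≼-reflexive (trans (cong (ι y ⊗_) ι-0) (⊗-zeroʳ _)))
          (0≼⊕ (ι≥0 y) (0≼⊗ (ι≥0 N) (inv≥0 p)))
        bound (suc C) hC = subst (_≼ ι y ⊕ ι N ⊗ inv p) (sym (trans (cong (ι y ⊗_) (ι-suc C)) (e′ (ι y) (ι C))))
          (⊕-mono (≼-refl {ι y}) (subst₂ _≼_ (trans (cong (inv p ⊗_) (ι-* p (y * C)))
            (trans (e (inv p) (ι p) (ι (y * C))) (trans (cong (_⊗ ι (y * C)) (inv-inverse p))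
            (trans (⊗-identityˡ _) (ι-* y C))))) (⊗-comm (inv p) (ι N))
            (⊗-monoˡ (inv p) (inv≥0 p) (ι-mono pyC≤N))))
          where
          pyC≤N : p * (y * C) ≤ N
          pyC≤N = ≤-trans (*-monoʳ-≤ p (*-monoˡ-≤ C (<⇒≤ y<p))) (+-cancelˡ-≤ (p * p) _ _
            (≤-trans (≤-reflexive (trans (cong (p * p +_) (sym (*-assoc p p C))) (sym (*-suc (p * p) C))))
              (≤-trans hC (≤-reflexive (+-comm N (p * p))))))
      both : ∀ {p} → y < p × p ≤ 2 ^ (24 * x) × Prime p → ι y ⊗ ι (counts p) ≼ ι (2 * y) ⊕ ι N ⊗ density p
      both {p} (y<p , _ , pp) = subst₂ _≼_ (trans (sym (⊗-distribˡ (ι y) _ _))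
        (cong (ι y ⊗_) (trans (sym (ι-+ (Σℕ N (λ k → δ (p * p) (form₁ k))) (Σℕ N (λ k → δ (p * p) (form₂ k)))))
        (cong ι (sym (Σℕ-+ _ _ N))))))
        (trans (e (ι y) (ι N) (inv p)) (cong (_⊕ ι N ⊗ density p)
          (trans (sym (ι-+ y y)) (cong (λ t → ι (y + t)) (sym (+-identityʳ y))))))
        (⊕-mono (one β pp y<p) (one (β + h) pp y<p))
        where
        opaque
          unfolding K
          e : ∀ y n i → (y ⊕ n ⊗ i) ⊕ (y ⊕ n ⊗ i) ≡ (y ⊕ y) ⊕ n ⊗ (i ⊕ i)
          e = RS.solve-∀ K-ring
      sum-all : ∀ {P} → All (λ p → y < p × p ≤ 2 ^ (24 * x) × Prime p) P → ι y ⊗ ι (Σlist counts P) ≼ ι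
        (length P * (2 * y)) ⊕ ι N ⊗ σ density P
      sum-all [] = ≼-reflexive (trans (cong (ι y ⊗_) ι-0)
        (trans (⊗-zeroʳ _) (sym (trans (cong₂ _⊕_ ι-0 (⊗-zeroʳ _)) (⊕-identityˡ 0K)))))
      sum-all {p ∷ P} (a ∷ as) = subst₂ _≼_ (trans (sym (⊗-distribˡ (ι y) _ _))
        (cong (ι y ⊗_) (sym (ι-+ (counts p) _))))
        (trans (e (ι (2 * y)) (ι N) (density p) (ι (length P * (2 * y))) (σ density P))
          (cong (_⊕ ι N ⊗ σ density (p ∷ P)) (sym (ι-+ (2 * y) _))))
        (⊕-mono (both a) (sum-all as))
        where
        opaque
          unfolding K
          e : ∀ a n g b s → (a ⊕ n ⊗ g) ⊕ (b ⊕ n ⊗ s) ≡ (a ⊕ b) ⊕ n ⊗ (g ⊕ s)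
          e = RS.solve-∀ K-ring
      total : ι y ⊗ ι (Σlist counts P) ≼ ι (length P * (2 * y)) ⊕ ι N ⊗ σ density P
      total = sum-all (chain-All P (window-chain x))
      eq₁ : ι (10 * (y * Σℕ N (λ k → Σlist (square-count k) P))) ≡ ι 10 ⊗ (ι y ⊗ ι (Σlist counts P))
      eq₁ = trans (ι-* 10 _) (cong (ι 10 ⊗_) (trans (ι-* y _) (cong (λ t → ι y ⊗ ι t) (Σℕ-Σlist square-count P N))))
      opaque
        unfolding K
        e₂ : ∀ t a n s → t ⊗ (a ⊕ n ⊗ s) ≡ t ⊗ a ⊕ n ⊗ (t ⊗ s)
        e₂ = RS.solve-∀ K-ring
      eq₂ : ι 10 ⊗ (ι (length P * (2 * y)) ⊕ ι N ⊗ σ density P) ≡ ι (10 * (length P * (2 * y))) ⊕ ι N ⊗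
        (ι 10 ⊗ σ density P)
      eq₂ = trans (e₂ (ι 10) _ (ι N) _) (cong (_⊕ ι N ⊗ (ι 10 ⊗ σ density P)) (sym (ι-* 10 _)))
      main : 10 * (length P * (2 * y)) ≤ 20 * 2 ^ (27 * x)
      main = ≤-trans (≤-reflexive (e (length P) y))
        (*-monoʳ-≤ 20 (≤-trans (*-monoʳ-≤ y (window-length x))
        (≤-reflexive (trans (sym (^-distribˡ-+-* 2 (3 * x) (24 * x))) (cong (2 ^_) (sym (*-distribʳ-+ x 3 24)))))))
        where
        e : ∀ l y → 10 * (l * (2 * y)) ≡ 20 * (y * l)
        e = ℕ-solve
      eq₃ : ι (20 * 2 ^ (27 * x)) ⊕ ι N ⊗ ι 63 ≡ ι (20 * 2 ^ (27 * x) + 63 * N)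
      eq₃ = trans (cong (ι (20 * 2 ^ (27 * x)) ⊕_) (trans (⊗-comm (ι N) (ι 63)) (sym (ι-* 63 N))))
        (sym (ι-+ _ (63 * N)))

  -- Existence of a sifted value

  search : ∀ {P : ℕ → Set} → (∀ k → Dec (P k)) → ∀ N → (∃ λ k → k < N × P k) ⊎ (∀ k → k < N → ¬ P k)
  search P? zero = inj₂ (λ k ())
  search {P} P? (suc N) with P? N | search P? N
  ... | yes p | _ = inj₁ (N , n<1+n N , p)
  ... | no _ | inj₁ (k , k<N , p) = inj₁ (k , m<n⇒m<1+n k<N , p)
  ... | no ¬p | inj₂ none = inj₂ below
    where
    below : ∀ k → k < suc N → ¬ P k
    below k k<1+N with k ≟ N
    ... | yes refl = ¬p
    ... | no k≢N = none k (≤∧≢⇒< (s≤s⁻¹ k<1+N) k≢N)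

  ΣK-mono : ∀ (f g : ℕ → K) N → (∀ k → k < N → f k ≼ g k) → ΣK N f ≼ ΣK N g
  ΣK-mono f g zero h = ≼-refl
  ΣK-mono f g (suc N) h = ⊕-mono (h N (n<1+n N)) (ΣK-mono f g N (λ k k<N → h k (m<n⇒m<1+n k<N)))

  n<2^n : ∀ n → n < 2 ^ n
  n<2^n zero = s≤s z≤n
  n<2^n (suc n) = ≤-trans (+-mono-≤ (m^n>0 2 n) (n<2^n n)) (≤-reflexive (cong (2 ^ n +_) (sym (+-identityʳ (2 ^ n)))))

  module Existence (W β h x₀ : ℕ) (sound : ∀ {p} → Prime p → x₀ < p → Forms.Good W β h p) where
    open Forms W β h
    open Sift W β h x₀ sound

    module _ (d q : ℕ) (q≥ : 300 ≤ q) (le : x₀ ≤ 2 ^ (3 * q)) where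

      x N w : ℕ
      x = 2 ^ d * q
      N = 2 ^ (90 * x)
      w = weight (lower d q)

      squares : ℕ → ℕ
      squares k = Σlist (square-count k) (window (doubled d q))

      q≤x : q ≤ x
      q≤x = m≤n*m q (2 ^ d) {{m^n≢0 2 d}}

      -- Lets a single factor 2^x absorb constants and powers such as 64^d.
      small : 300 * suc d ≤ x
      small = ≤-trans (≤-reflexive (*-comm 300 (suc d))) (*-mono-≤ (n<2^n d) q≥)

      -- The expected total of `lower` is at least N / 64^d. If nothing is sifted, the actual total
      -- is at most the contribution of squares, and only the rounding error `w` can make up the
      -- difference.
      none⇒N≤ : (∀ k → k < N → ¬ At.Sifted k d q) → N ≤ 64 ^ d * (8 * Σℕ N squares + w)
      none⇒N≤ none = ι-cancel-≤ (≼-trans (≼-reflexive (sym (⊗-identityʳ _)))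
        (≼-trans (⊗-monoˡ (ι N) (ι≥0 N) (Density.main-term d q q≥))
        (≼-trans (≼-reflexive (e (ι N) (ι (64 ^ d)) (Density.L d q)))
          (≼-trans (⊗-monoˡ (ι (64 ^ d)) (ι≥0 _) (≼-trans estimate (⊕-mono pointwise (≼-refl {ι w}))))
          (≼-reflexive (trans (cong (ι (64 ^ d) ⊗_) (sym (ι-+ _ w))) (sym (ι-* (64 ^ d) _))))))))
        where
        opaque
          unfolding K
          e : ∀ n t l → n ⊗ (t ⊗ l) ≡ t ⊗ (n ⊗ l)
          e = RS.solve-∀ K-ring
        total : K
        total = ΣK N (λ k → eval-tree (hits k) (lower d q))
        ι1⊗ : ∀ a → ι 1 ⊗ a ≡ a
        ι1⊗ a = trans (cong (_⊗ a) ι-1) (⊗-identityˡ a)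
        class-sum≡ : class-sum N 1 0 (lower d q) ≡ total
        class-sum≡ = ΣK-cong (λ k → trans (cong (λ t → ι t ⊗ eval-tree (hits k) (lower d q)) (δ-yes (1∣ _))) (ι1⊗ _)) N
        no-prime : NoPrimeAbove (2 ^ (3 * q)) 1
        no-prime pp _ p∣1 = ¬prime[1] (subst Prime (∣1⇒≡1 p∣1) pp)
        estimate : ι N ⊗ Density.L d q ≼ total ⊕ ι w
        estimate = ≼-trans (proj₂ (class-sum-estimate N (lower d q) (2 ^ (3 * q)) 1 0
          (ascending-lower W β h x₀ sound d q le) no-prime))
          (≼-reflexive (cong₂ _⊕_ (trans (ι1⊗ _) class-sum≡) (ι1⊗ _)))
        pointwise : total ≼ ι (8 * Σℕ N squares)
        pointwise = ≼-trans (ΣK-mono _ (λ k → ι (8 * squares k)) N (λ k k<N → At.unsifted-bound k d q le (none k k<N)))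
          (≼-reflexive (trans (ΣK-ι (λ k → 8 * squares k) N) (cong ι (Σℕ-* 8 squares N))))
          where
          Σℕ-* : ∀ c (f : ℕ → ℕ) N → Σℕ N (λ k → c * f k) ≡ c * Σℕ N f
          Σℕ-* c f zero = sym (*-zeroʳ c)
          Σℕ-* c f (suc N) = trans (cong (c * f N +_) (Σℕ-* c f N)) (sym (*-distribˡ-+ c (f N) _))

      squares-bound : 10 * (2 ^ (3 * x) * Σℕ N squares) ≤ 20 * 2 ^ (27 * x) + 63 * N
      squares-bound = subst (λ t → 10 * (2 ^ (3 * x) * Σℕ N (λ k → Σlist (square-count k) (window t))) ≤ 20 * 2 ^
        (27 * x) + 63 * N) (sym (doubled≡ d q))
        (square-sum N x (≤-trans q≥ q≤x) (≤-trans le (^-monoʳ-≤ 2 (*-monoʳ-≤ 3 q≤x))))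

      weight-bound : w ≤ 2 ^ (5 + d) * 2 ^ (89 * x)
      weight-bound = ≤-trans (m≤m*n w _ {{m^n≢0 2 (13 * ((5 + d) * q))}})
        (weight-lower d q (≤-trans (≤ᵇ⇒≤ 4 300 tt) q≥))

      -- Multiplied by 10 · 2^(3x), the left side becomes 10 M with M = 2^(93x), while the two parts
      -- of the square count and the rounding error are at most M each.
      contradiction-bound : ¬ N ≤ 64 ^ d * (8 * Σℕ N squares + w)
      contradiction-bound N≤ = <⇒≱ strict (≤-trans (*-monoʳ-≤ (10 * Y) N≤)
        (≤-trans (≤-reflexive (e₁ Y (64 ^ d) (Σℕ N squares) w))
          (≤-trans (*-monoʳ-≤ (64 ^ d) (+-mono-≤ (*-monoʳ-≤ 8 squares-bound) (*-monoʳ-≤ (10 * Y) weight-bound)))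
            (≤-trans (≤-reflexive (e₂ (64 ^ d) (2 ^ (27 * x)) N Y (2 ^ (5 + d)) (2 ^ (89 * x))))
            (+-mono-≤ (+-mono-≤ t₁ t₂) t₃)))))
        where
        Y = 2 ^ (3 * x)
        M = 2 ^ (93 * x)
        e₁ : ∀ Y g s w → 10 * Y * (g * (8 * s + w)) ≡ g * (8 * (10 * (Y * s)) + 10 * Y * w)
        e₁ = ℕ-solve
        e₂ : ∀ g a n Y b c → g * (8 * (20 * a + 63 * n) + 10 * Y * (b * c)) ≡ 160 * (g * a) + 504 * (g * n) + 10 *
          (g * Y * (b * c))
        e₂ = ℕ-solve
        64^d : 64 ^ d ≡ 2 ^ (6 * d)
        64^d = ^-*-assoc 2 6 d
        power : ∀ c a b → c ≤ 2 ^ a → a + b ≤ 93 * x → c * 2 ^ b ≤ M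
        power c a b h₁ h₂ = ≤-trans (*-monoˡ-≤ (2 ^ b) h₁)
          (≤-trans (≤-reflexive (sym (^-distribˡ-+-* 2 a b))) (^-monoʳ-≤ 2 h₂))
        d-bound : ∀ c a → a ≤ 300 → c ≤ 300 → c * d + a ≤ x
        d-bound c a ha hc = ≤-trans (+-mono-≤ (*-monoˡ-≤ d hc) ha)
          (≤-trans (≤-reflexive (trans (+-comm (300 * d) 300) (sym (*-suc 300 d)))) small)
        expand : ∀ c a b → c * d + a ≤ x → b + x ≤ 93 * x → a + (c * d + b) ≤ 93 * x
        expand c a b h₁ h₂ = ≤-trans (≤-reflexive (e c a b d)) (≤-trans (+-monoʳ-≤ b h₁) h₂)
          where
          e : ∀ c a b d → a + (c * d + b) ≡ b + (c * d + a)
          e = ℕ-solve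
        mult : ∀ c → c ≤ 92 → c * x + x ≤ 93 * x
        mult c h = ≤-trans (≤-reflexive (+-comm (c * x) x)) (*-monoˡ-≤ x (s≤s h))
        t₁ : 160 * (64 ^ d * 2 ^ (27 * x)) ≤ M
        t₁ = ≤-trans (≤-reflexive (cong (160 *_) (trans (cong (_* 2 ^ (27 * x)) 64^d)
          (sym (^-distribˡ-+-* 2 (6 * d) (27 * x))))))
          (power 160 8 _ (≤ᵇ⇒≤ 160 256 tt) (expand 6 8 (27 * x) (d-bound 6 8 (≤ᵇ⇒≤ 8 300 tt) (≤ᵇ⇒≤ 6 300 tt))
            (mult 27 (≤ᵇ⇒≤ 27 92 tt))))
        t₂ : 504 * (64 ^ d * N) ≤ M
        t₂ = ≤-trans (≤-reflexive (cong (504 *_) (trans (cong (_* N) 64^d) (sym (^-distribˡ-+-* 2 (6 * d) (90 * x))))))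
          (power 504 9 _ (≤ᵇ⇒≤ 504 512 tt) (expand 6 9 (90 * x) (d-bound 6 9 (≤ᵇ⇒≤ 9 300 tt) (≤ᵇ⇒≤ 6 300 tt))
            (mult 90 (≤ᵇ⇒≤ 90 92 tt))))
        t₃ : 10 * (64 ^ d * Y * (2 ^ (5 + d) * 2 ^ (89 * x))) ≤ M
        t₃ = ≤-trans (≤-reflexive (cong (10 *_) (trans
          (cong₂ (λ a b → a * Y * b) 64^d (sym (^-distribˡ-+-* 2 (5 + d) (89 * x))))
            (trans (cong (_* 2 ^ (5 + d + 89 * x)) (sym (^-distribˡ-+-* 2 (6 * d) (3 * x))))
              (sym (^-distribˡ-+-* 2 (6 * d + 3 * x) (5 + d + 89 * x)))))))
          (power 10 4 _ (≤ᵇ⇒≤ 10 16 tt) (≤-trans (≤-reflexive (e d x))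
            (expand 7 9 (92 * x) (d-bound 7 9 (≤ᵇ⇒≤ 9 300 tt) (≤ᵇ⇒≤ 7 300 tt)) (mult 92 ≤-refl))))
          where
          e : ∀ d x → 4 + (6 * d + 3 * x + (5 + d + 89 * x)) ≡ 9 + (7 * d + 92 * x)
          e = ℕ-solve
        strict : M + M + M < 10 * Y * N
        strict = subst (M + M + M <_) (trans (cong (10 *_)
          (trans (cong (2 ^_) (*-distribʳ-+ x 3 90)) (^-distribˡ-+-* 2 (3 * x) (90 * x)))) (sym (*-assoc 10 Y N)))
          (≤-trans (+-monoˡ-≤ (M + M + M) (m^n>0 2 (93 * x)))
            (≤-trans (≤-reflexive (e M)) (*-monoˡ-≤ M (≤ᵇ⇒≤ 4 10 tt))))
          where
          e : ∀ m → m + (m + m + m) ≡ 4 * m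
          e = ℕ-solve

      exists-sifted : ∃ λ k → k < N × At.Sifted k d q
      exists-sifted with search (λ k → At.sifted? k d q) N
      ... | inj₁ found = found
      ... | inj₂ none = ⊥-elim (contradiction-bound (none⇒N≤ none))

  -- Counting prime factors

  ≟-count : ℕ → ℕ → ℕ
  ≟-count p r with p ≟ r
  ... | yes _ = 1
  ... | no _ = 0

  multiplicity : ℕ → List ℕ → ℕ
  multiplicity p ps = Σlist (≟-count p) ps

  multiplicity-∣ : ∀ p ps → p ^ multiplicity p ps ∣ product ps
  multiplicity-∣ p [] = ∣-refl
  multiplicity-∣ p (r ∷ ps) with p ≟ r
  ... | yes refl = *-pres-∣ (∣-refl {p}) (multiplicity-∣ p ps)
  ... | no _ = ∣n⇒∣m*n r (multiplicity-∣ p ps)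

  Σlist-mono : ∀ (f g : ℕ → ℕ) {P} → All (λ p → f p ≤ g p) P → Σlist f P ≤ Σlist g P
  Σlist-mono f g [] = z≤n
  Σlist-mono f g (h ∷ hs) = +-mono-≤ h (Σlist-mono f g hs)

  Σlist-+ : ∀ (f g : ℕ → ℕ) P → Σlist (λ p → f p + g p) P ≡ Σlist f P + Σlist g P
  Σlist-+ f g [] = refl
  Σlist-+ f g (p ∷ P) = trans (cong (f p + g p +_) (Σlist-+ f g P)) (e (f p) (g p) _ _)
    where
    e : ∀ a b c d → a + b + (c + d) ≡ (a + c) + (b + d)
    e = ℕ-solve

  term≤Σlist : ∀ (f : ℕ → ℕ) {p P} → p ∈ P → f p ≤ Σlist f P
  term≤Σlist f {p} (here refl) = m≤m+n (f p) _
  term≤Σlist f {P = r ∷ P} (there i) = ≤-trans (term≤Σlist f i) (m≤n+m _ (f r))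

  small-count : ℕ → List ℕ → ℕ
  small-count b [] = 0
  small-count b (r ∷ ps) with r ≤? b
  ... | yes _ = suc (small-count b ps)
  ... | no _ = small-count b ps

  small-count≤ : ∀ b Q ps → All (λ r → r ≤ b → r ∈ Q) ps → small-count b ps ≤ Σlist (λ p → multiplicity p ps) Q
  small-count≤ b Q [] [] = z≤n
  small-count≤ b Q (r ∷ ps) (h ∷ hs) = subst (small-count b (r ∷ ps) ≤_)
    (sym (Σlist-+ (λ p → ≟-count p r) (λ p → multiplicity p ps) Q)) step
    where
    self : ≟-count r r ≡ 1
    self with r ≟ r
    ... | yes _ = refl
    ... | no ¬e = ⊥-elim (¬e refl)
    step : small-count b (r ∷ ps) ≤ Σlist (λ p → ≟-count p r) Q + Σlist (λ p → multiplicity p ps) Q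
    step with r ≤? b
    ... | yes r≤b = +-mono-≤ (subst (_≤ Σlist (λ p → ≟-count p r) Q) self (term≤Σlist (λ p → ≟-count p r) (h r≤b)))
      (small-count≤ b Q ps hs)
    ... | no _ = ≤-trans (small-count≤ b Q ps hs) (m≤n+m _ _)

  -- A prime above 2^(24x) brings 24 x bits by itself; a smaller one brings at least 3 x, and the 21
  -- x it may lack are credited on the right.
  factors-size : ∀ x ps → All (λ r → 2 ^ (3 * x) < r) ps →
    2 ^ (24 * x * length ps) ≤ product ps * 2 ^ (21 * x * small-count (2 ^ (24 * x)) ps)
  factors-size x [] [] = ≤-reflexive (trans (cong (2 ^_) (*-zeroʳ (24 * x)))
    (sym (trans (*-identityˡ _) (cong (2 ^_) (*-zeroʳ (21 * x))))))
  factors-size x (r ∷ ps) (r> ∷ rs) with r ≤? 2 ^ (24 * x)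
  ... | yes _ = ≤-trans (≤-reflexive (trans (cong (2 ^_) (*-suc (24 * x) (length ps))) (^-distribˡ-+-* 2 (24 * x) _)))
      (≤-trans (*-mono-≤ big (factors-size x ps rs))
        (≤-reflexive (trans (e r (2 ^ (21 * x)) (product ps) _) (cong (r * product ps *_)
        (sym (trans (cong (2 ^_) (*-suc (21 * x) (small-count (2 ^ (24 * x)) ps))) (^-distribˡ-+-* 2 (21 * x) _)))))))
    where
    e : ∀ r a p b → r * a * (p * b) ≡ r * p * (a * b)
    e = ℕ-solve
    big : 2 ^ (24 * x) ≤ r * 2 ^ (21 * x)
    big = ≤-trans (≤-reflexive (trans (cong (2 ^_) (*-distribʳ-+ x 3 21)) (^-distribˡ-+-* 2 (3 * x) (21 * x))))
      (*-monoˡ-≤ (2 ^ (21 * x)) (<⇒≤ r>))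
  ... | no r≰ = ≤-trans (≤-reflexive (trans (cong (2 ^_) (*-suc (24 * x) (length ps))) (^-distribˡ-+-* 2 (24 * x) _)))
      (≤-trans (*-mono-≤ (<⇒≤ (≰⇒> r≰)) (factors-size x ps rs)) (≤-reflexive (sym (*-assoc r (product ps) _))))

  δ≡0⇒∤ : ∀ {d n} → δ d n ≡ 0 → ¬ d ∣ n
  δ≡0⇒∤ eq p with trans (sym (δ-yes p)) eq
  ... | ()

  ∈-window : ∀ x {p} → Prime p → 2 ^ (3 * x) < p → p ≤ 2 ^ (24 * x) → p ∈ window x
  ∈-window x {p} pp lo hi with p ≤? 2 ^ (3 * (x + x)) | p ≤? 2 ^ (3 * (x + x + (x + x)))
  ... | yes h | _ = ∈-++⁺ˡ (∈-block x pp lo h)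
  ... | no h | yes h′ = ∈-++⁺ʳ (block x) (∈-++⁺ˡ (∈-block (x + x) pp (≰⇒> h) h′))
  ... | no h | no h′ = ∈-++⁺ʳ (block x) (∈-++⁺ʳ (block (x + x))
    (∈-block (x + x + (x + x)) pp (≰⇒> h′) (subst (λ j → p ≤ 2 ^ j) (e x) hi)))
    where
    e : ∀ x → 24 * x ≡ 3 * (x + x + (x + x) + (x + x + (x + x)))
    e = ℕ-solve

  module Extraction (W β h x₀ : ℕ) (sound : ∀ {p} → Prime p → x₀ < p → Forms.Good W β h p)
    (k : ℕ) (avoid : ∀ {p} → Prime p → p ≤ x₀ → ¬ p ∣ Forms.form₁ W β h k × ¬ p ∣ Forms.form₂ W β h k) where
    open Forms W β h
    open Sift W β h x₀ sound

    n m : ℕ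
    n = form₁ k
    m = form₂ k

    no-block-prime : ∀ d q → block-hits k d q ≡ 0 → ∀ {p} → Prime p → 2 ^ (3 * q) < p → p ≤ 2 ^ (3 * doubled d q) → ¬
      p ∣ n × ¬ p ∣ m
    no-block-prime zero q eq pp lo hi = ⊥-elim (<⇒≱ lo hi)
    no-block-prime (suc d) q eq {p} pp lo hi with p ≤? 2 ^ (3 * (q + q))
    ... | no p≰ = no-block-prime d (q + q) (m+n≡0⇒n≡0 (Σlist (hit-count k) (block q)) eq) pp (≰⇒> p≰) hi
    ... | yes p≤ = δ≡0⇒∤ (m+n≡0⇒m≡0 (δ p n) hits≡0) , δ≡0⇒∤ (m+n≡0⇒n≡0 (δ p n) hits≡0)
      where
      hits≡0 : hit-count k p ≡ 0
      hits≡0 = n≤0⇒n≡0 (≤-trans (term≤Σlist (hit-count k) (∈-block q pp lo p≤)) (≤-reflexive (m+n≡0⇒m≡0 _ eq)))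

    module _ (d q : ℕ) (x₀≡ : x₀ ≡ 2 ^ (3 * q)) (sifted : At.Sifted k d q) where

      x : ℕ
      x = doubled d q

      -- The residue class excludes the primes up to `x₀` = 2^(3q), the blocks those from there to
      -- 2^(3x).
      large-primes : ∀ {p} → Prime p → p ∣ n ⊎ p ∣ m → 2 ^ (3 * x) < p
      large-primes {p} pp p∣ with p ≤? 2 ^ (3 * x) | p ≤? x₀
      ... | no p≰ | _ = ≰⇒> p≰
      ... | yes p≤ | yes p≤x₀ = ⊥-elim ([ proj₁ (avoid pp p≤x₀) , proj₂ (avoid pp p≤x₀) ]′ p∣)
      ... | yes p≤ | no p≰x₀ = ⊥-elim ([ proj₁ none , proj₂ none ]′ p∣)
        where none = no-block-prime d q (proj₁ sifted) pp (subst (_< p) x₀≡ (≰⇒> p≰x₀)) p≤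

      x₀<⇒∤h : ∀ {p} → Prime p → 2 ^ (3 * x) < p → ¬ p ∣ h
      x₀<⇒∤h pp lo = proj₂ (proj₂ (sound pp (≤-<-trans
        (≤-trans (≤-reflexive x₀≡) (^-monoʳ-≤ 2 (*-monoʳ-≤ 3
        (≤-trans (m≤n*m q (2 ^ d) {{m^n≢0 2 d}}) (≤-reflexive (sym (doubled≡ d q))))))) lo)))

      -- A window prime divides at most one of `n` and `m`, and its square divides neither; so it
      -- occurs at most once among the factors, and then it is a hit.
      multiplicity≤hits : ∀ ps → product ps ≡ n * m → ∀ {p} → p ∈ window x → multiplicity p ps ≤ hit-count k p
      multiplicity≤hits ps eq {p} p∈ = case (multiplicity p ps) refl
        where
        info = All.lookup (chain-All (window x) (window-chain x)) p∈
        pp = proj₂ (proj₂ info)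
        instance _ = prime⇒nonZero pp
        squares≡0 : square-count k p ≡ 0
        squares≡0 = n≤0⇒n≡0 (≤-trans (term≤Σlist (square-count k) p∈) (≤-reflexive (proj₂ (proj₂ sifted))))
        power∣ : ∀ j → j ≤ multiplicity p ps → p ^ j ∣ n * m
        power∣ j j≤ = ∣-trans (divides (p ^ (multiplicity p ps ∸ j))
          (trans (cong (p ^_) (sym (m∸n+n≡m j≤))) (^-distribˡ-+-* p (multiplicity p ps ∸ j) j)))
          (subst (p ^ multiplicity p ps ∣_) eq (multiplicity-∣ p ps))
        not-both : p ∣ n → ¬ p ∣ m
        not-both p∣n p∣m = x₀<⇒∤h pp (proj₁ info) (∣m+n∣m⇒∣n (subst (p ∣_) (sym (+-assoc (W * k) β h)) p∣m) p∣n)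
        p^2 : p ^ 2 ≡ p * p
        p^2 = cong (p *_) (*-identityʳ p)
        no-square : ¬ 2 ≤ multiplicity p ps
        no-square 2≤ with p ∣? n
        ... | yes p∣n = δ≡0⇒∤ (m+n≡0⇒m≡0 (δ (p * p) n) squares≡0)
          (subst (_∣ n) p^2 (^∣*-cancel 2 pp (not-both p∣n) (subst (p ^ 2 ∣_) (*-comm n m) (power∣ 2 2≤))))
        ... | no p∤n = δ≡0⇒∤ (m+n≡0⇒n≡0 (δ (p * p) n) squares≡0) (subst (_∣ m) p^2 (^∣*-cancel 2 pp p∤n (power∣ 2 2≤)))
        case : ∀ j → multiplicity p ps ≡ j → multiplicity p ps ≤ hit-count k p
        case zero e = subst (_≤ hit-count k p) (sym e) z≤n
        case (suc (suc j)) e = ⊥-elim (no-square (subst (2 ≤_) (sym e) (s≤s (s≤s z≤n))))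
        case (suc zero) e = subst (_≤ hit-count k p) (sym e)
          ([ (λ p∣n → ≤-trans (≤-reflexive (sym (δ-yes p∣n))) (m≤m+n _ _)) ,
          (λ p∣m → ≤-trans (≤-reflexive (sym (δ-yes p∣m))) (m≤n+m _ _)) ]′
          (euclidsLemma n m pp (subst (_∣ n * m) (*-identityʳ p) (power∣ 1 (≤-reflexive (sym e))))))

      few-factors : n * m < 2 ^ (189 * x) → ∀ ps → All Prime ps → product ps ≡ n * m → length ps ≤ 13
      few-factors size ps primes eq with length ps ≤? 13
      ... | yes ≤13 = ≤13
      ... | no ≰13 = ⊥-elim (<⇒≱ too-small (≤-trans (^-monoʳ-≤ 2 (*-monoʳ-≤ (24 * x) (≰⇒> ≰13)))
        (≤-trans (factors-size x ps large) (*-mono-≤ (≤-reflexive eq) (^-monoʳ-≤ 2 (*-monoʳ-≤ (21 * x) small))))))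
        where
        large : All (λ r → 2 ^ (3 * x) < r) ps
        large = All.zipWith (λ { {r} (pr , r∣) → large-primes pr (euclidsLemma n m pr (subst (r ∣_) eq r∣)) })
          (primes , All.tabulate ∈⇒∣product)
        small : small-count (2 ^ (24 * x)) ps ≤ 7
        small = ≤-trans (small-count≤ (2 ^ (24 * x)) (window x) ps
          (All.zipWith (λ (pr , lo) hi → ∈-window x pr lo hi) (primes , large)))
          (≤-trans (Σlist-mono (λ p → multiplicity p ps) (hit-count k) (All.tabulate (multiplicity≤hits ps eq)))
            (proj₁ (proj₂ sifted)))
        too-small : n * m * 2 ^ (21 * x * 7) < 2 ^ (24 * x * 14)
        too-small = ≤-trans (*-monoˡ-< (2 ^ (21 * x * 7)) {{m^n≢0 2 (21 * x * 7)}} size)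
          (≤-reflexive (trans (sym (^-distribˡ-+-* 2 (189 * x) (21 * x * 7))) (cong (2 ^_) (e x))))
          where
          e : ∀ x → 189 * x + 21 * x * 7 ≡ 24 * x * 14
          e = ℕ-solve

  -- Choice of the residue class and of the parameters

  prime∣product : ∀ {p} ps → Prime p → All Prime ps → p ∣ product ps → p ∈ ps
  prime∣product [] pp [] d = ⊥-elim (¬prime[1] (subst Prime (∣1⇒≡1 d) pp))
  prime∣product (r ∷ ps) pp (pr ∷ prs) d with euclidsLemma r (product ps) pp d
  ... | inj₂ d′ = there (prime∣product ps pp prs d′)
  ... | inj₁ d′ with prime⇒irreducible pr d′
  ...   | inj₁ refl = ⊥-elim (¬prime[1] pp)
  ...   | inj₂ eq = here eq

  Avoids : ℕ → ℕ → ℕ → Set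
  Avoids h β p = ¬ p ∣ β × ¬ p ∣ β + h

  -- Since h is even, one of the residues 1 and 2 works modulo each prime.
  local-residue : ∀ {h p} → 2 ∣ h → Prime p → ∃ λ s → Avoids h s p
  local-residue {h} {p} 2∣h pp with p ∣? 1 + h
  ... | no p∤ = 1 , (λ d → ¬prime[1] (subst Prime (∣1⇒≡1 d) pp)) , p∤
  ... | yes p∣ = 2 , p∤2 , λ d → ¬p∣1 (∣m+n∣m⇒∣n (subst (p ∣_) (+-comm 1 (1 + h)) d) p∣)
    where
    ¬p∣1 : ¬ p ∣ 1
    ¬p∣1 d = ¬prime[1] (subst Prime (∣1⇒≡1 d) pp)
    p∤2 : ¬ p ∣ 2
    p∤2 d = ¬p∣1 (∣m+n∣m⇒∣n (subst (p ∣_) (+-comm 1 h) p∣) (∣-trans d 2∣h))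

  residue : ∀ {h} → 2 ∣ h → ∀ {x y} P → Chain x P y → ∃ λ β → All (Avoids h β) P
  residue 2∣h [] c = 0 , []
  residue {h} 2∣h (p ∷ P) (x<p , pp , c) = merge (residue 2∣h P c) (local-residue 2∣h pp)
    where
    instance _ = prime⇒nonZero pp
    W = product P
    p∤W : ¬ p ∣ W
    p∤W d = n≮n p (proj₁ (All.lookup (chain-All P c)
      (prime∣product P pp (All.map (λ (_ , _ , pr) → pr) (chain-All P c)) d)))
    merge : (∃ λ β → All (Avoids h β) P) → (∃ λ s → Avoids h s p) → ∃ λ β → All (Avoids h β) (p ∷ P)
    -- Chinese remaindering: `W * i + β` keeps the residues modulo the later primes, and `i` makes
    -- it ≡ s modulo `p`; `s * pred p` stands for -s.
    merge (β , avoids) (s , p∤s , p∤s+h) with linear-congruence (prime∤⇒coprime pp p∤W) (β + s * pred p)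
    ... | i , d = β′ , (avoid-β , avoid-β+h) ∷ All.tabulate later
      where
      β′ = W * i + β
      d′ : p ∣ β′ + s * pred p
      d′ = subst (p ∣_) (sym (+-assoc (W * i) β (s * pred p))) d
      key : ∀ t → (β′ + s * pred p) + (s + t) ≡ s * p + (β′ + t)
      key t = trans (e β′ s (pred p) t) (cong (λ q → s * q + (β′ + t)) (suc-pred p))
        where
        e : ∀ b s q t → (b + s * q) + (s + t) ≡ s * suc q + (b + t)
        e = ℕ-solve
      shift : ∀ t → p ∣ β′ + t → p ∣ s + t
      shift t h′ = ∣m+n∣m⇒∣n (subst (p ∣_) (sym (key t)) (∣m∣n⇒∣m+n (n∣m*n s) h′)) d′
      avoid-β : ¬ p ∣ β′
      avoid-β h′ = p∤s (subst (p ∣_) (+-identityʳ s) (shift 0 (subst (p ∣_) (sym (+-identityʳ β′)) h′)))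
      avoid-β+h : ¬ p ∣ β′ + h
      avoid-β+h h′ = p∤s+h (shift h h′)
      later : ∀ {r} → r ∈ P → Avoids h β′ r
      later {r} r∈ = (λ d → proj₁ a (∣m+n∣m⇒∣n d r∣Wi)) ,
        (λ d → proj₂ a (∣m+n∣m⇒∣n (subst (r ∣_) (+-assoc (W * i) β h) d) r∣Wi))
        where
        a = All.lookup avoids r∈
        r∣Wi : r ∣ W * i
        r∣Wi = ∣m⇒∣m*n i (∈⇒∣product r∈)

  AtMost13 : ℕ → Set
  AtMost13 n = ∃ λ ps → All Prime ps × length ps ≤ 13 × product ps ≡ n

  prime-divisor : ∀ n → 2 ≤ n → ∃ λ p → Prime p × p ∣ n
  prime-divisor n n≥2 with factorise n {{>-nonZero (≤-trans (s≤s z≤n) n≥2)}}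
  ... | record { factors = [] ; isFactorisation = refl } = ⊥-elim (<⇒≱ n≥2 ≤-refl)
  ... | record { factors = p ∷ ps ; isFactorisation = refl ; factorsPrime = pp ∷ _ } = p , pp , m∣m*n (product ps)

  ∤⇒>0 : ∀ d {n} → ¬ d ∣ n → 0 < n
  ∤⇒>0 d {zero} ∤0 = ⊥-elim (∤0 (d ∣0))
  ∤⇒>0 d {suc n} _ = s≤s z≤n

  module AlmostPrimes (h : ℕ) (2∣h : 2 ∣ h) (h≥2 : 2 ≤ h) (q : ℕ) (q≥ : 300 ≤ q) (h≤q : h ≤ q) (B : ℕ) where

    w : ℕ
    w = 2 ^ (3 * q)

    P : List ℕ
    P = primesFrom 0 w

    P-chain : Chain 0 P w
    P-chain = primesFrom-chain 0 w

    W : ℕ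
    W = product P

    β : ℕ
    β = proj₁ (residue 2∣h P P-chain)

    h≤w : h ≤ w
    h≤w = ≤-trans h≤q (≤-trans (m≤n*m q 3) (<⇒≤ (n<2^n (3 * q))))

    sound : ∀ {p} → Prime p → w < p → Forms.Good W β h p
    sound {p} pp w<p = pp ,
      (λ d → <⇒≱ w<p (proj₁ (proj₂ (All.lookup (chain-All P P-chain)
        (prime∣product P pp (All.map (λ (_ , _ , pr) → pr) (chain-All P P-chain)) d))))) ,
      (λ d → <⇒≱ w<p (≤-trans (∣⇒≤ {{>-nonZero (≤-trans (s≤s z≤n) h≥2)}} d) h≤w))

    avoid : ∀ k {p} → Prime p → p ≤ w → ¬ p ∣ Forms.form₁ W β h k × ¬ p ∣ Forms.form₂ W β h k
    avoid k {p} pp p≤w = (λ d → proj₁ a (∣m+n∣m⇒∣n d p∣Wk)) , (λ d → proj₂ a (∣m+n∣m⇒∣n d p∣Wk))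
      where
      p∈P : p ∈ P
      p∈P = ∈-primesFrom 0 w pp (>-nonZero⁻¹ p {{prime⇒nonZero pp}}) p≤w
      a = All.lookup (proj₂ (residue 2∣h P P-chain)) p∈P
      p∣Wk : p ∣ W * k
      p∣Wk = ∣m⇒∣m*n k (∈⇒∣product p∈P)

    -- `W` and `β` depend on `q` alone, so `d` may be taken larger than them; then all coefficients
    -- are below 2^x. The summand `B` serves for `n>B`.
    d x : ℕ
    d = W + β + h + B
    x = doubled d q

    d≤x : d ≤ x
    d≤x = ≤-trans (<⇒≤ (n<2^n d)) (≤-trans (m≤m*n (2 ^ d) q {{>-nonZero (≤-trans (s≤s z≤n) q≥)}})
      (≤-reflexive (sym (doubled≡ d q))))

    found : ∃ λ k → k < 2 ^ (90 * (2 ^ d * q)) × Sift.At.Sifted W β h w sound k d q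
    found = Existence.exists-sifted W β h w sound d q q≥ ≤-refl

    module Candidate (k : ℕ) (k< : k < 2 ^ (90 * x)) (sifted : Sift.At.Sifted W β h w sound k d q) where

      open Forms W β h using (form₁; form₂)
      open Extraction W β h w sound k (avoid k) using (n; m; large-primes; few-factors)

      form-bound : ∀ γ → W + γ ≤ 2 ^ x → W * k + γ ≤ 2 ^ (91 * x)
      form-bound γ le = ≤-trans (+-mono-≤ (*-monoʳ-≤ W (<⇒≤ k<)) (m≤m*n γ (2 ^ (90 * x)) {{m^n≢0 2 (90 * x)}}))
        (≤-trans (≤-reflexive (sym (*-distribʳ-+ (2 ^ (90 * x)) W γ)))
        (≤-trans (*-monoˡ-≤ (2 ^ (90 * x)) le) (≤-reflexive (sym (^-distribˡ-+-* 2 x (90 * x))))))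

      constants : W + (β + h) ≤ 2 ^ x
      constants = ≤-trans (≤-reflexive (sym (+-assoc W β h)))
        (≤-trans (m≤m+n (W + β + h) B) (≤-trans d≤x (<⇒≤ (n<2^n x))))

      -- Each form is at most 2^(91x), and 182 is less than 189.
      size : n * m < 2 ^ (189 * x)
      size = ≤-<-trans (*-mono-≤ (form-bound β (≤-trans (+-monoʳ-≤ W (m≤m+n β h)) constants))
        (form-bound (β + h) constants))
        (≤-<-trans (≤-reflexive (trans (sym (^-distribˡ-+-* 2 (91 * x) (91 * x)))
          (cong (2 ^_) (sym (*-distribʳ-+ x 91 91)))))
          (^-monoʳ-< 2 (s≤s (s≤s z≤n)) (*-monoˡ-< x {{>-nonZero x>0}} (≤ᵇ⇒≤ 183 189 _))))
        where
        x>0 : 0 < x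
        x>0 = ≤-trans (≤-trans (≤-trans (s≤s z≤n) h≥2) (≤-trans (m≤n+m h (W + β)) (m≤m+n (W + β + h) B))) d≤x

      m≡n+h : m ≡ n + h
      m≡n+h = sym (+-assoc (W * k) β h)

      n>0 : 0 < n
      n>0 = ∤⇒>0 2 (proj₁ (avoid k prime[2] (≤-trans h≥2 h≤w)))

      -- All prime factors of n + h exceed 2^(3x), which exceeds B + h; so sifting alone makes `n`
      -- large, whatever the size of `k`.
      n>B : B < n
      n>B with prime-divisor m (≤-trans h≥2 (≤-trans (m≤n+m h n) (≤-reflexive (sym m≡n+h))))
      ... | p , pp , p∣m = +-cancelʳ-< h B n (≤-<-trans
        (≤-trans (≤-reflexive (+-comm B h)) (≤-trans (+-monoˡ-≤ B (m≤n+m h (W + β)))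
        (≤-trans d≤x (≤-trans (m≤n*m x 3) (<⇒≤ (n<2^n (3 * x)))))))
          (<-≤-trans (large-primes d q refl sifted pp (inj₂ p∣m))
            (≤-trans (∣⇒≤ {{>-nonZero m>0}} p∣m) (≤-reflexive m≡n+h))))
        where
        m>0 : 0 < m
        m>0 = ≤-trans n>0 (≤-trans (m≤m+n n h) (≤-reflexive (sym m≡n+h)))

      almost-prime : AtMost13 (n * (n + h))
      almost-prime = conclude (factorise (n * (n + h))
        {{m*n≢0 n (n + h) {{>-nonZero n>0}} {{>-nonZero (≤-trans n>0 (m≤m+n n h))}}}})
        where
        conclude : PrimeFactorisation (n * (n + h)) → AtMost13 (n * (n + h))
        conclude record { factors = ps ; isFactorisation = eq ; factorsPrime = primes } =
          ps , primes , few-factors d q refl sifted size ps primes (trans (sym eq) (cong (n *_) (sym m≡n+h))) , sym eq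

      conclusion : ∃ λ n → B < n × AtMost13 (n * (n + h))
      conclusion = n , n>B , almost-prime

    conclusion : (∃ λ k → k < 2 ^ (90 * (2 ^ d * q)) × Sift.At.Sifted W β h w sound k d q) → ∃ λ n → B < n × AtMost13
      (n * (n + h))
    conclusion (k , k< , sifted) = Candidate.conclusion k (subst (λ t → k < 2 ^ (90 * t)) (sym (doubled≡ d q)) k<)
      sifted

  many-almost-primes : ∀ h → 2 ∣ h → 2 ≤ h → ∀ B → ∃ λ n → B < n × AtMost13 (n * (n + h))
  many-almost-primes h 2∣h h≥2 B = conclusion found
    where
    open AlmostPrimes h 2∣h h≥2 (300 + h) (m≤m+n 300 h) (m≤n+m h 300) B

-- From almost-prime values to Zariski density

module ZariskiDensity where
  open AlmostPrimeValues using (AtMost13; many-almost-primes; prime-divisor)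
  open import Data.Nat as ℕ using (ℕ; zero; suc; s≤s; z≤n; _!)
  import Data.Nat.Properties as ℕₚ
  import Data.Nat.Divisibility as ℕᵈ
  open import Data.Nat.Primality
  open import Data.Nat.ListAction using (product)
  open import Data.Nat.ListAction.Properties using (product-++)
  open import Data.Integer as ℤ using (ℤ; +_; 0ℤ; 1ℤ; ∣_∣; _+_; _*_; _^_; -_)
  import Data.Integer.Properties as ℤₚ
  open import Data.Integer.Tactic.RingSolver using () renaming (solve-∀ to ℤ-solve)
  open import Data.Fin using (zero; suc)
  open import Data.List using (List; []; _∷_; _++_; length)
  open import Data.List.Properties using (length-++)
  open import Data.List.Relation.Unary.All using (All; []; _∷_)
  open import Data.List.Relation.Unary.All.Properties using () renaming (++⁺ to All-++⁺)
  open import Data.Vec as Vec using (Vec; []; _∷_)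
  open import Data.Vec.Relation.Unary.All as VecAll using ([]; _∷_)
  open import Data.Product
  open import Data.Sum using (inj₁; inj₂; [_,_]′)
  open import Data.Empty using (⊥-elim)
  open import Relation.Binary.PropositionalEquality
  open import Relation.Nullary

  -- Polynomial functions on ℤ

  horner : List ℤ → ℤ → ℤ
  horner [] t = 0ℤ
  horner (c ∷ cs) t = c + t * horner cs t

  IsPoly : (ℤ → ℤ) → Set
  IsPoly f = ∃ λ cs → ∀ t → f t ≡ horner cs t

  addₗ : List ℤ → List ℤ → List ℤ
  addₗ [] ds = ds
  addₗ (c ∷ cs) [] = c ∷ cs
  addₗ (c ∷ cs) (d ∷ ds) = c + d ∷ addₗ cs ds

  horner-add : ∀ cs ds t → horner (addₗ cs ds) t ≡ horner cs t + horner ds t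
  horner-add [] ds t = sym (ℤₚ.+-identityˡ _)
  horner-add (c ∷ cs) [] t = sym (ℤₚ.+-identityʳ _)
  horner-add (c ∷ cs) (d ∷ ds) t = trans (cong (λ s → c + d + t * s) (horner-add cs ds t))
    (e c d t (horner cs t) (horner ds t))
    where
    e : ∀ c d t x y → c + d + t * (x + y) ≡ c + t * x + (d + t * y)
    e = ℤ-solve

  mulₗ : List ℤ → List ℤ → List ℤ
  mulₗ [] ds = []
  mulₗ (c ∷ cs) ds = addₗ (Data.List.map (c *_) ds) (0ℤ ∷ mulₗ cs ds)

  horner-scale : ∀ c ds t → horner (Data.List.map (c *_) ds) t ≡ c * horner ds t
  horner-scale c [] t = sym (ℤₚ.*-zeroʳ c)
  horner-scale c (d ∷ ds) t = trans (cong (λ s → c * d + t * s) (horner-scale c ds t)) (e c d t (horner ds t))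
    where
    e : ∀ c d t x → c * d + t * (c * x) ≡ c * (d + t * x)
    e = ℤ-solve

  horner-mul : ∀ cs ds t → horner (mulₗ cs ds) t ≡ horner cs t * horner ds t
  horner-mul [] ds t = sym (ℤₚ.*-zeroˡ (horner ds t))
  horner-mul (c ∷ cs) ds t = trans (horner-add (Data.List.map (c *_) ds) (0ℤ ∷ mulₗ cs ds) t)
    (trans (cong₂ (λ a b → a + (0ℤ + t * b)) (horner-scale c ds t) (horner-mul cs ds t))
      (e c t (horner cs t) (horner ds t)))
    where
    e : ∀ c t x y → c * y + (0ℤ + t * (x * y)) ≡ (c + t * x) * y
    e = ℤ-solve

  cst : ∀ c → IsPoly (λ _ → c)
  cst c = c ∷ [] , λ t → e c t
    where
    e : ∀ c t → c ≡ c + t * 0ℤ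
    e = ℤ-solve

  var : IsPoly (λ t → t)
  var = 0ℤ ∷ 1ℤ ∷ [] , e
    where
    e : ∀ t → t ≡ 0ℤ + t * (1ℤ + t * 0ℤ)
    e = ℤ-solve

  infixl 6 _⟨+⟩_
  infixl 7 _⟨*⟩_
  infixr 8 _⟨^⟩_

  _⟨+⟩_ : ∀ {f g} → IsPoly f → IsPoly g → IsPoly (λ t → f t + g t)
  (cs , p) ⟨+⟩ (ds , q) = addₗ cs ds , λ t → trans (cong₂ _+_ (p t) (q t)) (sym (horner-add cs ds t))

  _⟨*⟩_ : ∀ {f g} → IsPoly f → IsPoly g → IsPoly (λ t → f t * g t)
  (cs , p) ⟨*⟩ (ds , q) = mulₗ cs ds , λ t → trans (cong₂ _*_ (p t) (q t)) (sym (horner-mul cs ds t))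

  _⟨^⟩_ : ∀ {f} → IsPoly f → ∀ n → IsPoly (λ t → f t ^ n)
  p ⟨^⟩ zero = cst 1ℤ
  p ⟨^⟩ suc n = p ⟨*⟩ p ⟨^⟩ n

  poly-neg : ∀ {f} → IsPoly f → IsPoly (λ t → - f t)
  poly-neg {f} (cs , p) = Data.List.map (ℤ.-1ℤ *_) cs , λ t → trans (cong -_ (p t))
    (trans (sym (ℤₚ.-1*i≡-i (horner cs t))) (sym (horner-scale ℤ.-1ℤ cs t)))

  -- Infinitude of the zeros in the form the divisibility argument consumes: one beyond any given
  -- size.
  UnboundedZeros : (ℤ → ℤ) → Set
  UnboundedZeros f = ∀ B → ∃ λ t → B ℕ.< ∣ t ∣ × f t ≡ 0ℤ

  -- A zero t of c + t g(t) divides c, so c = 0 once |t| > |c|.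
  horner-zero : ∀ cs → UnboundedZeros (horner cs) → ∀ t → horner cs t ≡ 0ℤ
  horner-zero [] z t = refl
  horner-zero (c ∷ cs) z t = trans (cong₂ (λ a b → a + t * b) c≡0 (horner-zero cs zs t))
    (trans (ℤₚ.+-identityˡ _) (ℤₚ.*-zeroʳ t))
    where
    abs-divides : ∀ t → horner (c ∷ cs) t ≡ 0ℤ → ∣ t ∣ ℕᵈ.∣ ∣ c ∣
    abs-divides t eq = ℕᵈ.divides ∣ horner cs t ∣
      (trans (cong ∣_∣ (e c t (horner cs t) eq)) (trans (ℤₚ.∣-i∣≡∣i∣ (horner cs t * t)) (ℤₚ.abs-* (horner cs t) t)))
      where
      e₁ : ∀ c t x → c ≡ (c + t * x) + - (x * t)
      e₁ = ℤ-solve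
      e : ∀ c t x → c + t * x ≡ 0ℤ → c ≡ - (x * t)
      e c t x eq = trans (e₁ c t x) (trans (cong (_+ - (x * t)) eq) (ℤₚ.+-identityˡ _))
    c≡0 : c ≡ 0ℤ
    c≡0 with ∣ c ∣ in eqc | z ∣ c ∣
    ... | zero | _ = ℤₚ.∣i∣≡0⇒i≡0 eqc
    ... | suc n | s , big , eq = ⊥-elim (ℕₚ.<⇒≱ big (ℕᵈ.∣⇒≤ (subst (∣ s ∣ ℕᵈ.∣_) eqc (abs-divides s eq))))
    zs : UnboundedZeros (horner cs)
    zs B with z B
    ... | s , big , eq = s , big , [ (λ s≡0 → ⊥-elim (ℕₚ.<⇒≱ big (subst (ℕ._≤ B) (sym (cong ∣_∣ s≡0)) ℕ.z≤n))) ,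
      (λ x → x) ]′
      (ℤₚ.i*j≡0⇒i≡0∨j≡0 s (trans (sym (ℤₚ.+-identityˡ _)) (trans (cong (_+ s * horner cs s) (sym c≡0)) eq)))

  poly-zero : ∀ {f} → IsPoly f → UnboundedZeros f → ∀ t → f t ≡ 0ℤ
  poly-zero (cs , p) z t = trans (p t) (horner-zero cs (λ B → let s , big , eq = z B in s , big , trans (sym (p s)) eq) t)

  at : ∀ {n} → Vec (ℤ → ℤ) n → ℤ → Vec ℤ n
  at fs t = Vec.map (λ f → f t) fs

  monomial-poly : ∀ {n} (fs : Vec (ℤ → ℤ) n) (e : Vec ℕ n) → VecAll.All IsPoly fs →
    IsPoly (λ t → Vec.foldr (λ _ → ℤ) _*_ 1ℤ (Vec.zipWith _^_ (at fs t) e))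
  monomial-poly [] [] [] = cst 1ℤ
  monomial-poly (f ∷ fs) (k ∷ e) (p ∷ ps) = (p ⟨^⟩ k) ⟨*⟩ monomial-poly fs e ps

  eval-poly : ∀ F (fs : Vec (ℤ → ℤ) 7) → VecAll.All IsPoly fs → IsPoly (λ t → eval F (at fs t))
  eval-poly [] fs ps = cst 0ℤ
  eval-poly ((c , e) ∷ F) fs ps = (cst c ⟨*⟩ monomial-poly fs e ps) ⟨+⟩ eval-poly F fs ps

  ^-distribʳ-* : ∀ a b n → (a * b) ^ n ≡ a ^ n * b ^ n
  ^-distribʳ-* a b zero = refl
  ^-distribʳ-* a b (suc n) = trans (cong (a * b *_) (^-distribʳ-* a b n)) (e a b (a ^ n) (b ^ n))
    where
    e : ∀ a b x y → a * b * (x * y) ≡ a * x * (b * y)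
    e = ℤ-solve

  monomial-scale : ∀ {n} k (x : Vec ℤ n) (e : Vec ℕ n) → Vec.foldr (λ _ → ℤ) _*_ 1ℤ
    (Vec.zipWith _^_ (Vec.map (k *_) x) e) ≡
    k ^ Vec.foldr (λ _ → ℕ) ℕ._+_ 0 e * Vec.foldr (λ _ → ℤ) _*_ 1ℤ (Vec.zipWith _^_ x e)
  monomial-scale k [] [] = refl
  monomial-scale k (a ∷ x) (n ∷ e) = trans (cong₂ _*_ (^-distribʳ-* k a n) (monomial-scale k x e))
    (trans (r (k ^ n) (a ^ n) _ _) (cong (_* (a ^ n * Vec.foldr (λ _ → ℤ) _*_ 1ℤ (Vec.zipWith _^_ x e)))
      (sym (ℤₚ.^-distribˡ-+-* k n (Vec.foldr (λ _ → ℕ) ℕ._+_ 0 e)))))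
    where
    r : ∀ a b c d → a * b * (c * d) ≡ a * c * (b * d)
    r = ℤ-solve

  eval-scale : ∀ {d} F → Homogeneous d F → ∀ k x → eval F (Vec.map (k *_) x) ≡ k ^ d * eval F x
  eval-scale {d} [] [] k x = sym (ℤₚ.*-zeroʳ (k ^ d))
  eval-scale {d} ((c , e) ∷ F) (refl ∷ hs) k x = trans
    (cong₂ (λ a b → c * a + b) (monomial-scale k x e) (eval-scale F hs k x))
    (r c (k ^ d) _ _)
    where
    r : ∀ c t a b → c * (t * a) + t * b ≡ t * (c * a + b)
    r = ℤ-solve

  ^≢0 : ∀ k n → ¬ k ≡ 0ℤ → ¬ k ^ n ≡ 0ℤ
  ^≢0 k zero k≢0 ()
  ^≢0 k (suc n) k≢0 eq = [ k≢0 , ^≢0 k n k≢0 ]′ (ℤₚ.i*j≡0⇒i≡0∨j≡0 k eq)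

  unscale : ∀ {d} F → Homogeneous d F → ∀ k x → ¬ k ≡ 0ℤ → eval F (Vec.map (k *_) x) ≡ 0ℤ → eval F x ≡ 0ℤ
  unscale {d} F hom k x k≢0 eq = [ (λ z → ⊥-elim (^≢0 k d k≢0 z)) , (λ z → z) ]′
    (ℤₚ.i*j≡0⇒i≡0∨j≡0 (k ^ d) (trans (sym (eval-scale F hom k x)) eq))

  scale-zero : ∀ {d} F → Homogeneous d F → ∀ k x → eval F x ≡ 0ℤ → eval F (Vec.map (k *_) x) ≡ 0ℤ
  scale-zero {d} F hom k x eq = trans (eval-scale F hom k x) (trans (cong (k ^ d *_) eq) (ℤₚ.*-zeroʳ (k ^ d)))

  -- The point with x₅ = X, x₆ = A, x₃ = B, up to the common factor X².
  ψ : ℤ → ℤ → ℤ → Vec ℤ 7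
  ψ A B X = B * c ∷ A * B * X ∷ A * c ∷ B * (X * X) ∷ c * X ∷ X * (X * X) ∷ A * (X * X) ∷ []
    where c = - (A * A + B * X)

  -- All entries of `ψ` are homogeneous of degree 3 in A, B, X together. This reduces `X` to 1,
  -- though only where the first two arguments are multiples of `X`.
  ψ-scale : ∀ A B X → ψ (X * A) (X * B) X ≡ Vec.map (X * (X * X) *_) (ψ A B 1ℤ)
  ψ-scale A B X = vec (e₀ A B X) (e₁ A B X) (e₂ A B X) (e₃ B X) (e₄ A B X) (e₅ X) (e₃ A X)
    where
    vec : ∀ {a b c d e f g a′ b′ c′ d′ e′ f′ g′ : ℤ} → a ≡ a′ → b ≡ b′ → c ≡ c′ → d ≡ d′ → e ≡ e′ → f ≡ f′ → g ≡ g′ →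
      _≡_ {A = Vec ℤ 7} (a ∷ b ∷ c ∷ d ∷ e ∷ f ∷ g ∷ []) (a′ ∷ b′ ∷ c′ ∷ d′ ∷ e′ ∷ f′ ∷ g′ ∷ [])
    vec refl refl refl refl refl refl refl = refl
    e₀ : ∀ A B X → X * B * - (X * A * (X * A) + X * B * X) ≡ X * (X * X) * (B * - (A * A + B * 1ℤ))
    e₀ = ℤ-solve
    e₁ : ∀ A B X → X * A * (X * B) * X ≡ X * (X * X) * (A * B * 1ℤ)
    e₁ = ℤ-solve
    e₂ : ∀ A B X → X * A * - (X * A * (X * A) + X * B * X) ≡ X * (X * X) * (A * - (A * A + B * 1ℤ))
    e₂ = ℤ-solve
    e₃ : ∀ B X → X * B * (X * X) ≡ X * (X * X) * (B * (1ℤ * 1ℤ))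
    e₃ = ℤ-solve
    e₄ : ∀ A B X → - (X * A * (X * A) + X * B * X) * X ≡ X * (X * X) * (- (A * A + B * 1ℤ) * 1ℤ)
    e₄ = ℤ-solve
    e₅ : ∀ X → X * (X * X) ≡ X * (X * X) * (1ℤ * (1ℤ * 1ℤ))
    e₅ = ℤ-solve

  -- From the chart to the torsor

  prime-above : ∀ B → ∃ λ p → Prime p × B ℕ.< p
  prime-above B with prime-divisor (suc (B !)) (s≤s (ℕ.>-nonZero⁻¹ (B !) {{B ℕₚ.!≢0}}))
  ... | p , pp , d = p , pp , ℕₚ.≰⇒> (λ p≤B → ¬prime[1]
    (subst Prime (ℕᵈ.∣1⇒≡1 (ℕᵈ.∣m+n∣m⇒∣n (subst (p ℕᵈ.∣_) (ℕₚ.+-comm 1 (B !)) d) (p∣! p≤B))) pp))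
    where
    p∣! : p ℕ.≤ B → p ℕᵈ.∣ B !
    p∣! p≤B = ℕᵈ.∣-trans (self p (prime⇒nonZero pp)) (ℕᵈ.m≤n⇒m!∣n! p≤B)
      where
      self : ∀ p → ℕ.NonZero p → p ℕᵈ.∣ p !
      self (suc p) _ = ℕᵈ.m∣m*n (p !)

  vec≡ : ∀ {a b c d e f g a′ b′ c′ d′ e′ f′ g′ : ℤ} → a ≡ a′ → b ≡ b′ → c ≡ c′ → d ≡ d′ → e ≡ e′ → f ≡ f′ → g ≡ g′ →
    _≡_ {A = Vec ℤ 7} (a ∷ b ∷ c ∷ d ∷ e ∷ f ∷ g ∷ []) (a′ ∷ b′ ∷ c′ ∷ d′ ∷ e′ ∷ f′ ∷ g′ ∷ [])
  vec≡ refl refl refl refl refl refl refl = refl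

  coordProduct-chart : ∀ a b c → coordProduct (φ 1ℤ 1ℤ 1ℤ 1ℤ a b c) ≡ (a * (b * c)) * ((a * (b * c)) * (a * (b * c)))
  coordProduct-chart = e
    where
    e : ∀ a b c → b * c * (1ℤ * a * b * (1ℤ * a * c * (1ℤ * b * (1ℤ * c * (1ℤ * (1ℤ * a * 1ℤ)))))) ≡ (a * (b * c)) *
      ((a * (b * c)) * (a * (b * c)))
    e = ℤ-solve

  chart-sifted : ∀ p n → Prime p → AtMost13 (n ℕ.* (n ℕ.+ 2 ℕ.* p ℕ.* (2 ℕ.* p))) →
    S 45 (φ 1ℤ 1ℤ 1ℤ 1ℤ (+ (2 ℕ.* p)) (+ n) (- (+ (n ℕ.+ 2 ℕ.* p ℕ.* (2 ℕ.* p)))))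
  chart-sifted p n pp (ps , primes , len , prod) = coprime , in-X₀ , ps³ , primes³ , length³ , product³
    where
    m = n ℕ.+ 2 ℕ.* p ℕ.* (2 ℕ.* p)
    a b c : ℤ
    a = + (2 ℕ.* p)
    b = + n
    c = - (+ m)
    coprime : Primitive (φ 1ℤ 1ℤ 1ℤ 1ℤ a b c)
    -- The coordinate x₅ equals 1 on this chart.
    coprime k d = ℕᵈ.∣1⇒≡1 (d (suc (suc (suc (suc (suc zero))))))
    torsor : OnTorsor 1ℤ 1ℤ 1ℤ 1ℤ a b c
    torsor = trans (cong (λ t → 1ℤ * a ^ 2 + 1ℤ * b + 1ℤ * - t)
      (trans (ℤₚ.pos-+ n (2 ℕ.* p ℕ.* (2 ℕ.* p))) (cong (λ t → b + t) (ℤₚ.pos-* (2 ℕ.* p) (2 ℕ.* p))))) (e a b)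
      where
      e : ∀ a b → 1ℤ * (a * (a * 1ℤ)) + 1ℤ * b + 1ℤ * - (b + a * a) ≡ 0ℤ
      e = ℤ-solve
    in-X₀ : InX₀ (φ 1ℤ 1ℤ 1ℤ 1ℤ a b c)
    in-X₀ d F hom vanishes = vanishes 1ℤ 1ℤ 1ℤ 1ℤ a b c torsor
    qs = 2 ∷ p ∷ ps
    ps³ = qs ++ (qs ++ qs)
    primes³ : All Prime ps³
    primes³ = All-++⁺ qs-prime (All-++⁺ qs-prime qs-prime)
      where
      qs-prime : All Prime qs
      qs-prime = prime[2] ∷ pp ∷ primes
    length³ : length ps³ ℕ.≤ 45
    length³ = ℕₚ.≤-trans (ℕₚ.≤-reflexive (trans (length-++ qs) (cong (length qs ℕ.+_) (length-++ qs))))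
      (ℕₚ.+-mono-≤ len15 (ℕₚ.+-mono-≤ len15 len15))
      where
      len15 : length qs ℕ.≤ 15
      len15 = s≤s (s≤s len)
    product³ : product ps³ ≡ ∣ coordProduct (φ 1ℤ 1ℤ 1ℤ 1ℤ a b c) ∣
    product³ = trans (product-++ qs (qs ++ qs)) (trans (cong (product qs ℕ.*_) (product-++ qs qs))
      (sym (trans (cong ∣_∣ (coordProduct-chart a b c)) abs³)))
      where
      abc : ∣ a * (b * c) ∣ ≡ product qs
      abc = trans (ℤₚ.abs-* a (b * c)) (trans (cong (2 ℕ.* p ℕ.*_)
        (trans (ℤₚ.abs-* b c) (trans (cong (n ℕ.*_) (ℤₚ.∣-i∣≡∣i∣ (+ m))) (sym prod)))) (ℕₚ.*-assoc 2 p (product ps)))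
      abs³ : ∣ (a * (b * c)) * ((a * (b * c)) * (a * (b * c))) ∣ ≡ product qs ℕ.* (product qs ℕ.* product qs)
      abs³ = trans (ℤₚ.abs-* y (y * y)) (cong₂ ℕ._*_ abc (trans (ℤₚ.abs-* y y) (cong₂ ℕ._*_ abc abc)))
        where
        y = a * (b * c)

  φ-poly : ∀ F {a b c d e f g} → IsPoly a → IsPoly b → IsPoly c → IsPoly d → IsPoly e → IsPoly f → IsPoly g →
    IsPoly (λ t → eval F (φ (a t) (b t) (c t) (d t) (e t) (f t) (g t)))
  φ-poly F {a} {b} {c} {d} {e} {f} {g} η₁ η₂ η₃ η₄ α₁ α₂ α₃ = eval-poly F
    ( (λ t → f t * g t)
    ∷ (λ t → η^ (a t) (b t) (c t) (d t) 1 1 1 0 * e t * f t)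
    ∷ (λ t → η^ (a t) (b t) (c t) (d t) 1 1 0 1 * e t * g t)
    ∷ (λ t → η^ (a t) (b t) (c t) (d t) 2 1 2 1 * f t)
    ∷ (λ t → η^ (a t) (b t) (c t) (d t) 2 1 1 2 * g t)
    ∷ (λ t → η^ (a t) (b t) (c t) (d t) 4 2 3 3)
    ∷ (λ t → η^ (a t) (b t) (c t) (d t) 3 2 2 2 * e t)
    ∷ [])
    (α₂ ⟨*⟩ α₃ ∷ η 1 1 1 0 ⟨*⟩ α₁ ⟨*⟩ α₂ ∷ η 1 1 0 1 ⟨*⟩ α₁ ⟨*⟩ α₃ ∷ η 2 1 2 1 ⟨*⟩ α₂ ∷ η 2 1 1 2 ⟨*⟩ α₃ ∷ η 4 2 3 3 ∷
      η 3 2 2 2 ⟨*⟩ α₁ ∷ [])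
    where
    η : ∀ i j k l → IsPoly (λ t → η^ (a t) (b t) (c t) (d t) i j k l)
    η i j k l = (η₁ ⟨^⟩ i) ⟨*⟩ (η₂ ⟨^⟩ j) ⟨*⟩ (η₃ ⟨^⟩ k) ⟨*⟩ (η₄ ⟨^⟩ l)

  ψ-poly : ∀ F {a b} X → IsPoly a → IsPoly b → IsPoly (λ t → eval F (ψ (a t) (b t) X))
  ψ-poly F {a} {b} X A B = eval-poly F
    ( (λ t → b t * γ t) ∷ (λ t → a t * b t * X) ∷ (λ t → a t * γ t) ∷ (λ t → b t * (X * X)) ∷ (λ t → γ t * X) ∷
      (λ t → X * (X * X)) ∷ (λ t → a t * (X * X)) ∷ [])
    (B ⟨*⟩ C ∷ A ⟨*⟩ B ⟨*⟩ cst X ∷ A ⟨*⟩ C ∷ B ⟨*⟩ cst (X * X) ∷ C ⟨*⟩ cst X ∷ cst (X * (X * X)) ∷ A ⟨*⟩ cst (X * X) ∷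
      [])
    where
    γ : ℤ → ℤ
    γ t = - (a t * a t + b t * X)
    C : IsPoly γ
    C = poly-neg (A ⟨*⟩ A ⟨+⟩ B ⟨*⟩ cst X)

  ψ-chart : ∀ A B C → A * A + B + C ≡ 0ℤ → ψ A B 1ℤ ≡ φ 1ℤ 1ℤ 1ℤ 1ℤ A B C
  ψ-chart A B C eq = trans (vec≡ (cong (B *_) c≡) (e₁ A B) (trans (cong (A *_) c≡) (e₂ A C)) (e₃ B)
    (trans (cong (_* 1ℤ) c≡) (e₄ C)) refl (e₅ A)) refl
    where
    e₀ : ∀ A B C → - (A * A + B * 1ℤ) ≡ C + - (A * A + B + C)
    e₀ = ℤ-solve
    c≡ : - (A * A + B * 1ℤ) ≡ C
    c≡ = trans (e₀ A B C) (trans (cong (λ t → C + - t) eq) (ℤₚ.+-identityʳ C))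
    e₁ : ∀ A B → A * B * 1ℤ ≡ 1ℤ * A * B
    e₁ = ℤ-solve
    e₂ : ∀ A C → A * C ≡ 1ℤ * A * C
    e₂ = ℤ-solve
    e₃ : ∀ B → B * (1ℤ * 1ℤ) ≡ 1ℤ * B
    e₃ = ℤ-solve
    e₄ : ∀ C → C * 1ℤ ≡ 1ℤ * C
    e₄ = ℤ-solve
    e₅ : ∀ A → A * (1ℤ * 1ℤ) ≡ 1ℤ * A
    e₅ = ℤ-solve

  module Charts (d : ℕ) (F : Poly) (hom : Homogeneous d F) (zero-on-S : ∀ x → S 45 x → eval F x ≡ 0ℤ) where

    chart-zero : ∀ A B → eval F (ψ A B 1ℤ) ≡ 0ℤ
    chart-zero A B = poly-zero (ψ-poly F 1ℤ var (cst B)) (λ N → doubled-prime (prime-above N)) A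
      where
      at-prime : ∀ p → Prime p → ∀ B → eval F (ψ (+ (2 ℕ.* p)) B 1ℤ) ≡ 0ℤ
      at-prime p pp = poly-zero (ψ-poly F 1ℤ (cst (+ (2 ℕ.* p))) var) zeros
        where
        h = 2 ℕ.* p ℕ.* (2 ℕ.* p)
        instance _ = prime⇒nonZero pp
        instance _ = ℕₚ.m*n≢0 2 p
        torsor : ∀ n → + (2 ℕ.* p) * + (2 ℕ.* p) + + n + - (+ (n ℕ.+ h)) ≡ 0ℤ
        torsor n = trans (cong (λ t → + (2 ℕ.* p) * + (2 ℕ.* p) + + n + - t)
          (trans (ℤₚ.pos-+ n h) (cong (λ t → + n + t) (ℤₚ.pos-* (2 ℕ.* p) (2 ℕ.* p))))) (e (+ (2 ℕ.* p)) (+ n))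
          where
          e : ∀ a b → a * a + b + - (b + a * a) ≡ 0ℤ
          e = ℤ-solve
        zero-at : ∀ {N} → (∃ λ n → N ℕ.< n × AtMost13 (n ℕ.* (n ℕ.+ h))) → ∃ λ t → N ℕ.< ∣ t ∣ × eval F
          (ψ (+ (2 ℕ.* p)) t 1ℤ) ≡ 0ℤ
        zero-at (n , N<n , few) = + n , N<n , trans (cong (eval F)
          (ψ-chart (+ (2 ℕ.* p)) (+ n) (- (+ (n ℕ.+ h))) (torsor n))) (zero-on-S _ (chart-sifted p n pp few))
        zeros : UnboundedZeros (λ B → eval F (ψ (+ (2 ℕ.* p)) B 1ℤ))
        zeros N = zero-at (many-almost-primes h (ℕᵈ.∣m⇒∣m*n (2 ℕ.* p) (ℕᵈ.m∣m*n p))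
          (ℕₚ.≤-trans (ℕₚ.m≤m*n 2 p) (ℕₚ.m≤m*n (2 ℕ.* p) (2 ℕ.* p))) N)
      doubled-prime : ∀ {N} → (∃ λ p → Prime p × N ℕ.< p) → ∃ λ t → N ℕ.< ∣ t ∣ × eval F (ψ t B 1ℤ) ≡ 0ℤ
      doubled-prime (p , pp , N<p) = + (2 ℕ.* p) , ℕₚ.<-≤-trans N<p (ℕₚ.m≤n*m p 2) , at-prime p pp B

    multiples-unbounded : ∀ (f : ℤ → ℤ) X → ¬ X ≡ 0ℤ → (∀ B → f (X * B) ≡ 0ℤ) → UnboundedZeros f
    multiples-unbounded f X X≢0 z N = X * + suc N , subst (N ℕ.<_) (sym (ℤₚ.abs-* X (+ suc N)))
      (ℕₚ.m≤n*m (suc N) ∣ X ∣ {{ℕ.≢-nonZero (λ eq → X≢0 (ℤₚ.∣i∣≡0⇒i≡0 eq))}}) , z (+ suc N)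

    -- `ψ-scale` settles the arguments that are multiples of `X`. These are unbounded, so the
    -- polynomial argument frees `B` and then `A`.
    ψ-zero : ∀ X → ¬ X ≡ 0ℤ → ∀ A B → eval F (ψ A B X) ≡ 0ℤ
    ψ-zero X X≢0 A B = poly-zero (ψ-poly F X var (cst B)) (multiples-unbounded (λ A → eval F (ψ A B X)) X X≢0
      (λ A → poly-zero (ψ-poly F X (cst (X * A)) var) (multiples-unbounded (λ B → eval F (ψ (X * A) B X)) X X≢0
        (λ B → trans (cong (eval F) (ψ-scale A B X)) (scale-zero F hom (X * (X * X)) (ψ A B 1ℤ) (chart-zero A B))))
          B)) A

  -- With M = η₁²η₂η₃η₄ and μ = η₁η₂η₃η₄, the coordinates of φ are x₃ = Mη₃α₂, x₄ = Mη₄α₃, x₅ = M²η₃η₄, x₆ = Mμα₁,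
  -- and the torsor equation becomes x₆² + x₃x₅ + x₄x₅ = 0.
  module _ (η₁ η₂ η₃ η₄ α₁ α₂ α₃ : ℤ) (torsor : OnTorsor η₁ η₂ η₃ η₄ α₁ α₂ α₃) where

    private
      M ν κ μ A B X C : ℤ
      M = η₁ * η₁ * η₂ * η₃ * η₄
      ν = η₁ * η₂ * η₃
      κ = η₁ * η₂ * η₄
      μ = ν * η₄
      A = M * μ * α₁
      B = M * η₃ * α₂
      X = M * M * η₃ * η₄
      C = M * η₄ * α₃

    φ-coordinates : φ η₁ η₂ η₃ η₄ α₁ α₂ α₃ ≡ α₂ * α₃ ∷ ν * α₁ * α₂ ∷ κ * α₁ * α₃ ∷ B ∷ C ∷ X ∷ A ∷ []
    φ-coordinates = vec≡ refl (e₁ η₁ η₂ η₃ α₁ α₂) (e₂ η₁ η₂ η₄ α₁ α₃) (e₃ η₁ η₂ η₃ η₄ α₂) (e₄ η₁ η₂ η₃ η₄ α₃)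
      (e₅ η₁ η₂ η₃ η₄) (e₆ η₁ η₂ η₃ η₄ α₁)
      where
      e₁ : ∀ η₁ η₂ η₃ α₁ α₂ → (η₁ * 1ℤ) * (η₂ * 1ℤ) * (η₃ * 1ℤ) * 1ℤ * α₁ * α₂ ≡ η₁ * η₂ * η₃ * α₁ * α₂
      e₁ = ℤ-solve
      e₂ : ∀ η₁ η₂ η₄ α₁ α₃ → (η₁ * 1ℤ) * (η₂ * 1ℤ) * 1ℤ * (η₄ * 1ℤ) * α₁ * α₃ ≡ η₁ * η₂ * η₄ * α₁ * α₃
      e₂ = ℤ-solve
      e₃ : ∀ η₁ η₂ η₃ η₄ α₂ → (η₁ * (η₁ * 1ℤ)) * (η₂ * 1ℤ) * (η₃ * (η₃ * 1ℤ)) * (η₄ * 1ℤ) * α₂ ≡ η₁ * η₁ * η₂ * η₃ *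
        η₄ * η₃ * α₂
      e₃ = ℤ-solve
      e₄ : ∀ η₁ η₂ η₃ η₄ α₃ → (η₁ * (η₁ * 1ℤ)) * (η₂ * 1ℤ) * (η₃ * 1ℤ) * (η₄ * (η₄ * 1ℤ)) * α₃ ≡ η₁ * η₁ * η₂ * η₃ *
        η₄ * η₄ * α₃
      e₄ = ℤ-solve
      e₅ : ∀ η₁ η₂ η₃ η₄ → (η₁ * (η₁ * (η₁ * (η₁ * 1ℤ)))) * (η₂ * (η₂ * 1ℤ)) * (η₃ * (η₃ * (η₃ * 1ℤ))) *
        (η₄ * (η₄ * (η₄ * 1ℤ))) ≡ (η₁ * η₁ * η₂ * η₃ * η₄) * (η₁ * η₁ * η₂ * η₃ * η₄) * η₃ * η₄
      e₅ = ℤ-solve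
      e₆ : ∀ η₁ η₂ η₃ η₄ α₁ → (η₁ * (η₁ * (η₁ * 1ℤ))) * (η₂ * (η₂ * 1ℤ)) * (η₃ * (η₃ * 1ℤ)) * (η₄ * (η₄ * 1ℤ)) * α₁ ≡
        (η₁ * η₁ * η₂ * η₃ * η₄) * (η₁ * η₂ * η₃ * η₄) * α₁
      e₆ = ℤ-solve

    -- As μ² = M η₂ η₃ η₄, the sum A² + B X + C X is M³ η₃ η₄ times the torsor equation.
    residual : - (A * A + B * X) ≡ C * X
    residual = trans (e₁ M μ η₃ η₄ α₁ α₂ α₃) (trans
      (cong (λ t → C * X + - (M * M * t * (α₁ * α₁) + M * M * M * η₃ * η₄ * (η₃ * α₂ + η₄ * α₃))) (e₂ η₁ η₂ η₃ η₄))
      (trans (e₃ (C * X) M η₂ η₃ η₄ α₁ α₂ α₃) (trans (cong (λ t → C * X + - (M * M * M * η₃ * η₄ * t)) torsor)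
        (e₄ (C * X) (M * M * M * η₃ * η₄)))))
      where
      e₁ : ∀ M μ η₃ η₄ α₁ α₂ α₃ → - ((M * μ * α₁) * (M * μ * α₁) + (M * η₃ * α₂) * (M * M * η₃ * η₄)) ≡
        (M * η₄ * α₃) * (M * M * η₃ * η₄) + - (M * M * (μ * μ) * (α₁ * α₁) + M * M * M * η₃ * η₄ * (η₃ * α₂ + η₄ * α₃))
      e₁ = ℤ-solve
      e₂ : ∀ η₁ η₂ η₃ η₄ → (η₁ * η₂ * η₃ * η₄) * (η₁ * η₂ * η₃ * η₄) ≡ (η₁ * η₁ * η₂ * η₃ * η₄) * η₂ * η₃ * η₄
      e₂ = ℤ-solve
      e₃ : ∀ Y M η₂ η₃ η₄ α₁ α₂ α₃ → Y + - (M * M * (M * η₂ * η₃ * η₄) * (α₁ * α₁) + M * M * M * η₃ * η₄ *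
        (η₃ * α₂ + η₄ * α₃)) ≡
        Y + - (M * M * M * η₃ * η₄ * (η₂ * (α₁ * (α₁ * 1ℤ)) + η₃ * α₂ + η₄ * α₃))
      e₃ = ℤ-solve
      e₄ : ∀ Y Z → Y + - (Z * 0ℤ) ≡ Y
      e₄ = ℤ-solve

    ψ-torsor : ψ A B X ≡ Vec.map (X * X *_) (φ η₁ η₂ η₃ η₄ α₁ α₂ α₃)
    ψ-torsor = trans (vec≡
        (trans (cong (B *_) residual) (e₀ M η₃ η₄ α₂ α₃))
        (e₁ M ν η₃ η₄ α₁ α₂)
        (trans (cong₂ (λ t Y → M * t * α₁ * Y) (e₅ η₁ η₂ η₃ η₄) residual) (e₂ M κ η₃ η₄ α₁ α₃))
        (ℤₚ.*-comm B (X * X))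
        (trans (cong (_* X) residual) (e₃ C X))
        (ℤₚ.*-comm X (X * X))
        (ℤₚ.*-comm A (X * X)))
      (cong (Vec.map (X * X *_)) (sym φ-coordinates))
      where
      e₀ : ∀ M η₃ η₄ α₂ α₃ → (M * η₃ * α₂) * ((M * η₄ * α₃) * (M * M * η₃ * η₄)) ≡ (M * M * η₃ * η₄) *
        (M * M * η₃ * η₄) * (α₂ * α₃)
      e₀ = ℤ-solve
      e₁ : ∀ M ν η₃ η₄ α₁ α₂ → (M * (ν * η₄) * α₁) * (M * η₃ * α₂) * (M * M * η₃ * η₄) ≡ (M * M * η₃ * η₄) *
        (M * M * η₃ * η₄) * (ν * α₁ * α₂)
      e₁ = ℤ-solve
      e₂ : ∀ M κ η₃ η₄ α₁ α₃ → (M * (κ * η₃) * α₁) * ((M * η₄ * α₃) * (M * M * η₃ * η₄)) ≡ (M * M * η₃ * η₄) *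
        (M * M * η₃ * η₄) * (κ * α₁ * α₃)
      e₂ = ℤ-solve
      e₃ : ∀ C X → C * X * X ≡ X * X * C
      e₃ = ℤ-solve
      e₅ : ∀ η₁ η₂ η₃ η₄ → η₁ * η₂ * η₃ * η₄ ≡ η₁ * η₂ * η₄ * η₃
      e₅ = ℤ-solve

  *≢0 : ∀ {a b} → ¬ a ≡ 0ℤ → ¬ b ≡ 0ℤ → ¬ a * b ≡ 0ℤ
  *≢0 {a} {b} a≢0 b≢0 eq = [ a≢0 , b≢0 ]′ (ℤₚ.i*j≡0⇒i≡0∨j≡0 a eq)

  linear≢0 : ∀ {b} → ¬ b ≡ 0ℤ → ∀ c t → ∣ c ∣ ℕ.< ∣ t ∣ → ¬ c + b * t ≡ 0ℤ
  linear≢0 {b} b≢0 c t c<t eq = ℕₚ.<⇒≱ c<t (ℕₚ.≤-trans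
    (ℕₚ.m≤n*m ∣ t ∣ ∣ b ∣ {{ℕ.≢-nonZero (λ z → b≢0 (ℤₚ.∣i∣≡0⇒i≡0 z))}})
    (ℕₚ.≤-reflexive (trans (sym (ℤₚ.abs-* b t)) (trans
      (cong ∣_∣ (trans (e c (b * t)) (trans (cong (_+ - c) eq) (ℤₚ.+-identityˡ (- c))))) (ℤₚ.∣-i∣≡∣i∣ c)))))
    where
    e : ∀ c s → s ≡ (c + s) + - c
    e = ℤ-solve

  nonzero-unbounded : ∀ f → (∀ t → ¬ t ≡ 0ℤ → f t ≡ 0ℤ) → UnboundedZeros f
  nonzero-unbounded f z N = + suc N , ℕₚ.≤-refl , z (+ suc N) (λ ())

  module Torsor (d : ℕ) (F : Poly) (hom : Homogeneous d F) (zero-on-S : ∀ x → S 45 x → eval F x ≡ 0ℤ) where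
    open Charts d F hom zero-on-S using (ψ-zero)

    η-nonzero : ∀ η₁ η₂ η₃ η₄ α₁ α₂ α₃ → OnTorsor η₁ η₂ η₃ η₄ α₁ α₂ α₃ →
      ¬ η₁ ≡ 0ℤ → ¬ η₂ ≡ 0ℤ → ¬ η₃ ≡ 0ℤ → ¬ η₄ ≡ 0ℤ → eval F (φ η₁ η₂ η₃ η₄ α₁ α₂ α₃) ≡ 0ℤ
    η-nonzero η₁ η₂ η₃ η₄ α₁ α₂ α₃ torsor n₁ n₂ n₃ n₄ =
      unscale F hom (X * X) (φ η₁ η₂ η₃ η₄ α₁ α₂ α₃) (*≢0 X≢0 X≢0)
        (trans (cong (eval F) (sym (ψ-torsor η₁ η₂ η₃ η₄ α₁ α₂ α₃ torsor)))
          (ψ-zero X X≢0 (M * (η₁ * η₂ * η₃ * η₄) * α₁) (M * η₃ * α₂)))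
      where
      M = η₁ * η₁ * η₂ * η₃ * η₄
      X = M * M * η₃ * η₄
      M≢0 : ¬ M ≡ 0ℤ
      M≢0 = *≢0 (*≢0 (*≢0 (*≢0 n₁ n₁) n₂) n₃) n₄
      X≢0 : ¬ X ≡ 0ℤ
      X≢0 = *≢0 (*≢0 (*≢0 M≢0 M≢0) n₃) n₄

    -- Move along a curve in the torsor on which η₃ stays fixed and the other ηᵢ become nonzero.
    η₃-nonzero : ∀ η₁ η₂ η₃ η₄ α₁ α₂ α₃ → OnTorsor η₁ η₂ η₃ η₄ α₁ α₂ α₃ → ¬ η₃ ≡ 0ℤ → eval F (φ η₁ η₂ η₃ η₄ α₁ α₂ α₃)
      ≡ 0ℤ
    η₃-nonzero η₁ η₂ η₃ η₄ α₁ α₂ α₃ torsor n₃ = trans (sym at-0) (poly-zero f-poly zeros 0ℤ)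
      where
      f : ℤ → ℤ
      -- Moving η₂ and η₄ by η₃ t changes the equation by η₃ t (α₁² + α₃), a multiple of η₃ that α₂
      -- compensates without division.
      f t = eval F (φ (η₁ + 1ℤ * t) (η₂ + η₃ * t) η₃ (η₄ + η₃ * t) α₁ (α₂ + - (α₁ ^ 2 + α₃) * t) α₃)
      line : ∀ a b → IsPoly (λ t → a + b * t)
      line a b = cst a ⟨+⟩ cst b ⟨*⟩ var
      f-poly : IsPoly f
      f-poly = φ-poly F (line η₁ 1ℤ) (line η₂ η₃) (cst η₃) (line η₄ η₃) (cst α₁) (line α₂ (- (α₁ ^ 2 + α₃))) (cst α₃)
      at-0 : f 0ℤ ≡ eval F (φ η₁ η₂ η₃ η₄ α₁ α₂ α₃)
      at-0 = trans (cong₂ (λ a b → eval F (φ a b η₃ (η₄ + η₃ * 0ℤ) α₁ (α₂ + - (α₁ ^ 2 + α₃) * 0ℤ) α₃)) (e η₁ 1ℤ)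
        (e η₂ η₃))
        (cong₂ (λ a b → eval F (φ η₁ η₂ η₃ a α₁ b α₃)) (e η₄ η₃) (e α₂ (- (α₁ ^ 2 + α₃))))
        where
        e : ∀ a b → a + b * 0ℤ ≡ a
        e = ℤ-solve
      on-curve : ∀ t → OnTorsor (η₁ + 1ℤ * t) (η₂ + η₃ * t) η₃ (η₄ + η₃ * t) α₁ (α₂ + - (α₁ ^ 2 + α₃) * t) α₃
      on-curve t = trans (e η₂ η₃ η₄ α₁ α₂ α₃ t) torsor
        where
        e : ∀ η₂ η₃ η₄ α₁ α₂ α₃ t → (η₂ + η₃ * t) * (α₁ * (α₁ * 1ℤ)) + η₃ * (α₂ + - ((α₁ * (α₁ * 1ℤ)) + α₃) * t) +
          (η₄ + η₃ * t) * α₃ ≡ η₂ * (α₁ * (α₁ * 1ℤ)) + η₃ * α₂ + η₄ * α₃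
        e = ℤ-solve
      zero-beyond : ∀ t → ∣ η₁ ∣ ℕ.< ∣ t ∣ → ∣ η₂ ∣ ℕ.< ∣ t ∣ → ∣ η₄ ∣ ℕ.< ∣ t ∣ → f t ≡ 0ℤ
      zero-beyond t big₁ big₂ big₄ = η-nonzero (η₁ + 1ℤ * t) (η₂ + η₃ * t) η₃ (η₄ + η₃ * t) α₁
        (α₂ + - (α₁ ^ 2 + α₃) * t) α₃ (on-curve t)
        (linear≢0 {1ℤ} (λ ()) η₁ t big₁) (linear≢0 n₃ η₂ t big₂) n₃ (linear≢0 n₃ η₄ t big₄)
      zeros : UnboundedZeros f
      zeros N = t , s≤s (ℕₚ.m≤m+n N _) , zero-beyond t big₁ big₂ big₄
        where
        t = + suc (N ℕ.+ (∣ η₁ ∣ ℕ.+ (∣ η₂ ∣ ℕ.+ ∣ η₄ ∣)))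
        big₁ : ∣ η₁ ∣ ℕ.< ∣ t ∣
        big₁ = s≤s (ℕₚ.≤-trans (ℕₚ.m≤m+n _ _) (ℕₚ.m≤n+m _ N))
        big₂ : ∣ η₂ ∣ ℕ.< ∣ t ∣
        big₂ = s≤s (ℕₚ.≤-trans (ℕₚ.m≤m+n _ ∣ η₄ ∣) (ℕₚ.≤-trans (ℕₚ.m≤n+m _ ∣ η₁ ∣) (ℕₚ.m≤n+m _ N)))
        big₄ : ∣ η₄ ∣ ℕ.< ∣ t ∣
        big₄ = s≤s (ℕₚ.≤-trans (ℕₚ.m≤n+m _ ∣ η₂ ∣) (ℕₚ.≤-trans (ℕₚ.m≤n+m _ ∣ η₁ ∣) (ℕₚ.m≤n+m _ N)))

    -- The point lies at t = 0 on the curve with η₃ = η₄ t, where α₃ - α₂ t restores the equation.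
    η₄-nonzero : ∀ η₁ η₂ η₄ α₁ α₂ α₃ → OnTorsor η₁ η₂ 0ℤ η₄ α₁ α₂ α₃ → ¬ η₄ ≡ 0ℤ → eval F (φ η₁ η₂ 0ℤ η₄ α₁ α₂ α₃) ≡ 0ℤ
    η₄-nonzero η₁ η₂ η₄ α₁ α₂ α₃ torsor n₄ = trans (sym at-0) (poly-zero f-poly (nonzero-unbounded f zero-at) 0ℤ)
      where
      f : ℤ → ℤ
      f t = eval F (φ η₁ η₂ (η₄ * t) η₄ α₁ α₂ (α₃ + - α₂ * t))
      f-poly : IsPoly f
      f-poly = φ-poly F (cst η₁) (cst η₂) (cst η₄ ⟨*⟩ var) (cst η₄) (cst α₁) (cst α₂) (cst α₃ ⟨+⟩ cst (- α₂) ⟨*⟩ var)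
      at-0 : f 0ℤ ≡ eval F (φ η₁ η₂ 0ℤ η₄ α₁ α₂ α₃)
      at-0 = cong₂ (λ a b → eval F (φ η₁ η₂ a η₄ α₁ α₂ b)) (ℤₚ.*-zeroʳ η₄) (e α₃ (- α₂))
        where
        e : ∀ a b → a + b * 0ℤ ≡ a
        e = ℤ-solve
      zero-at : ∀ t → ¬ t ≡ 0ℤ → f t ≡ 0ℤ
      zero-at t t≢0 = η₃-nonzero η₁ η₂ (η₄ * t) η₄ α₁ α₂ (α₃ + - α₂ * t) (trans (e η₂ η₄ α₁ α₂ α₃ t) torsor)
        (*≢0 n₄ t≢0)
        where
        e : ∀ η₂ η₄ α₁ α₂ α₃ t → η₂ * (α₁ * (α₁ * 1ℤ)) + η₄ * t * α₂ + η₄ * (α₃ + - α₂ * t) ≡ η₂ * (α₁ * (α₁ * 1ℤ)) +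
          0ℤ * α₂ + η₄ * α₃
        e = ℤ-solve

    -- If η₃ = η₄ = 0 only x₀ = α₂α₃ survives, and (x₀ : 0 : ⋯ : 0) is the limit t → 0 of the curve below.
    both-zero : ∀ η₁ η₂ α₁ α₂ α₃ → eval F (φ η₁ η₂ 0ℤ 0ℤ α₁ α₂ α₃) ≡ 0ℤ
    both-zero η₁ η₂ α₁ α₂ α₃ = trans (cong (eval F) at-0) (poly-zero f-poly (nonzero-unbounded f zero-at) 0ℤ)
      where
      f : ℤ → ℤ
      -- With η₃ = η₄ = t² and α₁ = t every term of the equation carries t², and η₂ = -(α₂ + α₃)
      -- makes the coefficients cancel.
      f t = eval F (φ 1ℤ (- (α₂ + α₃)) (t * t) (t * t) t α₂ α₃)
      f-poly : IsPoly f
      f-poly = φ-poly F (cst 1ℤ) (cst (- (α₂ + α₃))) (var ⟨*⟩ var) (var ⟨*⟩ var) var (cst α₂) (cst α₃)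
      at-0 : φ η₁ η₂ 0ℤ 0ℤ α₁ α₂ α₃ ≡ φ 1ℤ (- (α₂ + α₃)) (0ℤ * 0ℤ) (0ℤ * 0ℤ) 0ℤ α₂ α₃
      at-0 = vec≡ refl (e₁ η₁ η₂ α₁ α₂ α₃) (e₂ η₁ η₂ α₁ α₂ α₃) (e₃ η₁ η₂ α₂ α₃) (e₄ η₁ η₂ α₂ α₃) (e₅ η₁ η₂ α₂ α₃)
        (e₆ η₁ η₂ α₁ α₂ α₃)
        where
        e₁ : ∀ η₁ η₂ α₁ α₂ α₃ → (η₁ * 1ℤ) * (η₂ * 1ℤ) * 0ℤ * 1ℤ * α₁ * α₂ ≡ 1ℤ * ((- (α₂ + α₃)) * 1ℤ) * 0ℤ * 1ℤ * 0ℤ *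
          α₂
        e₁ = ℤ-solve
        e₂ : ∀ η₁ η₂ α₁ α₂ α₃ → (η₁ * 1ℤ) * (η₂ * 1ℤ) * 1ℤ * 0ℤ * α₁ * α₃ ≡ 1ℤ * ((- (α₂ + α₃)) * 1ℤ) * 1ℤ * 0ℤ * 0ℤ *
          α₃
        e₂ = ℤ-solve
        e₃ : ∀ η₁ η₂ α₂ α₃ → (η₁ * (η₁ * 1ℤ)) * (η₂ * 1ℤ) * 0ℤ * 0ℤ * α₂ ≡ 1ℤ * ((- (α₂ + α₃)) * 1ℤ) * 0ℤ * 0ℤ * α₂
        e₃ = ℤ-solve
        e₄ : ∀ η₁ η₂ α₂ α₃ → (η₁ * (η₁ * 1ℤ)) * (η₂ * 1ℤ) * 0ℤ * 0ℤ * α₃ ≡ 1ℤ * ((- (α₂ + α₃)) * 1ℤ) * 0ℤ * 0ℤ * α₃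
        e₄ = ℤ-solve
        e₅ : ∀ η₁ η₂ α₂ α₃ → (η₁ * (η₁ * (η₁ * (η₁ * 1ℤ)))) * (η₂ * (η₂ * 1ℤ)) * 0ℤ * 0ℤ ≡ 1ℤ *
          ((- (α₂ + α₃)) * ((- (α₂ + α₃)) * 1ℤ)) * 0ℤ * 0ℤ
        e₅ = ℤ-solve
        e₆ : ∀ η₁ η₂ α₁ α₂ α₃ → (η₁ * (η₁ * (η₁ * 1ℤ))) * (η₂ * (η₂ * 1ℤ)) * 0ℤ * 0ℤ * α₁ ≡ 1ℤ *
          ((- (α₂ + α₃)) * ((- (α₂ + α₃)) * 1ℤ)) * 0ℤ * 0ℤ * 0ℤ
        e₆ = ℤ-solve
      zero-at : ∀ t → ¬ t ≡ 0ℤ → f t ≡ 0ℤ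
      zero-at t t≢0 = η₃-nonzero 1ℤ (- (α₂ + α₃)) (t * t) (t * t) t α₂ α₃ (e α₂ α₃ t) (*≢0 t≢0 t≢0)
        where
        e : ∀ α₂ α₃ t → - (α₂ + α₃) * (t * (t * 1ℤ)) + t * t * α₂ + t * t * α₃ ≡ 0ℤ
        e = ℤ-solve

    vanishes : VanishesOnX₀ F
    vanishes η₁ η₂ η₃ η₄ α₁ α₂ α₃ torsor with η₃ ℤ.≟ 0ℤ | η₄ ℤ.≟ 0ℤ
    ... | no n₃ | _ = η₃-nonzero η₁ η₂ η₃ η₄ α₁ α₂ α₃ torsor n₃
    ... | yes refl | no n₄ = η₄-nonzero η₁ η₂ η₄ α₁ α₂ α₃ torsor n₄
    ... | yes refl | yes refl = both-zero η₁ η₂ α₁ α₂ α₃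

theorem1p2 : ZariskiDenseInX₀ (S 45)
theorem1p2 d F hom zero-on-S = ZariskiDensity.Torsor.vanishes d F hom zero-on-S
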